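{- Let $\phi=\frac{1+\sqrt5}{2}$. Then \[ \lim_{g\to\infty}\frac{1}{g^4}\mathbb{E}_g[w(S)^2]=\left(\frac{1}{10\phi}\right)^2. \]
   Context: A numerical semigroup $S$ is a submonoid of $\mathbb{N}_0$ with finite complement; $\mathcal{H}(S)=\mathbb{N}_0\setminus S$ is the set of gaps and $g=|\mathcal{H}(S)|$ is the genus. The weight is $w(S)=\left(\sum_{x\in\mathcal{H}(S)}x\right)-\frac{g(g+1)}{2}$. $\mathbb{E}_g$ denotes expectation for the uniform distribution on the finite set $\mathcal{S}_g$ of numerical semigroups of genus $g$. -}

module Defs where

open import Data.Nat as ℕ using (ℕ; zero; suc; _≟_)
open import Data.Bool using (Bool; true; false; not; _∧_; _∨_)
open import Data.List using (List; []; _∷_; map; _++_; filterᵇ; length; upTo)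
open import Data.Bool.ListAction using (all; any)
open import Data.Nat.ListAction using (sum)
open import Data.Integer using (ℤ; +_)
open import Data.Rational.Unnormalised using (ℚᵘ; mkℚᵘ; 0ℚᵘ; _<_; _≤_; _*_; _-_; _+_)
open import Relation.Nullary.Decidable using (⌊_⌋)
open import Data.Product using (_×_)
open import Data.Sum using (_⊎_)

-- Numerical semigroups of genus g, represented by their gap sets H(S).
-- A numerical semigroup S of genus g has all gaps in {1,…,2g-1}
-- (standard bound), so H(S) ⊆ {0,…,2g}.  We enumerate all subsets H of
-- {0,…,2g} and keep those with |H| = g, 0 ∉ H, and ℕ∖H closed under +
-- (closure only needs checking for sums ≤ 2g, since larger numbers
-- are never in H).

subsets : List ℕ → List (List ℕ)
subsets []       = [] ∷ []
subsets (x ∷ xs) = map (x ∷_) (subsets xs) ++ subsets xs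

_∈ᵇ_ : ℕ → List ℕ → Bool
x ∈ᵇ H = any (λ y → ⌊ x ≟ y ⌋) H

-- ℕ ∖ H is a submonoid of ℕ (with H ⊆ {0,…,B}, checking sums in range)
isMonoidComplement : ℕ → List ℕ → Bool
isMonoidComplement B H =
  not (0 ∈ᵇ H) ∧
  all (λ x → all (λ y → (x ∈ᵇ H ∨ y ∈ᵇ H) ∨ not ((x ℕ.+ y) ∈ᵇ H)) (upTo (suc B)))
      (upTo (suc B))

gapSets : ℕ → List (List ℕ)
gapSets g = filterᵇ (λ H → ⌊ length H ≟ g ⌋ ∧ isMonoidComplement (2 ℕ.* g) H)
                   (subsets (upTo (suc (2 ℕ.* g))))

-- weight w(S) = Σ_{x ∈ H(S)} x − g(g+1)/2   (this is ≥ 0, so ∸ is exact)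
weight : List ℕ → ℕ
weight H = sum H ℕ.∸ (length H ℕ.* suc (length H)) ℕ./ 2

-- n / d as an unnormalised rational (d ≥ 1 in all uses)
frac : ℕ → ℕ → ℚᵘ
frac n zero    = 0ℚᵘ
frac n (suc d) = mkℚᵘ (+ n) d

normalisedSecondMoment : ℕ → ℚᵘ
normalisedSecondMoment g =
  frac (sum (map (λ H → weight H ℕ.* weight H) (gapSets g)))
       (length (gapSets g) ℕ.* (g ℕ.^ 4))

-- The limit L = (1/(10φ))², φ = (1+√5)/2.  Since 1/φ² = (3−√5)/2,
-- L = (3 − √5)/200.  L is irrational, so we describe it by its Dedekind
-- cut in ℚ:  q < L  ⇔  √5 < 3 − 200q,   L < q  ⇔  3 − 200q < √5.

_<√5 : ℚᵘ → Set
r <√5 = r ≤ 0ℚᵘ ⊎ r * r < mkℚᵘ (+ 5) 0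

√5<_ : ℚᵘ → Set
√5< r = 0ℚᵘ < r × mkℚᵘ (+ 5) 0 < r * r

c3-200 : ℚᵘ → ℚᵘ
c3-200 q = mkℚᵘ (+ 3) 0 - mkℚᵘ (+ 200) 0 * q

_<L : ℚᵘ → Set
q <L = √5< c3-200 q

L<_ : ℚᵘ → Set
L< q = c3-200 q <√5

-- A numerical semigroup of multiplicity m and genus g is a word k 1 … k (m − 1) of Kunz coordinates with sum g.
-- Words over {1 , 2} are the tilings of length g, counted by the Fibonacci number Z g. For such a word u, even after
-- a bounded prefix, the weight is up to O(g) the number of pairs i < j with u i = 1 and u j = 2. The second moment of
-- this number over the tilings obeys a linear recurrence and is g⁴ Z (g − 2) / 100 + O(g³ Z g), where
-- Z (g − 2) / Z g tends to 1/φ².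
--
-- The other semigroups are negligible. Let q ≥ 3 be the largest coordinate, l its last position and a the first
-- position of a 1. Then k i + k (l − i) ≥ q before l, k i + k (l + m − i) ≥ q − 1 after l, and k (i + a) ≤ k i + 1:
-- mirrored coordinates form pairs, and the pairs form chains of step a. Give a word of sum s the weight x^s with
-- x = 31/50, slightly above 1/φ. A transfer operator bounds the total weight of these chains: the factor 20/17 lost
-- at each free start of a chain after l is regained at the positions below a, whose coordinates are at least 2.
-- Hence there are at most poly(g) x^(−g) semigroups with q ≥ 4, and those with q = 3 decay geometrically in l.
module Submission where

open import Defs
open import Data.Nat using (ℕ; zero; suc; pred; _+_; _*_; _∸_; _^_; _≤_; _<_; z≤n; s≤s; NonZero; _≤?_; _<?_; _≟_; _<ᵇ_; _≤ᵇ_; _⊓_; ⌊_/2⌋; _/_; _%_; >-nonZero)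
open import Data.Nat.Properties
open import Data.Nat.DivMod
open import Data.Nat.Tactic.RingSolver using (solve-∀)
open import Data.Nat.ListAction using (sum)
open import Data.Nat.ListAction.Properties using (sum-++; sum-↭)
open import Data.Bool using (Bool; true; false; not; _∧_; _∨_; if_then_else_)
open import Data.Bool.Properties using (T?; T-≡; ∨-zeroʳ)
open import Data.Bool.ListAction using (all)
open import Data.List using (List; []; _∷_; _++_; _∷ʳ_; map; concatMap; filterᵇ; length; upTo; applyUpTo; take; drop)
open import Data.List.Properties using (map-++; map-id; ++-assoc; take-all; take++drop≡id; map-∘; length-++; length-map; upTo-∷ʳ; applyUpTo-∷ʳ; length-applyUpTo; length-upTo; map-upTo; ∷-injectiveˡ; ∷-injectiveʳ)
open import Data.List.Membership.Propositional using (_∈_; _∉_)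
open import Data.List.Membership.Propositional.Properties using (∈-map⁺; ∈-map⁻; ∈-++⁺ˡ; ∈-++⁺ʳ; ∈-++⁻; ∈-filter⁺; ∈-filter⁻; ∈-upTo⁺; ∈-upTo⁻; ∈-∃++; ∈-applyUpTo⁺; ∈-applyUpTo⁻)
open import Data.List.Relation.Unary.Any using (here; there)
open import Data.List.Relation.Unary.All as All using (All; []; _∷_)
import Data.List.Relation.Unary.All.Properties as AllP
open import Data.List.Relation.Unary.AllPairs using ([]; _∷_)
open import Data.List.Relation.Unary.Unique.Propositional using (Unique)
import Data.List.Relation.Unary.Unique.Propositional.Properties as Uniq
open import Data.List.Relation.Binary.Permutation.Propositional using (_↭_; prep; ↭-refl; ↭-trans; ↭-reflexive)
open import Data.List.Relation.Binary.Permutation.Propositional.Properties using (map⁺; ↭-length; ∈-resp-↭; shift)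
open import Data.Product using (Σ; ∃; _×_; _,_; proj₁; proj₂)
open import Data.Sum using (_⊎_; inj₁; inj₂; [_,_]′)
open import Data.Empty using (⊥; ⊥-elim)
open import Data.Unit using (tt)
open import Function using (_∘_; id; Equivalence)
open import Relation.Nullary using (¬_; yes; no; contradiction)
open import Relation.Nullary.Decidable using (⌊_⌋)
open import Relation.Binary.PropositionalEquality using (_≡_; refl; sym; trans; cong; cong₂; subst; subst₂; module ≡-Reasoning)
open import Relation.Binary.Definitions using (tri<; tri≈; tri>)
import Data.Integer as ℤ
import Data.Integer.Properties as ℤP
open import Data.Rational.Unnormalised as ℚ using (ℚᵘ; mkℚᵘ; 0ℚᵘ; *≤*; *<*; *≡*)
import Data.Rational.Unnormalised.Properties as ℚP

-- Independent pairs would not suffice. With x = 31/50 the pairs (p, r) with p, r ≤ Q ≤ p + r weigh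
-- about 1.16 for Q = 3 and 1.07 for Q = 4; only from Q = 5 on is their weight at most 1. This is
-- why chains enter for 3 ≤ q ≤ 5, and why the transfer inequalities are needed just for Q = 3, 4,
-- 5, where they are verified by evaluation. The base 31/50 lies above 13/21, which lies above 1/φ.
-- Since 31 · 21 = 651 and 50 · 13 = 650, comparing x^(-g) with Z g gains a factor (650/651)^g,
-- which beats every polynomial.
--
-- Every admissible prefix p of fixed length D can be continued by every tiling of g - sum p, and in
-- each such class the mean squared weight is asymptotic to the same g⁴ / (100 φ²), so the classes
-- can be summed without being counted. All estimates are kept in ℕ with denominators cleared, and
-- 1/φ² enters only through two ratios Z n / Z (n + 2) of opposite parity that enclose it.

-- Certificate for a linear inequality: it follows from X ≤ Y, with slack d.
lin : ∀ {X Y a b} d → X ≤ Y → b + X ≡ a + Y + d → a ≤ b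
lin {X} {Y} {a} {b} d X≤Y eq = +-cancelʳ-≤ X a b (begin
  a + X ≤⟨ +-monoʳ-≤ a X≤Y ⟩
  a + Y ≤⟨ m≤m+n (a + Y) d ⟩
  a + Y + d ≡⟨ eq ⟨
  b + X ∎)
  where open ≤-Reasoning

infixr 5 _⊕_
_⊕_ : ∀ {a b c d} → a ≤ b → c ≤ d → a + c ≤ b + d
_⊕_ = +-mono-≤

-- Finite sums and counting

sumTo : ℕ → (ℕ → ℕ) → ℕ
sumTo zero    f = 0
sumTo (suc n) f = sumTo n f + f n

sumTo-cong : ∀ n {f h} → (∀ i → i < n → f i ≡ h i) → sumTo n f ≡ sumTo n h
sumTo-cong zero    eq = refl
sumTo-cong (suc n) eq = cong₂ _+_ (sumTo-cong n (λ i i<n → eq i (m≤n⇒m≤1+n i<n))) (eq n ≤-refl)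

sumTo-mono : ∀ n {f h} → (∀ i → i < n → f i ≤ h i) → sumTo n f ≤ sumTo n h
sumTo-mono zero    le = z≤n
sumTo-mono (suc n) le = sumTo-mono n (λ i i<n → le i (m≤n⇒m≤1+n i<n)) ⊕ le n ≤-refl

sumTo-+ : ∀ n f h → sumTo n (λ i → f i + h i) ≡ sumTo n f + sumTo n h
sumTo-+ zero    f h = refl
sumTo-+ (suc n) f h = trans (cong (_+ (f n + h n)) (sumTo-+ n f h)) (lem (sumTo n f) (sumTo n h) (f n) (h n))
  where
  lem : ∀ a b c d → a + b + (c + d) ≡ a + c + (b + d)
  lem = solve-∀

sumTo-*ʳ : ∀ n f c → sumTo n (λ i → f i * c) ≡ sumTo n f * c
sumTo-*ʳ zero    f c = refl
sumTo-*ʳ (suc n) f c = trans (cong (_+ f n * c) (sumTo-*ʳ n f c)) (sym (*-distribʳ-+ c (sumTo n f) (f n)))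

sumTo-const : ∀ n c → sumTo n (λ _ → c) ≡ n * c
sumTo-const zero    c = refl
sumTo-const (suc n) c = trans (cong (_+ c) (sumTo-const n c)) (+-comm (n * c) c)

sumTo-0 : ∀ n f → (∀ i → i < n → f i ≡ 0) → sumTo n f ≡ 0
sumTo-0 n f eq = trans (sumTo-cong n eq) (trans (sumTo-const n 0) (*-zeroʳ n))

sumTo-split : ∀ n k f → sumTo (n + k) f ≡ sumTo n f + sumTo k (λ i → f (n + i))
sumTo-split n zero    f = trans (cong (λ z → sumTo z f) (+-identityʳ n)) (sym (+-identityʳ _))
sumTo-split n (suc k) f = begin
  sumTo (n + suc k) f ≡⟨ cong (λ z → sumTo z f) (+-suc n k) ⟩
  sumTo (n + k) f + f (n + k) ≡⟨ cong (_+ f (n + k)) (sumTo-split n k f) ⟩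
  sumTo n f + sumTo k (λ i → f (n + i)) + f (n + k) ≡⟨ +-assoc (sumTo n f) _ _ ⟩
  sumTo n f + (sumTo k (λ i → f (n + i)) + f (n + k)) ∎
  where open ≡-Reasoning

sumTo-front : ∀ n f → sumTo (suc n) f ≡ f 0 + sumTo n (f ∘ suc)
sumTo-front n f = sumTo-split 1 n f

sumTo-reverse : ∀ n f → sumTo (suc n) (λ i → f (n ∸ i)) ≡ sumTo (suc n) f
sumTo-reverse zero    f = refl
sumTo-reverse (suc n) f = begin
  sumTo (suc (suc n)) (λ i → f (suc n ∸ i)) ≡⟨ sumTo-front (suc n) _ ⟩
  f (suc n) + sumTo (suc n) (λ i → f (n ∸ i)) ≡⟨ cong (f (suc n) +_) (sumTo-reverse n f) ⟩
  f (suc n) + sumTo (suc n) f ≡⟨ +-comm (f (suc n)) _ ⟩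
  sumTo (suc (suc n)) f ∎
  where open ≡-Reasoning

sumTo-swap : ∀ n k (f : ℕ → ℕ → ℕ) →
  sumTo n (λ i → sumTo k (λ j → f i j)) ≡ sumTo k (λ j → sumTo n (λ i → f i j))
sumTo-swap zero    k f = sym (sumTo-0 k _ (λ _ _ → refl))
sumTo-swap (suc n) k f = trans (cong (_+ sumTo k (f n)) (sumTo-swap n k f)) (sym (sumTo-+ k _ _))

sumTo-blocks : ∀ Q m f → sumTo (Q * m) f ≡ sumTo Q (λ j → sumTo m (λ i → f (i + j * m)))
sumTo-blocks zero    m f = refl
sumTo-blocks (suc Q) m f = begin
  sumTo (m + Q * m) f ≡⟨ cong (λ z → sumTo z f) (+-comm m (Q * m)) ⟩
  sumTo (Q * m + m) f ≡⟨ sumTo-split (Q * m) m f ⟩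
  sumTo (Q * m) f + sumTo m (λ i → f (Q * m + i)) ≡⟨ cong₂ _+_ (sumTo-blocks Q m f)
                                                             (sumTo-cong m (λ i _ → cong f (+-comm (Q * m) i))) ⟩
  sumTo Q (λ j → sumTo m (λ i → f (i + j * m))) + sumTo m (λ i → f (i + Q * m)) ∎
  where open ≡-Reasoning

sumTo-≤-extend : ∀ {n k} f → n ≤ k → sumTo n f ≤ sumTo k f
sumTo-≤-extend {n} {k} f n≤k = begin
  sumTo n f ≤⟨ m≤m+n _ _ ⟩
  sumTo n f + sumTo (k ∸ n) (λ i → f (n + i)) ≡⟨ sumTo-split n (k ∸ n) f ⟨
  sumTo (n + (k ∸ n)) f ≡⟨ cong (λ z → sumTo z f) (m+[n∸m]≡n n≤k) ⟩
  sumTo k f ∎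
  where open ≤-Reasoning

sumTo-tail-0 : ∀ {n k} f → n ≤ k → (∀ i → n ≤ i → f i ≡ 0) → sumTo n f ≡ sumTo k f
sumTo-tail-0 {n} {k} f n≤k z = begin
  sumTo n f ≡⟨ +-identityʳ _ ⟨
  sumTo n f + 0 ≡⟨ cong (sumTo n f +_) (sumTo-0 (k ∸ n) _ (λ i _ → z (n + i) (m≤m+n n i))) ⟨
  sumTo n f + sumTo (k ∸ n) (λ i → f (n + i)) ≡⟨ sumTo-split n (k ∸ n) f ⟨
  sumTo (n + (k ∸ n)) f ≡⟨ cong (λ z → sumTo z f) (m+[n∸m]≡n n≤k) ⟩
  sumTo k f ∎
  where open ≡-Reasoning

term≤sumTo : ∀ {n i} f → i < n → f i ≤ sumTo n f
term≤sumTo {n} {i} f i<n = ≤-trans (m≤n+m (f i) (sumTo i f)) (sumTo-≤-extend {suc i} {n} f i<n)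

b2n : Bool → ℕ
b2n true  = 1
b2n false = 0

b2n≤1 : ∀ b → b2n b ≤ 1
b2n≤1 true  = ≤-refl
b2n≤1 false = z≤n

<ᵇ-true : ∀ {m n} → m < n → (m <ᵇ n) ≡ true
<ᵇ-true p = Equivalence.to T-≡ (<⇒<ᵇ p)

<ᵇ-false : ∀ {m n} → n ≤ m → (m <ᵇ n) ≡ false
<ᵇ-false {m} {n} p with m <ᵇ n in eq
... | false = refl
... | true  = contradiction (<ᵇ⇒< m n (Equivalence.from T-≡ eq)) (≤⇒≯ p)

<ᵇ-true⁻ : ∀ {m n} → (m <ᵇ n) ≡ true → m < n
<ᵇ-true⁻ {m} {n} eq = <ᵇ⇒< m n (Equivalence.from T-≡ eq)

<ᵇ-false⁻ : ∀ {m n} → (m <ᵇ n) ≡ false → n ≤ m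
<ᵇ-false⁻ {m} {n} eq = ≮⇒≥ (λ p → contradiction (trans (sym (<ᵇ-true p)) eq) λ ())

sumTo-below : ∀ {k Q} (h : ℕ → ℕ) → k ≤ Q → sumTo Q (λ j → h j * b2n (j <ᵇ k)) ≡ sumTo k h
sumTo-below {k} {Q} h k≤Q = trans
  (sym (sumTo-tail-0 (λ j → h j * b2n (j <ᵇ k)) k≤Q
    (λ j k≤j → trans (cong (λ b → h j * b2n b) (<ᵇ-false k≤j)) (*-zeroʳ (h j)))))
  (sumTo-cong k (λ j j<k → trans (cong (λ b → h j * b2n b) (<ᵇ-true j<k)) (*-identityʳ (h j))))

module _ {A : Set} where

  sumOn : (A → ℕ) → List A → ℕ
  sumOn f xs = sum (map f xs)

  sumOn-++ : ∀ f xs ys → sumOn f (xs ++ ys) ≡ sumOn f xs + sumOn f ys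
  sumOn-++ f xs ys = trans (cong sum (map-++ f xs ys)) (sum-++ (map f xs) (map f ys))

  sumOn-cong : ∀ {f h} xs → (∀ x → x ∈ xs → f x ≡ h x) → sumOn f xs ≡ sumOn h xs
  sumOn-cong []       eq = refl
  sumOn-cong (x ∷ xs) eq = cong₂ _+_ (eq x (here refl)) (sumOn-cong xs (λ y y∈ → eq y (there y∈)))

  sumOn-mono : ∀ {f h} xs → (∀ x → x ∈ xs → f x ≤ h x) → sumOn f xs ≤ sumOn h xs
  sumOn-mono []       le = z≤n
  sumOn-mono (x ∷ xs) le = le x (here refl) ⊕ sumOn-mono xs (λ y y∈ → le y (there y∈))

  sumOn-*ˡ : ∀ c f xs → sumOn (λ x → c * f x) xs ≡ c * sumOn f xs
  sumOn-*ˡ c f []       = sym (*-zeroʳ c)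
  sumOn-*ˡ c f (x ∷ xs) = trans (cong (c * f x +_) (sumOn-*ˡ c f xs)) (sym (*-distribˡ-+ c (f x) _))

  sumOn-+ : ∀ f h xs → sumOn (λ x → f x + h x) xs ≡ sumOn f xs + sumOn h xs
  sumOn-+ f h []       = refl
  sumOn-+ f h (x ∷ xs) = trans (cong (f x + h x +_) (sumOn-+ f h xs)) (lem (f x) (h x) (sumOn f xs) (sumOn h xs))
    where
    lem : ∀ a b c d → a + b + (c + d) ≡ a + c + (b + d)
    lem = solve-∀

  sumOn-const : ∀ c xs → sumOn (λ _ → c) xs ≡ length xs * c
  sumOn-const c []       = refl
  sumOn-const c (x ∷ xs) = cong (c +_) (sumOn-const c xs)

  length≡sumOn : ∀ (xs : List A) → length xs ≡ sumOn (λ _ → 1) xs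
  length≡sumOn xs = trans (sym (*-identityʳ _)) (sym (sumOn-const 1 xs))

  sumOn-↭ : ∀ f {xs ys} → xs ↭ ys → sumOn f xs ≡ sumOn f ys
  sumOn-↭ f p = sum-↭ (map⁺ f p)

  sumOn-filterᵇ : ∀ f (p : A → Bool) xs → sumOn f (filterᵇ p xs) ≡ sumOn (λ x → f x * b2n (p x)) xs
  sumOn-filterᵇ f p []       = refl
  sumOn-filterᵇ f p (x ∷ xs) with p x
  ... | true  = cong₂ _+_ (sym (*-identityʳ (f x))) (sumOn-filterᵇ f p xs)
  ... | false = trans (sumOn-filterᵇ f p xs) (cong (_+ sumOn (λ x → f x * b2n (p x)) xs) (sym (*-zeroʳ (f x))))

sumOn-map : ∀ {A B : Set} (f : B → ℕ) (h : A → B) xs → sumOn f (map h xs) ≡ sumOn (f ∘ h) xs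
sumOn-map f h xs = cong sum (sym (map-∘ xs))

sumOn-concatMap : ∀ {A B : Set} (f : B → ℕ) (h : A → List B) xs →
  sumOn f (concatMap h xs) ≡ sumOn (λ x → sumOn f (h x)) xs
sumOn-concatMap f h []       = refl
sumOn-concatMap f h (x ∷ xs) = trans (sumOn-++ f (h x) (concatMap h xs)) (cong (sumOn f (h x) +_) (sumOn-concatMap f h xs))

length-concatMap : ∀ {A B : Set} (h : A → List B) xs → length (concatMap h xs) ≡ sumOn (length ∘ h) xs
length-concatMap h xs = trans (length≡sumOn (concatMap h xs))
  (trans (sumOn-concatMap (λ _ → 1) h xs) (sumOn-cong xs (λ x _ → sym (length≡sumOn (h x)))))

sumOn-upTo : ∀ f n → sumOn f (upTo n) ≡ sumTo n f
sumOn-upTo f zero    = refl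
sumOn-upTo f (suc n) = begin
  sumOn f (upTo (suc n)) ≡⟨ cong (sumOn f) (upTo-∷ʳ n) ⟨
  sumOn f (upTo n ++ n ∷ []) ≡⟨ sumOn-++ f (upTo n) (n ∷ []) ⟩
  sumOn f (upTo n) + (f n + 0) ≡⟨ cong₂ _+_ (sumOn-upTo f n) (+-identityʳ (f n)) ⟩
  sumTo (suc n) f ∎
  where open ≡-Reasoning

-- A relation takes the place of an injection because a gap set is tied to its code through Kunz
-- data that are only asserted to exist. Deleting the partner of `x` from `ys` is harmless: by
-- injectivity no other element has that partner.
relational-pigeonhole : ∀ {A B : Set} (R : A → B → Set) (xs : List A) (ys : List B) → Unique xs →
  (∀ x → x ∈ xs → ∃ λ y → y ∈ ys × R x y) →
  (∀ {x x′ y} → R x y → R x′ y → x ≡ x′) → length xs ≤ length ys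
relational-pigeonhole R []       ys _          _   _   = z≤n
relational-pigeonhole R (x ∷ xs) ys (x∉ ∷ uxs) tot inj with tot x (here refl)
... | y , y∈ , Rxy with ∈-∃++ y∈
... | as , bs , refl = begin
  suc (length xs) ≤⟨ s≤s (relational-pigeonhole R xs (as ++ bs) uxs tot′ inj) ⟩
  suc (length (as ++ bs)) ≡⟨ cong suc (length-++ as) ⟩
  suc (length as + length bs) ≡⟨ +-suc (length as) (length bs) ⟨
  length as + suc (length bs) ≡⟨ length-++ as ⟨
  length (as ++ y ∷ bs) ∎
  where
  open ≤-Reasoning
  tot′ : ∀ x′ → x′ ∈ xs → ∃ λ y′ → y′ ∈ as ++ bs × R x′ y′
  tot′ x′ x′∈ with tot x′ (there x′∈)
  ... | y′ , y′∈ , R′ with ∈-++⁻ as y′∈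
  ... | inj₁ p = y′ , ∈-++⁺ˡ p , R′
  ... | inj₂ (there p) = y′ , ∈-++⁺ʳ as p , R′
  ... | inj₂ (here refl) = contradiction (inj Rxy R′) (All.lookup x∉ x′∈)

-- Used to split off the good gap sets. That no `z` lies in `xs` is what later forces every
-- remaining gap set to have a tail code.
unique-⊆-split : ∀ {A : Set} (xs ys : List A) → Unique xs → Unique ys → (∀ x → x ∈ xs → x ∈ ys) →
  ∃ λ zs → ys ↭ xs ++ zs × Unique zs × (∀ z → z ∈ zs → z ∈ ys × z ∉ xs)
unique-⊆-split []       ys _ uy _ = ys , ↭-refl , uy , λ z z∈ → z∈ , λ ()
unique-⊆-split (x ∷ xs) ys (x∉ ∷ ux) uy sub with unique-⊆-split xs ys ux uy (λ y y∈ → sub y (there y∈))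
... | zs , perm , uz , prop with ∈-++⁻ xs (∈-resp-↭ perm (sub x (here refl)))
... | inj₁ x∈xs = contradiction refl (All.lookup x∉ x∈xs)
... | inj₂ x∈zs with ∈-∃++ x∈zs
... | as , bs , refl with ∈-unique-middle as uz
  where
  ∈-unique-middle : ∀ {A : Set} {x : A} as {bs} → Unique (as ++ x ∷ bs) → Unique (as ++ bs) × x ∉ as ++ bs
  ∈-unique-middle [] (x∉ ∷ u) = u , λ x∈ → contradiction refl (All.lookup x∉ x∈)
  ∈-unique-middle {x = x} (a ∷ as) {bs} (a∉ ∷ u) with ∈-unique-middle as u
  ... | u′ , x∉ = (All.tabulate (λ {y} y∈ → All.lookup a∉ (weaken y∈)) ∷ u′) ,
      λ { (here refl) → contradiction refl (All.lookup a∉ (∈-++⁺ʳ as (here refl))) ; (there p) → x∉ p }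
    where
    weaken : ∀ {y} → y ∈ as ++ bs → y ∈ as ++ x ∷ bs
    weaken y∈ with ∈-++⁻ as y∈
    ... | inj₁ p = ∈-++⁺ˡ p
    ... | inj₂ p = ∈-++⁺ʳ as (there p)
... | uz′ , x∉zs′ = as ++ bs ,
  ↭-trans perm (↭-trans (↭-reflexive (sym (++-assoc xs as (x ∷ bs)))) (↭-trans (shift x (xs ++ as) bs) (prep x (↭-reflexive (++-assoc xs as bs))))) ,
  uz′ , λ z z∈ → proj₁ (prop z (weaken z∈)) , λ { (here refl) → x∉zs′ z∈ ; (there p) → proj₂ (prop z (weaken z∈)) p }
  where
  weaken : ∀ {y} → y ∈ as ++ bs → y ∈ as ++ x ∷ bs
  weaken y∈ with ∈-++⁻ as y∈
  ... | inj₁ p = ∈-++⁺ˡ p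
  ... | inj₂ p = ∈-++⁺ʳ as (there p)

-- Gap sets and Kunz coordinates

∈ᵇ-intro : ∀ {x xs} → x ∈ xs → (x ∈ᵇ xs) ≡ true
∈ᵇ-intro {x} (here refl) with x ≟ x
... | yes _ = refl
... | no ne = contradiction refl ne
∈ᵇ-intro {x} {y ∷ ys} (there p) with x ≟ y
... | yes _ = refl
... | no _  = ∈ᵇ-intro p

∈ᵇ-elim : ∀ {x} xs → (x ∈ᵇ xs) ≡ true → x ∈ xs
∈ᵇ-elim {x} (y ∷ ys) eq with x ≟ y
... | yes refl = here refl
... | no _     = there (∈ᵇ-elim ys eq)

≡false-from : ∀ {b} → ¬ (b ≡ true) → b ≡ false
≡false-from {true}  n = contradiction refl n
≡false-from {false} n = refl

true≢false : ∀ {b} → b ≡ true → b ≡ false → ⊥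
true≢false refl ()

∧-true⁻ : ∀ {a b} → a ∧ b ≡ true → a ≡ true × b ≡ true
∧-true⁻ {true} {true} eq = refl , refl

bool-ext : ∀ {a b} → (a ≡ true → b ≡ true) → (b ≡ true → a ≡ true) → a ≡ b
bool-ext {true}  {b}     f g = sym (f refl)
bool-ext {false} {true}  f g = g refl
bool-ext {false} {false} f g = refl

module _ {A : Set} where

  all-elim : ∀ (p : A → Bool) xs → all p xs ≡ true → ∀ x → x ∈ xs → p x ≡ true
  all-elim p (y ∷ ys) eq x (here refl) = proj₁ (∧-true⁻ eq)
  all-elim p (y ∷ ys) eq x (there x∈)  = all-elim p ys (proj₂ (∧-true⁻ {p y} eq)) x x∈

  all-intro : ∀ (p : A → Bool) xs → (∀ x → x ∈ xs → p x ≡ true) → all p xs ≡ true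
  all-intro p []       h = refl
  all-intro p (x ∷ xs) h rewrite h x (here refl) = all-intro p xs (λ y y∈ → h y (there y∈))

  ∈-filterᵇ⁻ : ∀ (p : A → Bool) {xs x} → x ∈ filterᵇ p xs → x ∈ xs × p x ≡ true
  ∈-filterᵇ⁻ p {xs} {x} x∈ with ∈-filter⁻ (T? ∘ p) {xs = xs} x∈
  ... | a , b = a , Equivalence.to T-≡ b

  ∈-filterᵇ⁺ : ∀ (p : A → Bool) {xs x} → x ∈ xs → p x ≡ true → x ∈ filterᵇ p xs
  ∈-filterᵇ⁺ p x∈ eq = ∈-filter⁺ (T? ∘ p) x∈ (Equivalence.from T-≡ eq)

  filterᵇ-cong : ∀ (p q : A → Bool) xs → (∀ x → x ∈ xs → p x ≡ q x) → filterᵇ p xs ≡ filterᵇ q xs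
  filterᵇ-cong p q []       eq = refl
  filterᵇ-cong p q (x ∷ xs) eq with p x | q x | eq x (here refl)
  ... | true  | true  | _ = cong (x ∷_) (filterᵇ-cong p q xs (λ y y∈ → eq y (there y∈)))
  ... | false | false | _ = filterᵇ-cong p q xs (λ y y∈ → eq y (there y∈))

∈-subsets⁻ : ∀ {H} xs → H ∈ subsets xs → ∀ {y} → y ∈ H → y ∈ xs
∈-subsets⁻ [] (here refl) ()
∈-subsets⁻ (x ∷ xs) H∈ y∈ with ∈-++⁻ (map (x ∷_) (subsets xs)) H∈
... | inj₂ q = there (∈-subsets⁻ xs q y∈)
... | inj₁ q with ∈-map⁻ (x ∷_) q
... | H′ , H′∈ , refl with y∈
... | here refl = here refl
... | there y∈′ = there (∈-subsets⁻ xs H′∈ y∈′)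

-- Turns a listed subset into its membership predicate, so that gap sets can be treated as Boolean
-- functions on ℕ.
subset≡filter : ∀ {H} xs → Unique xs → H ∈ subsets xs → H ≡ filterᵇ (_∈ᵇ H) xs
subset≡filter [] _ (here refl) = refl
subset≡filter {H} (x ∷ xs) (x∉ ∷ u) H∈ with ∈-++⁻ (map (x ∷_) (subsets xs)) H∈
... | inj₂ q with x ∈ᵇ H in eq
...   | true  = contradiction refl (All.lookup x∉ (∈-subsets⁻ xs q (∈ᵇ-elim H eq)))
...   | false = subset≡filter xs u q
subset≡filter {H} (x ∷ xs) (x∉ ∷ u) H∈ | inj₁ q with ∈-map⁻ (x ∷_) q
... | H′ , H′∈ , refl rewrite ∈ᵇ-intro {x} {x ∷ H′} (here refl) =
  cong (x ∷_) (trans (subset≡filter xs u H′∈) (filterᵇ-cong (_∈ᵇ H′) (_∈ᵇ (x ∷ H′)) xs λ y y∈ → skip y (λ { refl → All.lookup x∉ y∈ refl })))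
  where
  skip : ∀ y → ¬ (y ≡ x) → (y ∈ᵇ H′) ≡ (y ∈ᵇ (x ∷ H′))
  skip y ne with y ≟ x
  ... | yes eq = contradiction eq ne
  ... | no _   = refl

filter∈subsets : ∀ (p : ℕ → Bool) xs → filterᵇ p xs ∈ subsets xs
filter∈subsets p []       = here refl
filter∈subsets p (x ∷ xs) with p x
... | true  = ∈-++⁺ˡ (∈-map⁺ (x ∷_) (filter∈subsets p xs))
... | false = ∈-++⁺ʳ (map (x ∷_) (subsets xs)) (filter∈subsets p xs)

subsets-unique : ∀ xs → Unique xs → Unique (subsets xs)
subsets-unique []       _        = [] ∷ []
subsets-unique (x ∷ xs) (x∉ ∷ u) = Uniq.++⁺ (Uniq.map⁺ ∷-injectiveʳ (subsets-unique xs u)) (subsets-unique xs u)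
  λ { {H} (p , q) → disj p q }
  where
  disj : ∀ {H} → H ∈ map (x ∷_) (subsets xs) → H ∈ subsets xs → ⊥
  disj p q with ∈-map⁻ (x ∷_) p
  ... | H′ , _ , refl = All.lookup x∉ (∈-subsets⁻ xs q (here refl)) refl

gapSets-unique : ∀ g → Unique (gapSets g)
gapSets-unique g = Uniq.filter⁺ _ (subsets-unique (upTo (suc (2 * g))) (Uniq.upTo⁺ (suc (2 * g))))

record Gaps (g : ℕ) (G : ℕ → Bool) : Set where
  field
    zero-nongap : G 0 ≡ false
    closed      : ∀ x y → G x ≡ false → G y ≡ false → G (x + y) ≡ false
    bounded     : ∀ x → suc (2 * g) ≤ x → G x ≡ false

gapSet-Gaps : ∀ g {H} → H ∈ gapSets g →
  Gaps g (_∈ᵇ H) × H ≡ filterᵇ (_∈ᵇ H) (upTo (suc (2 * g))) × length H ≡ g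
gapSet-Gaps g {H} H∈ with ∈-filterᵇ⁻ (λ H → ⌊ length H ≟ g ⌋ ∧ isMonoidComplement (2 * g) H) {xs = subsets (upTo (suc (2 * g)))} H∈
... | H∈S , cond with ∧-true⁻ {⌊ length H ≟ g ⌋} cond
... | len , mon with ∧-true⁻ {not (0 ∈ᵇ H)} mon
... | nz , cl = record
    { zero-nongap = not-true nz
    ; closed = λ x y x∉ y∉ → ≡false-from (λ eq → closed′ x y x∉ y∉ eq)
    ; bounded = λ x B≤x → ≡false-from (λ eq → contradiction (H⊆ (∈ᵇ-elim H eq)) (≤⇒≯ B≤x))
    } , subset≡filter _ (Uniq.upTo⁺ (suc (2 * g))) H∈S , len≡
  where
  not-true : ∀ {b} → not b ≡ true → b ≡ false
  not-true {false} _ = refl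
  ≟-true : ∀ a b → ⌊ a ≟ b ⌋ ≡ true → a ≡ b
  ≟-true a b eq with a ≟ b
  ... | yes p = p
  ≟-true a b () | no _
  len≡ : length H ≡ g
  len≡ = ≟-true (length H) g len
  H⊆ : ∀ {x} → x ∈ H → x < suc (2 * g)
  H⊆ x∈ = ∈-upTo⁻ (∈-subsets⁻ _ H∈S x∈)
  check : ℕ → ℕ → Bool
  check x y = (x ∈ᵇ H ∨ y ∈ᵇ H) ∨ not ((x + y) ∈ᵇ H)
  -- If x + y is a gap, it is at most 2 g, so both summands lie in the range covered by the Boolean
  -- test.
  closed′ : ∀ x y → (x ∈ᵇ H) ≡ false → (y ∈ᵇ H) ≡ false → ((x + y) ∈ᵇ H) ≡ true → ⊥
  closed′ x y x∉ y∉ eq = absurd (all-elim (check x) (upTo (suc (2 * g)))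
      (all-elim (λ x → all (check x) (upTo (suc (2 * g)))) (upTo (suc (2 * g))) cl x (∈-upTo⁺ (≤-<-trans (m≤m+n x y) xy<))) y (∈-upTo⁺ (≤-<-trans (m≤n+m y x) xy<)))
    where
    xy< : x + y < suc (2 * g)
    xy< = H⊆ (∈ᵇ-elim H eq)
    absurd : check x y ≡ true → ⊥
    absurd c with () ← trans (sym c) (cong₂ (λ a b → a ∨ not b) (cong₂ _∨_ x∉ y∉) eq)

least : ∀ (p : ℕ → Bool) n → p n ≡ true → ∃ λ l → l ≤ n × p l ≡ true × (∀ i → i < l → p i ≡ false)
least p zero    pn = 0 , z≤n , pn , λ _ ()
least p (suc n) pn with p 0 in eq
... | true  = 0 , z≤n , eq , λ _ ()
... | false with least (p ∘ suc) n pn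
... | l , l≤ , pl , below = suc l , s≤s l≤ , pl , λ { zero _ → eq ; (suc i) (s≤s i<) → below i i< }

-- Kunz coordinates with respect to the multiplicity suc m: the gaps congruent to i are i + j * suc m for j < k i.
record Kunz (m : ℕ) (k : ℕ → ℕ) : Set where
  field
    k-zero : k 0 ≡ 0
    k-pos  : ∀ i → i < m → 1 ≤ k (suc i)
    k-sub  : ∀ i j → i + j ≤ m → k (i + j) ≤ k i + k j
    k-wrap : ∀ i j l → i ≤ m → j ≤ m → i + j ≡ l + suc m → k l ≤ suc (k i + k j)

gapᵇ : ℕ → (ℕ → ℕ) → ℕ → Bool
gapᵇ m k x = x / suc m <ᵇ k (x % suc m)

gapList : ℕ → ℕ → (ℕ → ℕ) → List ℕ
gapList g m k = filterᵇ (gapᵇ m k) (upTo (suc (2 * g)))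

gapᵇ-at : ∀ m k {i} j → i ≤ m → gapᵇ m k (i + j * suc m) ≡ (j <ᵇ k i)
gapᵇ-at m k {i} j i≤m = cong₂ (λ a b → a <ᵇ k b) quot (trans ([m+kn]%n≡m%n i j (suc m)) (m≤n⇒m%n≡m i≤m))
  where
  quot : (i + j * suc m) / suc m ≡ j
  quot = trans (+-distrib-/ i (j * suc m) (subst (_< suc m)
           (sym (trans (cong₂ _+_ (m≤n⇒m%n≡m i≤m) (m*n%n≡0 j (suc m))) (+-identityʳ i))) (s≤s i≤m)))
         (cong₂ _+_ (m<n⇒m/n≡0 (s≤s i≤m)) (m*n/n≡m j (suc m)))

-- Sorts the gaps by residue. Enlarging the range from B to B * suc m adds no gap and makes it a
-- union of complete blocks, so that the two summations can be exchanged.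
sum-gaps : ∀ m k B (F : ℕ → ℕ) → (∀ x → B ≤ x → gapᵇ m k x ≡ false) →
  sumTo B (λ x → F x * b2n (gapᵇ m k x)) ≡ sumTo (suc m) (λ i → sumTo (k i) (λ j → F (i + j * suc m)))
sum-gaps m k B F bd = begin
  sumTo B f ≡⟨ sumTo-tail-0 f (m≤m*n B (suc m)) (λ x B≤x → trans (cong (λ b → F x * b2n b) (bd x B≤x)) (*-zeroʳ (F x))) ⟩
  sumTo (B * suc m) f ≡⟨ sumTo-blocks B (suc m) f ⟩
  sumTo B (λ j → sumTo (suc m) (λ i → f (i + j * suc m)))
    ≡⟨ sumTo-cong B (λ j _ → sumTo-cong (suc m) (λ i i<m → cong (λ b → F (i + j * suc m) * b2n b) (gapᵇ-at m k j (≤-pred i<m)))) ⟩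
  sumTo B (λ j → sumTo (suc m) (λ i → F (i + j * suc m) * b2n (j <ᵇ k i))) ≡⟨ sumTo-swap B (suc m) _ ⟩
  sumTo (suc m) (λ i → sumTo B (λ j → F (i + j * suc m) * b2n (j <ᵇ k i)))
    ≡⟨ sumTo-cong (suc m) (λ i i<m → sumTo-below (λ j → F (i + j * suc m)) (k≤B i (≤-pred i<m))) ⟩
  sumTo (suc m) (λ i → sumTo (k i) (λ j → F (i + j * suc m))) ∎
  where
  open ≡-Reasoning
  f : ℕ → ℕ
  f x = F x * b2n (gapᵇ m k x)
  k≤B : ∀ i → i ≤ m → k i ≤ B
  k≤B i i≤m = <ᵇ-false⁻ (trans (sym (gapᵇ-at m k B i≤m)) (bd _ (≤-trans (m≤m*n B (suc m)) (m≤n+m _ i))))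

count-gaps : ∀ m k B → (∀ x → B ≤ x → gapᵇ m k x ≡ false) →
  sumTo B (λ x → 1 * b2n (gapᵇ m k x)) ≡ sumTo (suc m) k
count-gaps m k B bd = trans (sum-gaps m k B (λ _ → 1) bd)
  (sumTo-cong (suc m) (λ i _ → trans (sumTo-const (k i) 1) (*-identityʳ (k i))))

module _ {g : ℕ} {G : ℕ → Bool} (isG : Gaps g G) where

  open Gaps isG

  private
    not≡ : ∀ {b} → b ≡ false → not b ≡ true
    not≡ refl = refl
    not≡⁻ : ∀ {b} → not b ≡ true → b ≡ false
    not≡⁻ {false} _ = refl
    not≡f : ∀ {b} → not b ≡ false → b ≡ true
    not≡f {true} _ = refl

    mult = least (λ i → not (G (suc i))) (2 * g) (not≡ (bounded (suc (2 * g)) ≤-refl))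

  m-of : ℕ
  m-of = proj₁ mult

  private
    m = m-of
    Gm : G (suc m) ≡ false
    Gm = not≡⁻ (proj₁ (proj₂ (proj₂ mult)))
    G<m : ∀ i → i < m → G (suc i) ≡ true
    G<m i i< = not≡f (proj₂ (proj₂ (proj₂ mult)) i i<)

    coord : ∀ i → ∃ λ l → l ≤ suc (2 * g) × not (G (i + l * suc m)) ≡ true × (∀ j → j < l → not (G (i + j * suc m)) ≡ false)
    coord i = least (λ j → not (G (i + j * suc m))) (suc (2 * g))
      (not≡ (bounded _ (≤-trans (m≤m*n (suc (2 * g)) (suc m)) (m≤n+m _ i))))

  k-of : ℕ → ℕ
  k-of i = proj₁ (coord i)

  k-of≤ : ∀ i → k-of i ≤ suc (2 * g)
  k-of≤ i = proj₁ (proj₂ (coord i))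

  m-of≤ : m-of ≤ 2 * g
  m-of≤ = proj₁ (proj₂ mult)

  private
    k = k-of
    Gk : ∀ i → G (i + k i * suc m) ≡ false
    Gk i = not≡⁻ (proj₁ (proj₂ (proj₂ (coord i))))
    G<k : ∀ i j → j < k i → G (i + j * suc m) ≡ true
    G<k i j j< = not≡f (proj₂ (proj₂ (proj₂ (coord i))) j j<)

    k≤ : ∀ i j → G (i + j * suc m) ≡ false → k i ≤ j
    k≤ i j eq = ≮⇒≥ (λ j<k → true≢false (G<k i j j<k) eq)

    Gmult : ∀ x j → G x ≡ false → G (x + j * suc m) ≡ false
    Gmult x zero    eq = trans (cong G (+-identityʳ x)) eq
    Gmult x (suc j) eq = trans (cong G (lem x (suc m) (j * suc m))) (closed (x + j * suc m) (suc m) (Gmult x j eq) Gm)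
      where
      lem : ∀ a b c → a + (b + c) ≡ a + c + b
      lem = solve-∀

  -- Adding the least nongaps of two residue classes gives a nongap in the class of the sum. When i
  -- + j passes the multiplicity, one more multiple is carried; this is the extra 1 in `k-wrap`.
  kunz-of : Kunz m-of k-of
  kunz-of = record
    { k-zero = n≤0⇒n≡0 (k≤ 0 0 zero-nongap)
    ; k-pos  = λ i i< → ≰⇒> (λ le → true≢false (G<m i i<)
        (trans (cong G (sym (trans (cong (λ z → suc i + z * suc m) (n≤0⇒n≡0 le)) (+-identityʳ (suc i))))) (Gk (suc i))))
    ; k-sub  = λ i j _ → k≤ (i + j) (k i + k j)
        (trans (cong G (lem₁ i j (k i) (k j) (suc m))) (closed _ _ (Gk i) (Gk j)))
    ; k-wrap = λ i j l _ _ eq → k≤ l (suc (k i + k j))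
        (trans (cong G (trans (lem₂ l (k i) (k j) (suc m)) (trans (cong (_+ (k i + k j) * suc m) (sym eq)) (lem₁ i j (k i) (k j) (suc m)))))
          (closed _ _ (Gk i) (Gk j)))
    }
    where
    lem₁ : ∀ i j a b m → i + j + (a + b) * m ≡ i + a * m + (j + b * m)
    lem₁ = solve-∀
    lem₂ : ∀ l a b m → l + suc (a + b) * m ≡ l + m + (a + b) * m
    lem₂ = solve-∀

  -- Adding the multiplicity keeps nongaps, so the gaps of each class form an initial segment of it.
  G≡gapᵇ : ∀ x → G x ≡ gapᵇ m-of k-of x
  G≡gapᵇ x = trans (cong G (m≡m%n+[m/n]*n x (suc m))) (by (x % suc m) (x / suc m))
    where
    by : ∀ i j → G (i + j * suc m) ≡ (j <ᵇ k i)
    by i j with j <ᵇ k i in eq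
    ... | true  = G<k i j (<ᵇ-true⁻ eq)
    ... | false = trans (cong G (trans (cong (λ z → i + z * suc m) (sym (m+[n∸m]≡n (<ᵇ-false⁻ {j} {k i} eq))))
                    (lem i (k i) (j ∸ k i) (suc m)))) (Gmult _ (j ∸ k i) (Gk i))
      where
      lem : ∀ i a b m → i + (a + b) * m ≡ i + a * m + b * m
      lem = solve-∀

length-filterᵇ : ∀ (p : ℕ → Bool) n → length (filterᵇ p (upTo n)) ≡ sumTo n (λ x → 1 * b2n (p x))
length-filterᵇ p n = trans (length≡sumOn (filterᵇ p (upTo n))) (trans (sumOn-filterᵇ (λ _ → 1) p (upTo n)) (sumOn-upTo _ n))

-- The crude bounds `m≤` and `k≤` make the parameter ranges of the tail codes finite.
record KunzData (g : ℕ) (H : List ℕ) : Set where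
  field
    m      : ℕ
    k      : ℕ → ℕ
    kunz   : Kunz m k
    k-sum  : sumTo (suc m) k ≡ g
    H≡     : H ≡ gapList g m k
    m≤     : m ≤ 2 * g
    k≤     : ∀ i → k i ≤ suc (2 * g)

kunzData : ∀ g {H} → H ∈ gapSets g → KunzData g H
kunzData g {H} H∈ with gapSet-Gaps g H∈
... | isG , H≡ , len = record
  { m = m-of isG ; k = k-of isG ; kunz = kunz-of isG
  ; k-sum = trans (sym (count-gaps (m-of isG) (k-of isG) (suc (2 * g)) (λ x B≤x → trans (sym (G≡gapᵇ isG x)) (Gaps.bounded isG x B≤x))))
              (trans (sym (length-filterᵇ _ (suc (2 * g)))) (trans (cong length (sym H≡′)) len))
  ; H≡ = H≡′
  ; m≤ = m-of≤ isG ; k≤ = k-of≤ isG }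
  where
  H≡′ : H ≡ gapList g (m-of isG) (k-of isG)
  H≡′ = trans H≡ (filterᵇ-cong _ _ (upTo (suc (2 * g))) (λ x _ → G≡gapᵇ isG x))

module _ {m : ℕ} {k : ℕ → ℕ} (K : Kunz m k) where

  open Kunz K

  gapᵇ-closed : ∀ x y → gapᵇ m k x ≡ false → gapᵇ m k y ≡ false → gapᵇ m k (x + y) ≡ false
  gapᵇ-closed x y x∉ y∉ = trans (cong (gapᵇ m k) (trans (cong₂ _+_ (m≡m%n+[m/n]*n x (suc m)) (m≡m%n+[m/n]*n y (suc m)))
      (lem₁ i i′ j j′ (suc m)))) main
    where
    i = x % suc m
    i′ = y % suc m
    j = x / suc m
    j′ = y / suc m
    i≤ : i ≤ m
    i≤ = ≤-pred (m%n<n x (suc m))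
    i′≤ : i′ ≤ m
    i′≤ = ≤-pred (m%n<n y (suc m))
    kj : k i + k i′ ≤ j + j′
    kj = <ᵇ-false⁻ {j} {k i} x∉ ⊕ <ᵇ-false⁻ {j′} {k i′} y∉
    lem₁ : ∀ i j a b m → i + a * m + (j + b * m) ≡ i + j + (a + b) * m
    lem₁ = solve-∀
    lem₂ : ∀ l a b m → l + m + (a + b) * m ≡ l + suc (a + b) * m
    lem₂ = solve-∀
    main : gapᵇ m k (i + i′ + (j + j′) * suc m) ≡ false
    main with i + i′ ≤? m
    ... | yes le = trans (gapᵇ-at m k (j + j′) le) (<ᵇ-false (≤-trans (k-sub i i′ le) kj))
    ... | no nle = trans (cong (gapᵇ m k) (trans (cong (_+ (j + j′) * suc m) (sym leq)) (lem₂ l j j′ (suc m))))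
                   (trans (gapᵇ-at m k (suc (j + j′)) l≤) (<ᵇ-false (≤-trans (k-wrap i i′ l i≤ i′≤ (sym leq)) (s≤s kj))))
      where
      l = i + i′ ∸ suc m
      leq : l + suc m ≡ i + i′
      leq = m∸n+n≡m (≰⇒> nle)
      l≤ : l ≤ m
      l≤ = +-cancelʳ-≤ (suc m) l m (subst (_≤ m + suc m) (sym leq) (≤-trans (i≤ ⊕ i′≤) (+-monoʳ-≤ m (n≤1+n m))))

  -- Among s and F ∸ s at least one is a gap, so F + 1 ≤ 2 g.
  gapᵇ-bound : ∀ x → suc (2 * sumTo (suc m) k) ≤ x → gapᵇ m k x ≡ false
  gapᵇ-bound F 2g< = ≡false-from absurd
    where
    g = sumTo (suc m) k
    c : ℕ → ℕ
    c x = 1 * b2n (gapᵇ m k x)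
    crude : ∀ x → g * suc m ≤ x → gapᵇ m k x ≡ false
    crude x gm≤x = <ᵇ-false (≤-trans (term≤sumTo k (m%n<n x (suc m)))
      (subst (_≤ x / suc m) (m*n/n≡m g (suc m)) (/-monoˡ-≤ (suc m) gm≤x)))
    absurd : gapᵇ m k F ≡ true → ⊥
    absurd eq = <⇒≱ 2g< (begin
      F ≤⟨ n≤1+n F ⟩
      suc F ≡⟨ trans (sumTo-const (suc F) 1) (*-identityʳ (suc F)) ⟨
      sumTo (suc F) (λ _ → 1) ≤⟨ sumTo-mono (suc F) (λ s s≤F → one s (≤-pred s≤F)) ⟩
      sumTo (suc F) (λ s → c s + c (F ∸ s)) ≡⟨ sumTo-+ (suc F) c _ ⟩
      sumTo (suc F) c + sumTo (suc F) (λ s → c (F ∸ s)) ≡⟨ cong (sumTo (suc F) c +_) (sumTo-reverse F c) ⟩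
      sumTo (suc F) c + sumTo (suc F) c ≤⟨ le ⊕ le ⟩
      g + g ≡⟨ cong (g +_) (+-identityʳ g) ⟨
      2 * g ∎)
      where
      open ≤-Reasoning
      F< : F < g * suc m
      F< = ≰⇒> (λ p → true≢false eq (crude F p))
      le : sumTo (suc F) c ≤ g
      le = ≤-trans (sumTo-≤-extend c F<) (≤-reflexive (count-gaps m k (g * suc m) crude))
      one : ∀ s → s ≤ F → 1 ≤ c s + c (F ∸ s)
      one s s≤F with gapᵇ m k s in e₁ | gapᵇ m k (F ∸ s) in e₂
      ... | true  | _     = s≤s z≤n
      ... | false | true  = s≤s z≤n
      ... | false | false = ⊥-elim (true≢false eq (trans (cong (gapᵇ m k) (sym (m+[n∸m]≡n s≤F))) (gapᵇ-closed s (F ∸ s) e₁ e₂)))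

  module _ {g : ℕ} (k-sum : sumTo (suc m) k ≡ g) where

    gapᵇ-bound′ : ∀ x → suc (2 * g) ≤ x → gapᵇ m k x ≡ false
    gapᵇ-bound′ x = subst (λ z → suc (2 * z) ≤ x → gapᵇ m k x ≡ false) k-sum (gapᵇ-bound x)

    -- No gap is lost when the list is cut at 2 g, by `gapᵇ-bound`.
    ∈ᵇ-gapList : ∀ x → (x ∈ᵇ gapList g m k) ≡ gapᵇ m k x
    ∈ᵇ-gapList x = bool-ext
      (λ eq → proj₂ (∈-filterᵇ⁻ (gapᵇ m k) {xs = upTo (suc (2 * g))} (∈ᵇ-elim _ eq)))
      (λ eq → ∈ᵇ-intro (∈-filterᵇ⁺ (gapᵇ m k) (∈-upTo⁺ (≰⇒> (λ p → true≢false eq (gapᵇ-bound′ x p)))) eq))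

    gapList-length : length (gapList g m k) ≡ g
    gapList-length = trans (length-filterᵇ _ (suc (2 * g))) (trans (count-gaps m k (suc (2 * g)) gapᵇ-bound′) k-sum)

    gapList-sum : sum (gapList g m k) ≡ sumTo (suc m) (λ i → sumTo (k i) (λ j → i + j * suc m))
    gapList-sum = trans (cong sum (sym (map-id (gapList g m k)))) (trans (sumOn-filterᵇ id (gapᵇ m k) (upTo (suc (2 * g))))
        (trans (sumOn-upTo _ (suc (2 * g))) (sum-gaps m k (suc (2 * g)) id gapᵇ-bound′)))

    gapList∈gapSets : gapList g m k ∈ gapSets g
    gapList∈gapSets = ∈-filterᵇ⁺ (λ H → ⌊ length H ≟ g ⌋ ∧ isMonoidComplement (2 * g) H)
      (filter∈subsets (gapᵇ m k) (upTo (suc (2 * g)))) cond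
      where
      H = gapList g m k
      checks : ∀ x y → (x ∈ᵇ H ∨ y ∈ᵇ H) ∨ not ((x + y) ∈ᵇ H) ≡ true
      checks x y rewrite ∈ᵇ-gapList x | ∈ᵇ-gapList y | ∈ᵇ-gapList (x + y) with gapᵇ m k x in e₁ | gapᵇ m k y in e₂
      ... | true  | _     = refl
      ... | false | true  = refl
      ... | false | false rewrite gapᵇ-closed x y e₁ e₂ = refl
      zero∉ : not (0 ∈ᵇ H) ≡ true
      zero∉ = cong not (trans (∈ᵇ-gapList 0) (cong (0 <ᵇ_) k-zero))
      ≟-true : ∀ {a b} → a ≡ b → ⌊ a ≟ b ⌋ ≡ true
      ≟-true {a} {b} eq with a ≟ b
      ... | yes _ = refl
      ... | no ne = contradiction eq ne
      cond : ⌊ length H ≟ g ⌋ ∧ isMonoidComplement (2 * g) H ≡ true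
      cond = cong₂ _∧_ (≟-true gapList-length) (cong₂ _∧_ zero∉
        (all-intro _ (upTo (suc (2 * g))) (λ x _ → all-intro _ (upTo (suc (2 * g))) (λ y _ → checks x y))))

    gapᵇ-0 : gapᵇ m k (suc m) ≡ false
    gapᵇ-0 = trans (cong (gapᵇ m k) (sym (+-identityʳ (suc m)))) (trans (gapᵇ-at m k 1 z≤n) (cong (1 <ᵇ_) k-zero))

    gapᵇ-small : ∀ i → i < m → gapᵇ m k (suc i) ≡ true
    gapᵇ-small i i<m = trans (cong (gapᵇ m k) (sym (+-identityʳ (suc i)))) (trans (gapᵇ-at m k 0 i<m) (<ᵇ-true (k-pos i i<m)))

gapList-cong : ∀ g m {k k′} → (∀ i → i ≤ m → k i ≡ k′ i) → gapList g m k ≡ gapList g m k′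
gapList-cong g m eq = filterᵇ-cong _ _ (upTo (suc (2 * g))) (λ x _ → cong (x / suc m <ᵇ_) (eq _ (≤-pred (m%n<n x (suc m)))))

-- The gaps determine suc m as the least positive nongap, and then every coordinate as the number of
-- gaps in its class.
gapList-injective : ∀ {g m m′ k k′} → Kunz m k → Kunz m′ k′ → sumTo (suc m) k ≡ g → sumTo (suc m′) k′ ≡ g →
  gapList g m k ≡ gapList g m′ k′ → m ≡ m′ × (∀ i → i ≤ m → k i ≡ k′ i)
gapList-injective {g} {m} {m′} {k} {k′} K K′ s s′ eq = m≡ , k≡
  where
  same : ∀ x → gapᵇ m k x ≡ gapᵇ m′ k′ x
  same x = trans (sym (∈ᵇ-gapList K s x)) (trans (cong (x ∈ᵇ_) eq) (∈ᵇ-gapList K′ s′ x))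
  m≡ : m ≡ m′
  m≡ with <-cmp m m′
  ... | tri≈ _ p _ = p
  ... | tri< p _ _ = ⊥-elim (true≢false (gapᵇ-small K′ s′ m p) (trans (sym (same (suc m))) (gapᵇ-0 K s)))
  ... | tri> _ _ p = ⊥-elim (true≢false (gapᵇ-small K s m′ p) (trans (same (suc m′)) (gapᵇ-0 K′ s′)))
  k≡ : ∀ i → i ≤ m → k i ≡ k′ i
  k≡ i i≤m with m≡
  ... | refl = ≤-antisym (half same′) (half (sym ∘ same′))
    where
    same′ : ∀ j → (j <ᵇ k i) ≡ (j <ᵇ k′ i)
    same′ j = trans (sym (gapᵇ-at m k j i≤m)) (trans (same (i + j * suc m)) (gapᵇ-at m k′ j i≤m))
    half : ∀ {a b} → (∀ j → (j <ᵇ a) ≡ (j <ᵇ b)) → a ≤ b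
    half {a} {b} h = <ᵇ-false⁻ {b} {a} (trans (h b) (<ᵇ-false {b} {b} ≤-refl))

-- Codes of intervals and their weights

-- Codes of an interval of n Kunz coordinates u 1 … u n: the list of pairs (u (1 + j) , u (n ∸ j)), j < ⌊ n /2⌋.
State : Set
State = ℕ × ℕ

size : List State → ℕ
size []             = 0
size ((p , r) ∷ ss) = p + r + size ss

rangeFrom1 : ℕ → List ℕ
rangeFrom1 Q = applyUpTo suc Q

pairs : ℕ → List State
pairs Q = concatMap (λ p → map (p ,_) (filterᵇ (λ r → Q ≤ᵇ p + r) (rangeFrom1 Q))) (rangeFrom1 Q)

-- A slot restricts the next pair: prev s is the pair found a positions earlier in the chain.
data Slot : Set where
  free       : Slot
  left-large : Slot
  both-large : Slot
  prev       : State → Slot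

-- In the `prev` case p lies one chain step to the right of p₀, while r lies one step to the left of
-- r₀. The same chain inequality therefore bounds p from above by p₀ and r from below by r₀.
compatible : Slot → State → Bool
compatible free       s       = true
compatible left-large (p , r) = 2 ≤ᵇ p
compatible both-large (p , r) = (2 ≤ᵇ p) ∧ (2 ≤ᵇ r)
compatible (prev (p₀ , r₀)) (p , r) = (p ≤ᵇ suc p₀) ∧ (r₀ ≤ᵇ suc r)

allowed : ℕ → Slot → List State
allowed Q s = filterᵇ (compatible s) (pairs Q)

-- The window is a queue of constant length a. The slot of a chosen pair is appended at its end and
-- so constrains the pair chosen a steps later; in this way all a chains are run interleaved.
codes : ℕ → List Slot → ℕ → List (List State)
codes Q win        zero    = [] ∷ []
codes Q []         (suc n) = []
codes Q (sl ∷ win) (suc n) = concatMap (λ s → map (s ∷_) (codes Q (win ∷ʳ prev s) n)) (allowed Q sl)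

-- The weight of a pair is (31/50)^(p+r), scaled by 50^(2Q); the base 31/50 is slightly above the inverse of the golden ratio.
wt : ℕ → State → ℕ
wt Q (p , r) = 31 ^ (p + r) * 50 ^ (2 * Q ∸ (p + r))

wts : ℕ → List State → ℕ
wts Q []       = 1
wts Q (s ∷ ss) = wt Q s * wts Q ss

scale : ℕ → ℕ
scale Q = 50 ^ (2 * Q)

prod : List ℕ → ℕ
prod []       = 1
prod (x ∷ xs) = x * prod xs

prod-++ : ∀ xs ys → prod (xs ++ ys) ≡ prod xs * prod ys
prod-++ []       ys = sym (+-identityʳ _)
prod-++ (x ∷ xs) ys = trans (cong (x *_) (prod-++ xs ys)) (sym (*-assoc x (prod xs) (prod ys)))

sumOn-wts-∷ : ∀ Q s cs → sumOn (wts Q) (map (s ∷_) cs) ≡ wt Q s * sumOn (wts Q) cs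
sumOn-wts-∷ Q s cs = trans (sumOn-map (wts Q) (s ∷_) cs) (sumOn-*ˡ (wt Q s) (wts Q) cs)

sumOn-codes-suc : ∀ Q sl win n → sumOn (wts Q) (codes Q (sl ∷ win) (suc n))
  ≡ sumOn (λ s → wt Q s * sumOn (wts Q) (codes Q (win ∷ʳ prev s) n)) (allowed Q sl)
sumOn-codes-suc Q sl win n = trans (sumOn-concatMap (wts Q) _ (allowed Q sl))
  (sumOn-cong (allowed Q sl) (λ s _ → sumOn-wts-∷ Q s (codes Q (win ∷ʳ prev s) n)))

take-++ˡ : ∀ {A : Set} n (xs ys : List A) → n ≤ length xs → take n (xs ++ ys) ≡ take n xs
take-++ˡ zero    xs       ys _       = refl
take-++ˡ (suc n) (x ∷ xs) ys (s≤s p) = cong (x ∷_) (take-++ˡ n xs ys p)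

-- The transfer operator on chains of pairs

-- If V is a supersolution of the transfer operator, the codes weigh at most the product of V over the used slots.
module Transfer (Q U : ℕ) (V : Slot → ℕ) (Good : Slot → Set)
  (last-step : ∀ sl → Good sl → U * sumOn (wt Q) (allowed Q sl) ≤ scale Q * V sl)
  (step      : ∀ sl → Good sl → sumOn (λ s → wt Q s * V (prev s)) (allowed Q sl) ≤ scale Q * V sl)
  (good-prev : ∀ sl s → s ∈ allowed Q sl → Good (prev s)) where

  codes-bound : ∀ n win → All Good win →
    U ^ length (take n win) * sumOn (wts Q) (codes Q win n) ≤ scale Q ^ n * prod (map V (take n win))
  codes-bound zero    win _  = ≤-refl
  codes-bound (suc n) []  _  = z≤n
  codes-bound (suc n) (sl ∷ win) (gsl ∷ gw) with n ≤? length win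
  -- The remaining n pairs fit into `win`, so the slot appended for `s` is never reached: the chain
  -- ends here and is charged by `last-step`.
  ... | yes n≤ = begin
    U * U ^ L * sumOn (wts Q) (codes Q (sl ∷ win) (suc n))
      ≡⟨ cong (U * U ^ L *_) (sumOn-codes-suc Q sl win n) ⟩
    U * U ^ L * sumOn (λ s → wt Q s * rest s) A
      ≡⟨ trans (*-assoc U (U ^ L) _) (cong (U *_) (sym (sumOn-*ˡ (U ^ L) (λ s → wt Q s * rest s) A))) ⟩
    U * sumOn (λ s → U ^ L * (wt Q s * rest s)) A
      ≤⟨ *-monoʳ-≤ U (sumOn-mono A (λ s s∈ → begin
           U ^ L * (wt Q s * rest s) ≡⟨ x∙yz≡y∙xz (U ^ L) (wt Q s) (rest s) ⟩
           wt Q s * (U ^ L * rest s) ≤⟨ *-monoʳ-≤ (wt Q s) (subst (λ w → U ^ length w * rest s ≤ scale Q ^ n * prod (map V w))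
                                            (take-++ˡ n win _ n≤) (codes-bound n (win ∷ʳ prev s) (good-snoc sl s s∈ gw))) ⟩
           wt Q s * P ≡⟨ *-comm (wt Q s) P ⟩
           P * wt Q s ∎)) ⟩
    U * sumOn (λ s → P * wt Q s) A ≡⟨ cong (U *_) (sumOn-*ˡ P (wt Q) A) ⟩
    U * (P * sumOn (wt Q) A) ≡⟨ x∙yz≡y∙xz U P _ ⟩
    P * (U * sumOn (wt Q) A) ≤⟨ *-monoʳ-≤ P (last-step sl gsl) ⟩
    P * (scale Q * V sl) ≡⟨ lem (scale Q ^ n) _ (scale Q) (V sl) ⟩
    scale Q * scale Q ^ n * (V sl * prod (map V (take n win))) ∎
    where
    open ≤-Reasoning
    A = allowed Q sl
    L = length (take n win)
    P = scale Q ^ n * prod (map V (take n win))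
    rest : State → ℕ
    rest s = sumOn (wts Q) (codes Q (win ∷ʳ prev s) n)
    x∙yz≡y∙xz : ∀ x y z → x * (y * z) ≡ y * (x * z)
    x∙yz≡y∙xz = solve-∀
    lem : ∀ a b c d → a * b * (c * d) ≡ c * a * (d * b)
    lem = solve-∀
    good-snoc : ∀ sl s → s ∈ allowed Q sl → ∀ {w} → All Good w → All Good (w ∷ʳ prev s)
    good-snoc sl s s∈ []       = good-prev sl s s∈ ∷ []
    good-snoc sl s s∈ (g ∷ gs) = g ∷ good-snoc sl s s∈ gs
  -- Here the appended slot is reached, and its value `V (prev s)` is absorbed by `step`.
  ... | no n≰ = begin
    U * U ^ length (take n win) * sumOn (wts Q) (codes Q (sl ∷ win) (suc n))
      ≡⟨ cong₂ _*_ (cong (λ w → U * U ^ length w) (take-all n win (<⇒≤ (≰⇒> n≰)))) (sumOn-codes-suc Q sl win n) ⟩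
    U ^ suc L * sumOn (λ s → wt Q s * rest s) A
      ≡⟨ sumOn-*ˡ (U ^ suc L) (λ s → wt Q s * rest s) A ⟨
    sumOn (λ s → U ^ suc L * (wt Q s * rest s)) A
      ≤⟨ sumOn-mono A (λ s s∈ → begin
           U ^ suc L * (wt Q s * rest s) ≡⟨ x∙yz≡y∙xz (U ^ suc L) (wt Q s) (rest s) ⟩
           wt Q s * (U ^ suc L * rest s) ≤⟨ *-monoʳ-≤ (wt Q s) (subst₂ (λ w l → U ^ l * rest s ≤ scale Q ^ n * prod (map V w))
                                               (take-all n (win ∷ʳ prev s) (len≤ s)) (trans (cong length (take-all n (win ∷ʳ prev s) (len≤ s))) (len s))
                                               (codes-bound n (win ∷ʳ prev s) (good-snoc sl s s∈ gw))) ⟩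
           wt Q s * (scale Q ^ n * prod (map V (win ∷ʳ prev s)))
             ≡⟨ cong (λ z → wt Q s * (scale Q ^ n * z)) (trans (cong prod (map-++ V win (prev s ∷ []))) (prod-++ (map V win) (V (prev s) ∷ []))) ⟩
           wt Q s * (scale Q ^ n * (prod (map V win) * (V (prev s) * 1))) ≡⟨ lem₁ (wt Q s) (scale Q ^ n) (prod (map V win)) (V (prev s)) ⟩
           P * (wt Q s * V (prev s)) ∎) ⟩
    sumOn (λ s → P * (wt Q s * V (prev s))) A ≡⟨ sumOn-*ˡ P (λ s → wt Q s * V (prev s)) A ⟩
    P * sumOn (λ s → wt Q s * V (prev s)) A ≤⟨ *-monoʳ-≤ P (step sl gsl) ⟩
    P * (scale Q * V sl) ≡⟨ lem (scale Q ^ n) _ (scale Q) (V sl) ⟩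
    scale Q * scale Q ^ n * (V sl * prod (map V win))
      ≡⟨ cong (λ w → scale Q * scale Q ^ n * (V sl * prod (map V w))) (take-all n win (<⇒≤ (≰⇒> n≰))) ⟨
    scale Q * scale Q ^ n * (V sl * prod (map V (take n win))) ∎
    where
    open ≤-Reasoning
    A = allowed Q sl
    L = length win
    P = scale Q ^ n * prod (map V win)
    rest : State → ℕ
    rest s = sumOn (wts Q) (codes Q (win ∷ʳ prev s) n)
    len : ∀ s → length (win ∷ʳ prev s) ≡ suc L
    len s = trans (length-++ win) (+-comm L 1)
    len≤ : ∀ s → length (win ∷ʳ prev s) ≤ n
    len≤ s = ≤-trans (≤-reflexive (len s)) (≰⇒> n≰)
    x∙yz≡y∙xz : ∀ x y z → x * (y * z) ≡ y * (x * z)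
    x∙yz≡y∙xz = solve-∀
    lem : ∀ a b c d → a * b * (c * d) ≡ c * a * (d * b)
    lem = solve-∀
    lem₁ : ∀ w a b v → w * (a * (b * (v * 1))) ≡ a * b * (w * v)
    lem₁ = solve-∀
    good-snoc : ∀ sl s → s ∈ allowed Q sl → ∀ {w} → All Good w → All Good (w ∷ʳ prev s)
    good-snoc sl s s∈ []       = good-prev sl s s∈ ∷ []
    good-snoc sl s s∈ (g ∷ gs) = g ∷ good-snoc sl s s∈ gs

-- Supersolutions for Q = 3, 4, 5

-- The common unit of the slot values: free = 20/17, left-large = 17/20, both-large = (17/20)².
unit : ℕ
unit = 6800

-- For `prev s` the value is the total weight of the compatible pairs in the given unit, rounded up.
-- The `last-step` inequality then holds for `prev s` by construction, and the real content of the
-- test is the `step` inequality.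
slotValue : ℕ → Slot → ℕ
slotValue Q free       = 8000
slotValue Q left-large = 5780
slotValue Q both-large = 4913
slotValue Q (prev s)   = suc ((unit * sumOn (wt Q) (allowed Q (prev s))) / scale Q)
  where instance
    nz : NonZero (scale Q)
    nz = m^n≢0 50 (2 * Q)

testedSlots : ℕ → List Slot
testedSlots Q = free ∷ left-large ∷ both-large ∷ map prev (pairs Q)

testSlot : ℕ → Slot → Bool
testSlot Q sl = (unit * sumOn (wt Q) (allowed Q sl) ≤ᵇ scale Q * slotValue Q sl)
  ∧ (sumOn (λ s → wt Q s * slotValue Q (prev s)) (allowed Q sl) ≤ᵇ scale Q * slotValue Q sl)

-- The values of Q that are needed: q = 3 uses Q = 3 before the maximum, q = 4 uses 4 and 3, q = 5
-- uses 5 and 4.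
test-3 : all (testSlot 3) (testedSlots 3) ≡ true
test-3 = refl

test-4 : all (testSlot 4) (testedSlots 4) ≡ true
test-4 = refl

test-5 : all (testSlot 5) (testedSlots 5) ≡ true
test-5 = refl

≤ᵇ-true : ∀ {m n} → m ≤ n → (m ≤ᵇ n) ≡ true
≤ᵇ-true p = Equivalence.to T-≡ (≤⇒≤ᵇ p)

≤ᵇ-true⁻ : ∀ {m n} → (m ≤ᵇ n) ≡ true → m ≤ n
≤ᵇ-true⁻ {m} {n} eq = ≤ᵇ⇒≤ m n (Equivalence.from T-≡ eq)

∈-rangeFrom1⁺ : ∀ {x Q} → 1 ≤ x → x ≤ Q → x ∈ rangeFrom1 Q
∈-rangeFrom1⁺ {suc x} _ x≤Q = ∈-applyUpTo⁺ suc x≤Q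

∈-rangeFrom1⁻ : ∀ {x} Q → x ∈ rangeFrom1 Q → 1 ≤ x × x ≤ Q
∈-rangeFrom1⁻ Q x∈ with ∈-applyUpTo⁻ suc x∈
... | i , i<Q , refl = s≤s z≤n , i<Q

∈-concatMap-intro : ∀ {A B : Set} (f : A → List B) {xs x y} → x ∈ xs → y ∈ f x → y ∈ concatMap f xs
∈-concatMap-intro f {x ∷ xs} (here refl) y∈ = ∈-++⁺ˡ y∈
∈-concatMap-intro f {x ∷ xs} (there x∈)  y∈ = ∈-++⁺ʳ (f x) (∈-concatMap-intro f x∈ y∈)

∈-concatMap-elim : ∀ {A B : Set} (f : A → List B) xs {y} → y ∈ concatMap f xs → ∃ λ x → x ∈ xs × y ∈ f x
∈-concatMap-elim f (x ∷ xs) y∈ with ∈-++⁻ (f x) y∈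
... | inj₁ p = x , here refl , p
... | inj₂ p with ∈-concatMap-elim f xs p
... | x′ , x′∈ , q = x′ , there x′∈ , q

∈-pairs⁺ : ∀ {Q p r} → 1 ≤ p → p ≤ Q → 1 ≤ r → r ≤ Q → Q ≤ p + r → (p , r) ∈ pairs Q
∈-pairs⁺ {Q} {p} 1≤p p≤Q 1≤r r≤Q Q≤ = ∈-concatMap-intro _ (∈-rangeFrom1⁺ 1≤p p≤Q)
  (∈-map⁺ (p ,_) (∈-filterᵇ⁺ (λ r → Q ≤ᵇ p + r) (∈-rangeFrom1⁺ 1≤r r≤Q) (≤ᵇ-true Q≤)))

∈-pairs⁻ : ∀ Q {p r} → (p , r) ∈ pairs Q → (1 ≤ p × p ≤ Q) × (1 ≤ r × r ≤ Q)
∈-pairs⁻ Q pr∈ with ∈-concatMap-elim _ (rangeFrom1 Q) pr∈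
... | p′ , p′∈ , q with ∈-map⁻ (p′ ,_) q
... | r′ , r′∈ , refl = ∈-rangeFrom1⁻ Q p′∈ , ∈-rangeFrom1⁻ Q (proj₁ (∈-filterᵇ⁻ (λ r → Q ≤ᵇ p′ + r) r′∈))

module _ (Q : ℕ) where

  codes-shape : ∀ win h {l} → l ∈ codes Q win h → length l ≡ h × All (_∈ pairs Q) l
  codes-shape win        zero    (here refl) = refl , []
  codes-shape (sl ∷ win) (suc h) l∈ with ∈-concatMap-elim _ (allowed Q sl) l∈
  ... | s , s∈ , q with ∈-map⁻ (s ∷_) q
  ... | l′ , l′∈ , refl with codes-shape (win ∷ʳ prev s) h l′∈
  ... | len , all∈ = cong suc len , proj₁ (∈-filterᵇ⁻ (compatible sl) s∈) ∷ all∈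

  size-lower : ∀ {l} → All (_∈ pairs Q) l → 2 * length l ≤ size l
  size-lower [] = z≤n
  size-lower {(p , r) ∷ l} (s∈ ∷ all∈) with ∈-pairs⁻ Q s∈
  ... | (1≤p , _) , (1≤r , _) = subst (_≤ p + r + size l) (sym (*-suc 2 (length l))) ((1≤p ⊕ 1≤r) ⊕ size-lower all∈)

  -- The bound p + r ≤ 2 Q keeps the subtraction in `wt` exact, so the normalised weight of a code
  -- is (31/50) to the power of its size.
  wts-size : ∀ {l} → All (_∈ pairs Q) l → wts Q l * 50 ^ size l ≡ 31 ^ size l * scale Q ^ length l
  wts-size [] = refl
  wts-size {(p , r) ∷ l} (s∈ ∷ all∈) with ∈-pairs⁻ Q s∈
  ... | (_ , p≤) , (_ , r≤) = begin
    31 ^ t * 50 ^ (2 * Q ∸ t) * wts Q l * 50 ^ (t + size l)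
      ≡⟨ cong (31 ^ t * 50 ^ (2 * Q ∸ t) * wts Q l *_) (^-distribˡ-+-* 50 t (size l)) ⟩
    31 ^ t * 50 ^ (2 * Q ∸ t) * wts Q l * (50 ^ t * 50 ^ size l)
      ≡⟨ lem (31 ^ t) (50 ^ (2 * Q ∸ t)) (wts Q l) (50 ^ t) (50 ^ size l) ⟩
    31 ^ t * (50 ^ (2 * Q ∸ t) * 50 ^ t) * (wts Q l * 50 ^ size l)
      ≡⟨ cong₂ (λ a b → 31 ^ t * a * b) (trans (sym (^-distribˡ-+-* 50 (2 * Q ∸ t) t)) (cong (50 ^_) (m∸n+n≡m t≤))) (wts-size all∈) ⟩
    31 ^ t * scale Q * (31 ^ size l * scale Q ^ length l)
      ≡⟨ lem₂ (31 ^ t) (scale Q) (31 ^ size l) (scale Q ^ length l) ⟩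
    31 ^ t * 31 ^ size l * (scale Q * scale Q ^ length l)
      ≡⟨ cong (_* (scale Q * scale Q ^ length l)) (^-distribˡ-+-* 31 t (size l)) ⟨
    31 ^ (t + size l) * (scale Q * scale Q ^ length l) ∎
    where
    open ≡-Reasoning
    t = p + r
    t≤ : t ≤ 2 * Q
    t≤ = ≤-trans (p≤ ⊕ r≤) (≤-reflexive (cong (Q +_) (sym (+-identityʳ Q))))
    lem : ∀ a b w c d → a * b * w * (c * d) ≡ a * (b * c) * (w * d)
    lem = solve-∀
    lem₂ : ∀ a s b c → a * s * (b * c) ≡ a * b * (s * c)
    lem₂ = solve-∀

  -- Here σ lists the slots of the whole run: the first `suc a` form the initial window, and slot
  -- `j + suc a` is the one that pair j has left behind.
  codes-mem : ∀ h a (f : ℕ → State) (σ : ℕ → Slot) → (∀ j → σ (j + suc a) ≡ prev (f j)) →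
    (∀ j → j < h → f j ∈ allowed Q (σ j)) → applyUpTo f h ∈ codes Q (applyUpTo σ (suc a)) h
  codes-mem zero    a f σ _   _  = here refl
  codes-mem (suc h) a f σ σ-prev f∈ = ∈-concatMap-intro _ (f∈ 0 (s≤s z≤n))
    (∈-map⁺ (f 0 ∷_) (subst (λ w → applyUpTo (f ∘ suc) h ∈ codes Q w h)
      (trans (sym (applyUpTo-∷ʳ (σ ∘ suc) a)) (cong (applyUpTo (σ ∘ suc) a ∷ʳ_) (σ-prev 0)))
      (codes-mem h a (f ∘ suc) (σ ∘ suc) (λ j → σ-prev (suc j)) (λ j j<h → f∈ (suc j) (s≤s j<h)))))

-- Slot j stands for the positions o + j + 1 and o + n ∸ j; below a, the first position of a 1, coordinates are at least 2.
initSlot : ℕ → ℕ → ℕ → ℕ → Slot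
initSlot o n a j = if o + suc j <ᵇ a then (if o + (n ∸ j) <ᵇ a then both-large else left-large) else free

window : ℕ → ℕ → ℕ → List Slot
window o n a = applyUpTo (initSlot o n a) a

intervalCodes : ℕ → ℕ → ℕ → ℕ → List (List State)
intervalCodes Q o n a = codes Q (window o n a) ⌊ n /2⌋

pairUp : (ℕ → ℕ) → ℕ → ℕ → State
pairUp u n j = u (suc j) , u (n ∸ j)

intervalPairs : (ℕ → ℕ) → ℕ → List State
intervalPairs u n = applyUpTo (pairUp u n) ⌊ n /2⌋

-- Describes both stretches of a word, the one before the last maximum q with Q = q and the one
-- after it with Q = q - 1. The offset `o` is the number of coordinates in front; it matters for
-- `large`, because `a` is counted from the start of the word.
record Interval (Q o n a : ℕ) (u : ℕ → ℕ) : Set where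
  field
    pos   : ∀ i → 1 ≤ i → i ≤ n → 1 ≤ u i
    upper : ∀ i → 1 ≤ i → i ≤ n → u i ≤ Q
    pair  : ∀ i j → i + j ≡ suc n → 1 ≤ i → 1 ≤ j → Q ≤ u i + u j
    chain : ∀ i → 1 ≤ i → i + a ≤ n → u (i + a) ≤ suc (u i)
    large : ∀ i → 1 ≤ i → i ≤ n → o + i < a → 2 ≤ u i

applyUpTo-cong : ∀ {A : Set} {f h : ℕ → A} n → (∀ i → i < n → f i ≡ h i) → applyUpTo f n ≡ applyUpTo h n
applyUpTo-cong zero    eq = refl
applyUpTo-cong (suc n) eq = cong₂ _∷_ (eq 0 (s≤s z≤n)) (applyUpTo-cong n (λ i i<n → eq (suc i) (s≤s i<n)))

2⌊n/2⌋≤n : ∀ n → ⌊ n /2⌋ + ⌊ n /2⌋ ≤ n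
2⌊n/2⌋≤n zero          = z≤n
2⌊n/2⌋≤n (suc zero)    = z≤n
2⌊n/2⌋≤n (suc (suc n)) = s≤s (subst (_≤ suc n) (sym (+-suc ⌊ n /2⌋ ⌊ n /2⌋)) (s≤s (2⌊n/2⌋≤n n)))

n≤1+2⌊n/2⌋ : ∀ n → n ≤ suc (⌊ n /2⌋ + ⌊ n /2⌋)
n≤1+2⌊n/2⌋ zero          = z≤n
n≤1+2⌊n/2⌋ (suc zero)    = s≤s z≤n
n≤1+2⌊n/2⌋ (suc (suc n)) = s≤s (subst (suc n ≤_) (sym (cong suc (+-suc ⌊ n /2⌋ ⌊ n /2⌋))) (s≤s (n≤1+2⌊n/2⌋ n)))

intervalPairs∈codes : ∀ {Q o n a u} → Interval Q o n (suc a) u → intervalPairs u n ∈ intervalCodes Q o n (suc a)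
intervalPairs∈codes {Q} {o} {n} {a} {u} I = subst (λ w → intervalPairs u n ∈ codes Q w ⌊ n /2⌋)
  (applyUpTo-cong {f = σ} {h = initSlot o n (suc a)} (suc a) (λ j j<a → cong (λ b → if b then initSlot o n (suc a) j else prev (pairUp u n (j ∸ suc a))) (<ᵇ-true j<a)))
  (codes-mem Q ⌊ n /2⌋ a (pairUp u n) σ
    (λ j → trans (cong (λ b → if b then initSlot o n (suc a) (j + suc a) else prev (pairUp u n (j + suc a ∸ suc a))) (<ᵇ-false (m≤n+m (suc a) j))) (cong (prev ∘ pairUp u n) (m+n∸n≡m j (suc a)))) ok)
  where
  open Interval I
  σ : ℕ → Slot
  σ j = if j <ᵇ suc a then initSlot o n (suc a) j else prev (pairUp u n (j ∸ suc a))
  ok : ∀ j → j < ⌊ n /2⌋ → pairUp u n j ∈ allowed Q (σ j)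
  ok j j<h = ∈-filterᵇ⁺ (compatible (σ j)) (∈-pairs⁺ (pos _ 1≤p p≤n) (upper _ 1≤p p≤n) (pos _ 1≤r r≤n) (upper _ 1≤r r≤n)
      (pair (suc j) (n ∸ j) (cong suc (m+[n∸m]≡n (<⇒≤ j<n))) 1≤p 1≤r)) comp
    where
    j<n : j < n
    j<n = ≤-trans j<h (≤-trans (m≤m+n _ _) (2⌊n/2⌋≤n n))
    1≤p : 1 ≤ suc j
    1≤p = s≤s z≤n
    p≤n : suc j ≤ n
    p≤n = j<n
    1≤r : 1 ≤ n ∸ j
    1≤r = m<n⇒0<n∸m j<n
    r≤n : n ∸ j ≤ n
    r≤n = m∸n≤m n j
    comp : compatible (σ j) (pairUp u n j) ≡ true
    comp with j <ᵇ suc a in e₀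
    ... | true with o + suc j <ᵇ suc a in e₁
    ...   | false = refl
    ...   | true with o + (n ∸ j) <ᵇ suc a in e₂
    ...     | false = ≤ᵇ-true (large (suc j) 1≤p p≤n (<ᵇ-true⁻ {o + suc j} {suc a} e₁))
    ...     | true  = cong₂ _∧_ (≤ᵇ-true (large (suc j) 1≤p p≤n (<ᵇ-true⁻ {o + suc j} {suc a} e₁))) (≤ᵇ-true (large (n ∸ j) 1≤r r≤n (<ᵇ-true⁻ {o + (n ∸ j)} {suc a} e₂)))
    comp | false = cong₂ _∧_
        (≤ᵇ-true (subst (λ z → u z ≤ suc (u (suc i))) (cong suc i+a≡j) (chain (suc i) (s≤s z≤n) (≤-trans (≤-reflexive (cong suc i+a≡j)) p≤n))))
        (≤ᵇ-true (subst (λ z → u z ≤ suc (u (n ∸ j))) r+a (chain (n ∸ j) 1≤r (≤-trans (≤-reflexive r+a) (m∸n≤m n i)))))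
      where
      i = j ∸ suc a
      a≤j : suc a ≤ j
      a≤j = <ᵇ-false⁻ {j} {suc a} e₀
      i+a≡j : i + suc a ≡ j
      i+a≡j = m∸n+n≡m a≤j
      r+a : n ∸ j + suc a ≡ n ∸ i
      r+a = trans (cong (λ z → n ∸ z + suc a) (sym i+a≡j)) (trans (cong (_+ suc a) (sym (∸-+-assoc n i (suc a))))
        (m∸n+n≡m (m+n≤o⇒m≤o∸n (suc a) (≤-trans (≤-reflexive (trans (+-comm (suc a) i) i+a≡j)) (<⇒≤ j<n)))))

-- The balance of free and large slots

sumTo-indicator : ∀ t c → sumTo t (λ j → b2n (not (j <ᵇ c))) ≡ t ∸ c
sumTo-indicator zero    c = sym (0∸n≡0 c)
sumTo-indicator (suc t) c with t <ᵇ c in eq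
... | true  = trans (+-identityʳ _) (trans (sumTo-indicator t c)
                (trans (m≤n⇒m∸n≡0 (<⇒≤ (<ᵇ-true⁻ {t} {c} eq))) (sym (m≤n⇒m∸n≡0 (<ᵇ-true⁻ {t} {c} eq)))))
... | false = trans (cong (_+ 1) (sumTo-indicator t c)) (trans (+-comm _ 1) (sym (+-∸-assoc 1 (<ᵇ-false⁻ {t} {c} eq))))

-- `frees` and `larges` are the exponents of 20/17 and of 17/20 in the value of an initial slot;
-- `larges` counts the positions known to hold at least 2.
frees : Slot → ℕ
frees free = 1
frees _    = 0

larges : Slot → ℕ
larges left-large = 1
larges both-large = 2
larges _          = 0

data Initial : Slot → Set where
  i-free : Initial free
  i-left : Initial left-large
  i-both : Initial both-large

initSlot-initial : ∀ o n a j → Initial (initSlot o n a j)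
initSlot-initial o n a j with o + suc j <ᵇ a
... | false = i-free
... | true with o + (n ∸ j) <ᵇ a
...   | false = i-left
...   | true  = i-both

take-applyUpTo : ∀ {A : Set} (f : ℕ → A) h n → take h (applyUpTo f n) ≡ applyUpTo f (h ⊓ n)
take-applyUpTo f zero    n       = refl
take-applyUpTo f (suc h) zero    = refl
take-applyUpTo f (suc h) (suc n) = cong (f 0 ∷_) (take-applyUpTo (f ∘ suc) h n)

sumOn-applyUpTo : ∀ {A : Set} (w : A → ℕ) (f : ℕ → A) n → sumOn w (applyUpTo f n) ≡ sumTo n (w ∘ f)
sumOn-applyUpTo w f n = trans (cong (sumOn w) (sym (map-upTo f n))) (trans (sumOn-map w f (upTo n)) (sumOn-upTo (w ∘ f) n))

slotValues-initial : ∀ Q {ss} → All Initial ss →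
  prod (map (slotValue Q) ss) * (17 ^ sumOn frees ss * 20 ^ sumOn larges ss)
  ≡ unit ^ length ss * (20 ^ sumOn frees ss * 17 ^ sumOn larges ss)
slotValues-initial Q []       = refl
slotValues-initial Q {ss = s ∷ ss} (i ∷ is) = begin
  v s * P * (17 ^ (frees s + F) * 20 ^ (larges s + R))
    ≡⟨ cong (v s * P *_) (cong₂ _*_ (^-distribˡ-+-* 17 (frees s) F) (^-distribˡ-+-* 20 (larges s) R)) ⟩
  v s * P * (17 ^ frees s * 17 ^ F * (20 ^ larges s * 20 ^ R))
    ≡⟨ lem (v s) P (17 ^ frees s) (17 ^ F) (20 ^ larges s) (20 ^ R) ⟩
  v s * (17 ^ frees s * 20 ^ larges s) * (P * (17 ^ F * 20 ^ R))
    ≡⟨ cong₂ _*_ (one i) (slotValues-initial Q is) ⟩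
  unit * (20 ^ frees s * 17 ^ larges s) * (unit ^ length ss * (20 ^ F * 17 ^ R))
    ≡⟨ lem₂ unit (20 ^ frees s) (17 ^ larges s) (unit ^ length ss) (20 ^ F) (17 ^ R) ⟩
  unit * unit ^ length ss * (20 ^ frees s * 20 ^ F * (17 ^ larges s * 17 ^ R))
    ≡⟨ cong (unit * unit ^ length ss *_) (cong₂ _*_ (^-distribˡ-+-* 20 (frees s) F) (^-distribˡ-+-* 17 (larges s) R)) ⟨
  unit * unit ^ length ss * (20 ^ (frees s + F) * 17 ^ (larges s + R)) ∎
  where
  open ≡-Reasoning
  v = slotValue Q
  P = prod (map v ss)
  F = sumOn frees ss
  R = sumOn larges ss
  one : ∀ {s} → Initial s → v s * (17 ^ frees s * 20 ^ larges s) ≡ unit * (20 ^ frees s * 17 ^ larges s)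
  one i-free = refl
  one i-left = refl
  one i-both = refl
  lem : ∀ v p a b c d → v * p * (a * b * (c * d)) ≡ v * (a * c) * (p * (b * d))
  lem = solve-∀
  lem₂ : ∀ u a b w c d → u * (a * b) * (w * (c * d)) ≡ u * w * (a * c * (b * d))
  lem₂ = solve-∀

usedSlots : ℕ → ℕ → ℕ → List Slot
usedSlots o n a = take ⌊ n /2⌋ (window o n a)

usedSlots≡ : ∀ o n a → usedSlots o n a ≡ applyUpTo (initSlot o n a) (⌊ n /2⌋ ⊓ a)
usedSlots≡ o n a = take-applyUpTo (initSlot o n a) ⌊ n /2⌋ a

frees-init : ∀ o n a j → frees (initSlot o n a j) ≡ b2n (not (o + suc j <ᵇ a))
frees-init o n a j with o + suc j <ᵇ a
... | false = refl
... | true with o + (n ∸ j) <ᵇ a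
...   | false = refl
...   | true  = refl

-- Slot j is free when o + j + 1 ≥ a, which among j < a happens for at most o + 1 values.
frees-count : ∀ o n a → sumOn frees (usedSlots o n a) ≤ a ⊓ suc o
frees-count o n a = begin
  sumOn frees (usedSlots o n a) ≡⟨ trans (cong (sumOn frees) (usedSlots≡ o n a)) (sumOn-applyUpTo frees _ t) ⟩
  sumTo t (λ j → frees (initSlot o n a j)) ≡⟨ sumTo-cong t (λ j _ → trans (frees-init o n a j) (cong (b2n ∘ not) (shift< j))) ⟩
  sumTo t (λ j → b2n (not (j <ᵇ a ∸ suc o))) ≡⟨ sumTo-indicator t (a ∸ suc o) ⟩
  t ∸ (a ∸ suc o) ≤⟨ ∸-monoˡ-≤ (a ∸ suc o) (m⊓n≤n ⌊ n /2⌋ a) ⟩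
  a ∸ (a ∸ suc o) ≡⟨ m∸[m∸n]≡m⊓n a (suc o) ⟩
  a ⊓ suc o ∎
  where
  open ≤-Reasoning
  t = ⌊ n /2⌋ ⊓ a
  m∸[m∸n]≡m⊓n : ∀ m n → m ∸ (m ∸ n) ≡ m ⊓ n
  m∸[m∸n]≡m⊓n m n with n ≤? m
  ... | yes n≤m = trans (m∸[m∸n]≡n n≤m) (sym (m≥n⇒m⊓n≡n n≤m))
  ... | no n≰m  = trans (cong (m ∸_) (m≤n⇒m∸n≡0 (<⇒≤ (≰⇒> n≰m)))) (sym (m≤n⇒m⊓n≡m (<⇒≤ (≰⇒> n≰m))))
  shift< : ∀ j → (o + suc j <ᵇ a) ≡ (j <ᵇ a ∸ suc o)
  shift< j = bool-ext
    (λ e → <ᵇ-true (m+n≤o⇒m≤o∸n (suc j) (≤-trans (≤-reflexive (lem j o)) (<ᵇ-true⁻ {o + suc j} {a} e))))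
    (λ e → <ᵇ-true (≰⇒> (λ a≤ → <⇒≱ (<ᵇ-true⁻ {j} {a ∸ suc o} e) (m≤n+o⇒m∸n≤o a (suc o) (≤-trans a≤ (≤-reflexive (+-suc o j)))))))
    where
    lem : ∀ j o → suc j + suc o ≡ suc (o + suc j)
    lem = solve-∀

larges-init : ∀ n a j → larges (initSlot 0 n a j)
  ≡ b2n (suc j <ᵇ a) + b2n ((suc j <ᵇ a) ∧ (n ∸ j <ᵇ a))
larges-init n a j with suc j <ᵇ a
... | false = refl
... | true with n ∸ j <ᵇ a
...   | false = refl
...   | true  = refl

-- Of the positions 1 ... n, those below `a` number min (a - 1, n). When a ≤ ⌊ n /2⌋ the left
-- positions alone suffice; otherwise left and right ones are both counted, and only an unpaired
-- middle position can be missed. The 2 covers both that loss and the shift by one.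
larges-count : ∀ n a → 1 ≤ a → a ⊓ suc n ≤ sumOn larges (usedSlots 0 n a) + 2
larges-count n a 1≤a = subst (λ z → a ⊓ suc n ≤ z + 2)
  (sym (trans (cong (sumOn larges) (usedSlots≡ 0 n a)) (sumOn-applyUpTo larges (initSlot 0 n a) (h ⊓ a)))) main
  where
  open ≤-Reasoning
  h = ⌊ n /2⌋
  R : ℕ → ℕ
  R t = sumTo t (λ j → larges (initSlot 0 n a j))
  main : a ⊓ suc n ≤ R (h ⊓ a) + 2
  main with a ≤? h
  ... | yes a≤h = begin
    a ⊓ suc n ≤⟨ m⊓n≤m a (suc n) ⟩
    a ≡⟨ m∸n+n≡m 1≤a ⟨
    a ∸ 1 + 1 ≤⟨ below ⊕ s≤s z≤n ⟩
    R a + 2 ≡⟨ cong (λ z → R z + 2) (m≥n⇒m⊓n≡n a≤h) ⟨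
    R (h ⊓ a) + 2 ∎
    where
    below : a ∸ 1 ≤ R a
    below = begin
      a ∸ 1 ≡⟨ trans (sumTo-const (a ∸ 1) 1) (*-identityʳ _) ⟨
      sumTo (a ∸ 1) (λ _ → 1) ≤⟨ sumTo-mono (a ∸ 1) (λ j j< → subst (1 ≤_) (sym (larges-init n a j))
                                             (≤-trans (≤-reflexive (cong b2n (sym (<ᵇ-true (≤-trans (s≤s j<) (≤-reflexive (m+[n∸m]≡n 1≤a))))))) (m≤m+n _ _))) ⟩
      R (a ∸ 1) ≤⟨ sumTo-≤-extend _ (m∸n≤m a 1) ⟩
      R a ∎
  ... | no a≰h = +-cancelʳ-≤ c (a ⊓ suc n) (R (h ⊓ a) + 2) (begin
    a ⊓ suc n + c ≡⟨ m⊓n+n∸m≡n a (suc n) ⟩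
    suc n ≤⟨ s≤s (n≤1+2⌊n/2⌋ n) ⟩
    2 + (h + h) ≤⟨ +-monoʳ-≤ 2 (+-monoʳ-≤ h (m≤n+m∸n h c)) ⟩
    2 + (h + (c + (h ∸ c))) ≡⟨ lem h c (h ∸ c) ⟩
    h + (h ∸ c) + 2 + c ≤⟨ +-monoˡ-≤ c (+-monoˡ-≤ 2 above) ⟩
    R h + 2 + c ≡⟨ cong (λ z → R z + 2 + c) (m≤n⇒m⊓n≡m (<⇒≤ h<a)) ⟨
    R (h ⊓ a) + 2 + c ∎)
    where
    c = suc n ∸ a
    h<a : h < a
    h<a = ≰⇒> a≰h
    lem : ∀ h c x → 2 + (h + (c + x)) ≡ h + x + 2 + c
    lem = solve-∀
    below : ∀ j → j < h → b2n (not (j <ᵇ c)) ≤ b2n (n ∸ j <ᵇ a)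
    below j j<h with j <ᵇ c in e
    ... | true  = z≤n
    ... | false = ≤-reflexive (cong b2n (sym (<ᵇ-true (≰⇒> (λ a≤n-j → <⇒≱ {j} {c}
        (m+n≤o⇒m≤o∸n (suc j) (s≤s (≤-trans (≤-reflexive (+-comm j a)) (m≤o∸n⇒m+n≤o a j≤n a≤n-j)))) (<ᵇ-false⁻ {j} {c} e))))))
      where
      j≤n : j ≤ n
      j≤n = ≤-trans (<⇒≤ j<h) (≤-trans (m≤m+n h h) (2⌊n/2⌋≤n n))
    above : h + (h ∸ c) ≤ R h
    above = begin
      h + (h ∸ c) ≡⟨ cong₂ _+_ (trans (sumTo-const h 1) (*-identityʳ h)) (sumTo-indicator h c) ⟨
      sumTo h (λ _ → 1) + sumTo h (λ j → b2n (not (j <ᵇ c))) ≡⟨ sumTo-+ h (λ _ → 1) (λ j → b2n (not (j <ᵇ c))) ⟨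
      sumTo h (λ j → 1 + b2n (not (j <ᵇ c))) ≤⟨ sumTo-mono h (λ j j<h → ≤-trans (s≤s (below j j<h))
            (≤-reflexive (sym (trans (larges-init n a j) (cong (λ b → b2n b + b2n (b ∧ (n ∸ j <ᵇ a))) (<ᵇ-true (≤-trans (s≤s j<h) h<a))))))) ⟩
      R h ∎

Tested : ℕ → Set
Tested Q = all (testSlot Q) (testedSlots Q) ≡ true

module _ (Q : ℕ) (tested : Tested Q) where

  private
    test : ∀ sl → sl ∈ testedSlots Q → testSlot Q sl ≡ true
    test = all-elim (testSlot Q) (testedSlots Q) tested
    open Transfer Q unit (slotValue Q) (_∈ testedSlots Q)
      (λ sl sl∈ → ≤ᵇ-true⁻ (proj₁ (∧-true⁻ (test sl sl∈))))
      (λ sl sl∈ → ≤ᵇ-true⁻ (proj₂ (∧-true⁻ {unit * sumOn (wt Q) (allowed Q sl) ≤ᵇ scale Q * slotValue Q sl} (test sl sl∈))))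
      (λ sl s s∈ → there (there (there (∈-map⁺ prev (proj₁ (∈-filterᵇ⁻ (compatible sl) s∈))))))

  intervalCodes-bound : ∀ o n a →
    sumOn (wts Q) (intervalCodes Q o n a) * (17 ^ sumOn frees (usedSlots o n a) * 20 ^ sumOn larges (usedSlots o n a))
    ≤ scale Q ^ ⌊ n /2⌋ * (20 ^ sumOn frees (usedSlots o n a) * 17 ^ sumOn larges (usedSlots o n a))
  intervalCodes-bound o n a = *-cancelˡ-≤ (unit ^ L) {{m^n≢0 unit L}} (begin
    unit ^ L * (S * E) ≡⟨ *-assoc (unit ^ L) S E ⟨
    unit ^ L * S * E ≤⟨ *-monoˡ-≤ E (codes-bound ⌊ n /2⌋ (window o n a) good) ⟩
    scale Q ^ ⌊ n /2⌋ * P * E ≡⟨ *-assoc (scale Q ^ ⌊ n /2⌋) P E ⟩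
    scale Q ^ ⌊ n /2⌋ * (P * E) ≡⟨ cong (scale Q ^ ⌊ n /2⌋ *_) (slotValues-initial Q used-initial) ⟩
    scale Q ^ ⌊ n /2⌋ * (unit ^ L * E′) ≡⟨ lem (scale Q ^ ⌊ n /2⌋) (unit ^ L) E′ ⟩
    unit ^ L * (scale Q ^ ⌊ n /2⌋ * E′) ∎)
    where
    open ≤-Reasoning
    us = usedSlots o n a
    L = length us
    S = sumOn (wts Q) (intervalCodes Q o n a)
    P = prod (map (slotValue Q) us)
    E = 17 ^ sumOn frees us * 20 ^ sumOn larges us
    E′ = 20 ^ sumOn frees us * 17 ^ sumOn larges us
    lem : ∀ a b c → a * (b * c) ≡ b * (a * c)
    lem = solve-∀
    initial∈ : ∀ {sl} → Initial sl → sl ∈ testedSlots Q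
    initial∈ i-free = here refl
    initial∈ i-left = there (here refl)
    initial∈ i-both = there (there (here refl))
    good : All (_∈ testedSlots Q) (window o n a)
    good = AllP.applyUpTo⁺₁ (initSlot o n a) a (λ {j} _ → initial∈ (initSlot-initial o n a j))
    used-initial : All Initial us
    used-initial = subst (All Initial) (sym (usedSlots≡ o n a)) (AllP.applyUpTo⁺₁ (initSlot o n a) _ (λ {j} _ → initSlot-initial o n a j))

-- The hypothesis bounds S / T by (20/17)^(F - R), and F - R ≤ c.
trade : ∀ S T F R c → S * (17 ^ F * 20 ^ R) ≤ T * (20 ^ F * 17 ^ R) → F ≤ R + c → S * 17 ^ c ≤ T * 20 ^ c
trade S T F R c le F≤ = *-cancelʳ-≤ (S * 17 ^ c) (T * 20 ^ c) (17 ^ F * 20 ^ R) {{m*n≢0 (17 ^ F) (20 ^ R) {{m^n≢0 17 F}} {{m^n≢0 20 R}}}} (begin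
  S * 17 ^ c * (17 ^ F * 20 ^ R) ≡⟨ lem₁ S (17 ^ c) (17 ^ F * 20 ^ R) ⟩
  S * (17 ^ F * 20 ^ R) * 17 ^ c ≤⟨ *-monoˡ-≤ (17 ^ c) le ⟩
  T * (20 ^ F * 17 ^ R) * 17 ^ c ≡⟨ lem₂ T (20 ^ F) (17 ^ R) (17 ^ c) ⟩
  T * (20 ^ F * (17 ^ R * 17 ^ c)) ≡⟨ cong (λ z → T * (20 ^ F * z)) (pow 17) ⟩
  T * (20 ^ F * (17 ^ F * 17 ^ d)) ≤⟨ *-monoʳ-≤ T (*-monoʳ-≤ (20 ^ F) (*-monoʳ-≤ (17 ^ F) (^-monoˡ-≤ d (≤ᵇ⇒≤ 17 20 tt)))) ⟩
  T * (20 ^ F * (17 ^ F * 20 ^ d)) ≡⟨ lem₃ T (20 ^ F) (17 ^ F) (20 ^ d) ⟩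
  T * (17 ^ F * (20 ^ F * 20 ^ d)) ≡⟨ cong (λ z → T * (17 ^ F * z)) (sym (pow 20)) ⟩
  T * (17 ^ F * (20 ^ R * 20 ^ c)) ≡⟨ lem₄ T (17 ^ F) (20 ^ R) (20 ^ c) ⟩
  T * 20 ^ c * (17 ^ F * 20 ^ R) ∎)
  where
  open ≤-Reasoning
  d = R + c ∸ F
  pow : ∀ x → x ^ R * x ^ c ≡ x ^ F * x ^ d
  pow x = trans (sym (^-distribˡ-+-* x R c)) (trans (cong (x ^_) (sym (m+[n∸m]≡n F≤))) (^-distribˡ-+-* x F d))
  lem₁ : ∀ a b c → a * b * c ≡ a * c * b
  lem₁ = solve-∀
  lem₂ : ∀ t a b c → t * (a * b) * c ≡ t * (a * (b * c))
  lem₂ = solve-∀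
  lem₃ : ∀ t a b c → t * (a * (b * c)) ≡ t * (b * (a * c))
  lem₃ = solve-∀
  lem₄ : ∀ t a b c → t * (a * (b * c)) ≡ t * c * (a * b)
  lem₄ = solve-∀

-- With offset 0 the only slot that can be free is the one whose left position is `a` itself; it
-- costs the single factor 20/17.
first-interval-bound : ∀ Q → Tested Q → ∀ n a →
  sumOn (wts Q) (intervalCodes Q 0 n a) * 17 ^ 1 ≤ scale Q ^ ⌊ n /2⌋ * 20 ^ 1
first-interval-bound Q t n a = trade (sumOn (wts Q) (intervalCodes Q 0 n a)) (scale Q ^ ⌊ n /2⌋) (sumOn frees (usedSlots 0 n a)) (sumOn larges (usedSlots 0 n a)) 1 (intervalCodes-bound Q t 0 n a)
  (≤-trans (frees-count 0 n a) (≤-trans (m⊓n≤n a 1) (m≤n+m 1 (sumOn larges (usedSlots 0 n a)))))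

-- The second interval may cost (20/17)^(min a ℓ), which the first one pays for.
both-intervals-bound : ∀ Q Q′ → Tested Q → Tested Q′ → ∀ n n′ a → 1 ≤ a →
  sumOn (wts Q) (intervalCodes Q 0 n a) * sumOn (wts Q′) (intervalCodes Q′ (suc n) n′ a) * 17 ^ 4
  ≤ scale Q ^ ⌊ n /2⌋ * scale Q′ ^ ⌊ n′ /2⌋ * 20 ^ 4
both-intervals-bound Q Q′ t t′ n n′ a 1≤a = trade (S * S′) (T * T′) (F + F′) (R + R′) 4 (begin
    S * S′ * (17 ^ (F + F′) * 20 ^ (R + R′)) ≡⟨ cong (S * S′ *_) (cong₂ _*_ (^-distribˡ-+-* 17 F F′) (^-distribˡ-+-* 20 R R′)) ⟩
    S * S′ * (17 ^ F * 17 ^ F′ * (20 ^ R * 20 ^ R′)) ≡⟨ lem S S′ (17 ^ F) (17 ^ F′) (20 ^ R) (20 ^ R′) ⟩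
    S * (17 ^ F * 20 ^ R) * (S′ * (17 ^ F′ * 20 ^ R′)) ≤⟨ *-mono-≤ (intervalCodes-bound Q t 0 n a) (intervalCodes-bound Q′ t′ (suc n) n′ a) ⟩
    T * (20 ^ F * 17 ^ R) * (T′ * (20 ^ F′ * 17 ^ R′)) ≡⟨ lem T T′ (20 ^ F) (20 ^ F′) (17 ^ R) (17 ^ R′) ⟨
    T * T′ * (20 ^ F * 20 ^ F′ * (17 ^ R * 17 ^ R′)) ≡⟨ cong (T * T′ *_) (cong₂ _*_ (^-distribˡ-+-* 20 F F′) (^-distribˡ-+-* 17 R R′)) ⟨
    T * T′ * (20 ^ (F + F′) * 17 ^ (R + R′)) ∎)
  (begin
    -- The exponent 4 is made of one free slot of the first interval, the passage from n + 2 to n +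
    -- 1 in the second minimum, and the 2 of `larges-count`.
    F + F′ ≤⟨ ≤-trans (frees-count 0 n a) (m⊓n≤n a 1) ⊕ frees-count (suc n) n′ a ⟩
    1 + a ⊓ suc (suc n) ≤⟨ s≤s (⊓-suc a (suc n)) ⟩
    2 + a ⊓ suc n ≤⟨ +-monoʳ-≤ 2 (larges-count n a 1≤a) ⟩
    2 + (R + 2) ≡⟨ +-comm 2 (R + 2) ⟩
    R + 2 + 2 ≡⟨ +-assoc R 2 2 ⟩
    R + 4 ≤⟨ +-monoˡ-≤ 4 (m≤m+n R R′) ⟩
    R + R′ + 4 ∎)
  where
  open ≤-Reasoning
  S = sumOn (wts Q) (intervalCodes Q 0 n a)
  S′ = sumOn (wts Q′) (intervalCodes Q′ (suc n) n′ a)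
  T = scale Q ^ ⌊ n /2⌋
  T′ = scale Q′ ^ ⌊ n′ /2⌋
  F = sumOn frees (usedSlots 0 n a)
  F′ = sumOn frees (usedSlots (suc n) n′ a)
  R = sumOn larges (usedSlots 0 n a)
  R′ = sumOn larges (usedSlots (suc n) n′ a)
  lem : ∀ s s′ a b c d → s * s′ * (a * b * (c * d)) ≡ s * (a * c) * (s′ * (b * d))
  lem = solve-∀
  ⊓-suc : ∀ a b → a ⊓ suc b ≤ suc (a ⊓ b)
  ⊓-suc zero    b       = z≤n
  ⊓-suc (suc a) zero    = s≤s (m⊓n≤n a 0)
  ⊓-suc (suc a) (suc b) = s≤s (⊓-suc a b)

-- Intervals without chain conditions

geometric : ℕ → ℕ
geometric zero    = 1
geometric (suc n) = 50 ^ suc n + 31 * geometric n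

-- The factor is 19 = 50 - 31: (50 - 31) · `geometric n` telescopes to 50^(n+1) - 31^(n+1).
geometric-bound : ∀ n → 19 * geometric n ≤ 50 ^ suc n
geometric-bound zero    = ≤ᵇ⇒≤ 19 50 tt
geometric-bound (suc n) = begin
  19 * (P + 31 * geometric n) ≡⟨ lem P (geometric n) ⟩
  19 * P + 31 * (19 * geometric n) ≤⟨ +-monoʳ-≤ (19 * P) (*-monoʳ-≤ 31 (geometric-bound n)) ⟩
  19 * P + 31 * P ≡⟨ lem₂ P ⟩
  50 * P ∎
  where
  open ≤-Reasoning
  P = 50 ^ suc n
  lem : ∀ a b → 19 * (a + 31 * b) ≡ 19 * a + 31 * (19 * b)
  lem = solve-∀
  lem₂ : ∀ a → 19 * a + 31 * a ≡ 50 * a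
  lem₂ = solve-∀

geometric≡ : ∀ n → sumTo (suc n) (λ i → 31 ^ (n ∸ i) * 50 ^ i) ≡ geometric n
geometric≡ zero    = refl
geometric≡ (suc n) = begin
  sumTo (suc n) (λ i → 31 ^ (suc n ∸ i) * 50 ^ i) + 31 ^ (n ∸ n) * 50 ^ suc n
    ≡⟨ cong₂ _+_ (sumTo-cong (suc n) (λ i i≤n → trans (cong (λ z → 31 ^ z * 50 ^ i) (+-∸-assoc 1 (≤-pred i≤n))) (*-assoc 31 (31 ^ (n ∸ i)) (50 ^ i))))
         (trans (cong (λ z → 31 ^ z * 50 ^ suc n) (n∸n≡0 n)) (+-identityʳ _)) ⟩
  sumTo (suc n) (λ i → 31 * (31 ^ (n ∸ i) * 50 ^ i)) + 50 ^ suc n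
    ≡⟨ cong (_+ 50 ^ suc n) (trans (sumTo-cong (suc n) (λ i _ → *-comm 31 (31 ^ (n ∸ i) * 50 ^ i))) (trans (sumTo-*ʳ (suc n) (λ i → 31 ^ (n ∸ i) * 50 ^ i) 31) (cong (_* 31) (geometric≡ n)))) ⟩
  geometric n * 31 + 50 ^ suc n ≡⟨ trans (+-comm _ (50 ^ suc n)) (cong (50 ^ suc n +_) (*-comm (geometric n) 31)) ⟩
  geometric (suc n) ∎
  where open ≡-Reasoning

-- With i = suc Q - r the condition p + r ≥ suc Q reads i ≤ p, so the row is dominated by the
-- geometric series x^(suc Q) / (1 - x) for x = 31/50.
pairs-row : ∀ Q p → p ≤ suc Q →
  19 * sumOn (λ r → wt (suc Q) (p , r)) (filterᵇ (λ r → suc Q ≤ᵇ p + r) (rangeFrom1 (suc Q))) ≤ 50 * (31 ^ suc Q * 50 ^ suc Q)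
pairs-row Q p p≤ = begin
  19 * sumOn w (filterᵇ t (rangeFrom1 (suc Q)))
    ≡⟨ cong (19 *_) (trans (sumOn-filterᵇ w t (rangeFrom1 (suc Q))) (trans (sumOn-applyUpTo (λ r → w r * b2n (t r)) suc (suc Q))
         (sym (sumTo-reverse Q (λ j → w (suc j) * b2n (t (suc j))))))) ⟩
  19 * sumTo (suc Q) (λ i → w (suc (Q ∸ i)) * b2n (t (suc (Q ∸ i))))
    ≤⟨ *-monoʳ-≤ 19 (≤-trans (sumTo-mono (suc Q) (λ i i≤Q → term i (≤-pred i≤Q))) (sumTo-≤-extend f (n≤1+n (suc Q)))) ⟩
  19 * sumTo (suc (suc Q)) (λ i → A * (31 ^ (p ∸ i) * 50 ^ i) * b2n (i <ᵇ suc p))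
    ≡⟨ cong (19 *_) (trans (sumTo-below (λ i → A * (31 ^ (p ∸ i) * 50 ^ i)) (s≤s p≤))
         (trans (sumTo-cong (suc p) (λ i _ → *-comm A (31 ^ (p ∸ i) * 50 ^ i))) (trans (sumTo-*ʳ (suc p) (λ i → 31 ^ (p ∸ i) * 50 ^ i) A) (cong (_* A) (geometric≡ p))))) ⟩
  19 * (geometric p * A) ≡⟨ sym (*-assoc 19 (geometric p) A) ⟩
  19 * geometric p * A ≤⟨ *-monoˡ-≤ A (geometric-bound p) ⟩
  50 * 50 ^ p * A ≡⟨ lem (50 ^ p) (31 ^ suc Q) (50 ^ (suc Q ∸ p)) ⟩
  50 * (31 ^ suc Q * (50 ^ (suc Q ∸ p) * 50 ^ p))
    ≡⟨ cong (λ z → 50 * (31 ^ suc Q * z)) (trans (sym (^-distribˡ-+-* 50 (suc Q ∸ p) p)) (cong (50 ^_) (m∸n+n≡m p≤))) ⟩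
  50 * (31 ^ suc Q * 50 ^ suc Q) ∎
  where
  open ≤-Reasoning
  w : ℕ → ℕ
  w r = wt (suc Q) (p , r)
  t : ℕ → Bool
  t r = suc Q ≤ᵇ p + r
  A = 31 ^ suc Q * 50 ^ (suc Q ∸ p)
  f : ℕ → ℕ
  f i = A * (31 ^ (p ∸ i) * 50 ^ i) * b2n (i <ᵇ suc p)
  lem : ∀ x a b → 50 * x * (a * b) ≡ 50 * (a * (b * x))
  lem = solve-∀
  term : ∀ i → i ≤ Q → w (suc (Q ∸ i)) * b2n (t (suc (Q ∸ i))) ≤ f i
  term i i≤Q with i ≤? p
  ... | no i≰p = ≤-trans (≤-reflexive (trans (cong (λ b → w (suc (Q ∸ i)) * b2n b) (≡false-from (λ e → i≰p (bad (≤ᵇ-true⁻ e))))) (*-zeroʳ (w (suc (Q ∸ i)))))) z≤n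
    where
    bad : suc Q ≤ p + suc (Q ∸ i) → i ≤ p
    bad le = +-cancelʳ-≤ (Q ∸ i) i p (≤-pred (≤-trans (≤-reflexive (cong suc (m+[n∸m]≡n i≤Q))) (≤-trans le (≤-reflexive (+-suc p (Q ∸ i))))))
  ... | yes i≤p = begin
    w (suc (Q ∸ i)) * b2n (t (suc (Q ∸ i))) ≤⟨ *-monoʳ-≤ (w (suc (Q ∸ i))) (b2n≤1 _) ⟩
    w (suc (Q ∸ i)) * 1 ≡⟨ *-identityʳ _ ⟩
    31 ^ (p + suc (Q ∸ i)) * 50 ^ (2 * suc Q ∸ (p + suc (Q ∸ i)))
      ≡⟨ cong₂ (λ a b → 31 ^ a * 50 ^ b) e₁ (trans (cong (2 * suc Q ∸_) e₁) e₂) ⟩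
    31 ^ (suc Q + (p ∸ i)) * 50 ^ (suc Q ∸ p + i)
      ≡⟨ cong₂ _*_ (^-distribˡ-+-* 31 (suc Q) (p ∸ i)) (^-distribˡ-+-* 50 (suc Q ∸ p) i) ⟩
    31 ^ suc Q * 31 ^ (p ∸ i) * (50 ^ (suc Q ∸ p) * 50 ^ i) ≡⟨ lem₂ (31 ^ suc Q) (31 ^ (p ∸ i)) (50 ^ (suc Q ∸ p)) (50 ^ i) ⟩
    A * (31 ^ (p ∸ i) * 50 ^ i) * 1 ≡⟨ cong (λ b → A * (31 ^ (p ∸ i) * 50 ^ i) * b2n b) (<ᵇ-true (s≤s i≤p)) ⟨
    f i ∎
    where
    lem₂ : ∀ a b c d → a * b * (c * d) ≡ a * c * (b * d) * 1
    lem₂ = solve-∀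
    e₁ : p + suc (Q ∸ i) ≡ suc Q + (p ∸ i)
    e₁ = +-cancelʳ-≡ i _ _ (trans (lem₃ p (Q ∸ i) i) (trans (cong (λ z → suc (p + z)) (m∸n+n≡m i≤Q))
           (trans (cong (λ z → suc (z + Q)) (sym (m∸n+n≡m i≤p))) (lem₄ (p ∸ i) i Q))))
      where
      lem₃ : ∀ p x i → p + suc x + i ≡ suc (p + (x + i))
      lem₃ = solve-∀
      lem₄ : ∀ x i Q → suc (x + i + Q) ≡ suc Q + x + i
      lem₄ = solve-∀
    e₂ : 2 * suc Q ∸ (suc Q + (p ∸ i)) ≡ suc Q ∸ p + i
    e₂ = trans (cong (_∸ (suc Q + (p ∸ i))) (lem₅ (p ∸ i) i (suc Q ∸ p) (suc Q) eqQ)) (m+n∸m≡n (suc Q + (p ∸ i)) _)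
      where
      eqQ : suc Q ≡ suc Q ∸ p + (p ∸ i + i)
      eqQ = sym (trans (cong (suc Q ∸ p +_) (m∸n+n≡m i≤p)) (m∸n+n≡m p≤))
      lem₅ : ∀ x i y Q → Q ≡ y + (x + i) → 2 * Q ≡ Q + x + (y + i)
      lem₅ x i y Q eq = trans (cong (Q +_) (trans (+-identityʳ Q) eq)) (lem₆ x i y Q)
        where
        lem₆ : ∀ x i y Q → Q + (y + (x + i)) ≡ Q + x + (y + i)
        lem₆ = solve-∀

-- Adding up the rows gives at most Q x^Q / (1 - x), which falls below 1 only at Q = 6 and decreases
-- from there. The case Q = 5 is evaluated directly.
pairs-weight : ∀ Q → 5 ≤ Q → sumOn (wt Q) (pairs Q) ≤ scale Q
pairs-weight Q 5≤Q with 6 ≤? Q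
... | no  6≰Q rewrite ≤-antisym (≤-pred (≰⇒> 6≰Q)) 5≤Q = ≤ᵇ⇒≤ (sumOn (wt 5) (pairs 5)) (scale 5) tt
... | yes 6≤Q = big Q 6≤Q
  where
  open ≤-Reasoning
  decay : ∀ d → (6 + d) * 50 * 31 ^ (6 + d) ≤ 19 * 50 ^ (6 + d)
  decay zero    = ≤ᵇ⇒≤ (6 * 50 * 31 ^ 6) (19 * 50 ^ 6) tt
  decay (suc d) = begin
    (7 + d) * 50 * (31 * 31 ^ (6 + d)) ≡⟨ lem₁ (7 + d) (31 ^ (6 + d)) ⟩
    31 * (7 + d) * (50 * 31 ^ (6 + d)) ≤⟨ *-monoˡ-≤ (50 * 31 ^ (6 + d)) (lin (83 + 19 * d) (z≤n {0}) (lem₂ d)) ⟩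
    50 * (6 + d) * (50 * 31 ^ (6 + d)) ≡⟨ lem₃ (6 + d) (31 ^ (6 + d)) ⟩
    50 * ((6 + d) * 50 * 31 ^ (6 + d)) ≤⟨ *-monoʳ-≤ 50 (decay d) ⟩
    50 * (19 * 50 ^ (6 + d)) ≡⟨ lem₄ (50 ^ (6 + d)) ⟩
    19 * (50 * 50 ^ (6 + d)) ∎
    where
    lem₁ : ∀ a b → a * 50 * (31 * b) ≡ 31 * a * (50 * b)
    lem₁ = solve-∀
    lem₂ : ∀ d → 50 * (6 + d) + 0 ≡ 31 * (7 + d) + 0 + (83 + 19 * d)
    lem₂ = solve-∀
    lem₃ : ∀ a b → 50 * a * (50 * b) ≡ 50 * (a * 50 * b)
    lem₃ = solve-∀
    lem₄ : ∀ a → 50 * (19 * a) ≡ 19 * (50 * a)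
    lem₄ = solve-∀
  rows : ∀ Q → 19 * sumOn (wt (suc Q)) (pairs (suc Q)) ≤ suc Q * (50 * (31 ^ suc Q * 50 ^ suc Q))
  rows Q = begin
    19 * sumOn (wt (suc Q)) (pairs (suc Q))
      ≡⟨ cong (19 *_) (trans (sumOn-concatMap (wt (suc Q)) (λ p → map (p ,_) (rs p)) (rangeFrom1 (suc Q)))
           (sumOn-cong {f = λ p → sumOn (wt (suc Q)) (map (p ,_) (rs p))} {h = row} (rangeFrom1 (suc Q)) (λ p _ → sumOn-map (wt (suc Q)) (p ,_) (rs p)))) ⟩
    19 * sumOn row (rangeFrom1 (suc Q)) ≡⟨ sumOn-*ˡ 19 row (rangeFrom1 (suc Q)) ⟨
    sumOn (λ p → 19 * row p) (rangeFrom1 (suc Q)) ≤⟨ sumOn-mono (rangeFrom1 (suc Q)) (λ p p∈ → pairs-row Q p (proj₂ (∈-rangeFrom1⁻ (suc Q) p∈))) ⟩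
    sumOn (λ _ → C) (rangeFrom1 (suc Q)) ≡⟨ sumOn-const C (rangeFrom1 (suc Q)) ⟩
    length (rangeFrom1 (suc Q)) * C ≡⟨ cong (_* C) (length-applyUpTo suc (suc Q)) ⟩
    suc Q * C ∎
    where
    C = 50 * (31 ^ suc Q * 50 ^ suc Q)
    rs : ℕ → List ℕ
    rs p = filterᵇ (λ r → suc Q ≤ᵇ p + r) (rangeFrom1 (suc Q))
    row : ℕ → ℕ
    row p = sumOn (λ r → wt (suc Q) (p , r)) (rs p)
  big : ∀ Q → 6 ≤ Q → sumOn (wt Q) (pairs Q) ≤ scale Q
  big (suc Q) 6≤Q = *-cancelˡ-≤ {sumOn (wt (suc Q)) (pairs (suc Q))} {scale (suc Q)} 19 (begin
    19 * sumOn (wt (suc Q)) (pairs (suc Q)) ≤⟨ rows Q ⟩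
    suc Q * (50 * (31 ^ suc Q * 50 ^ suc Q)) ≡⟨ lem (suc Q) (31 ^ suc Q) (50 ^ suc Q) ⟩
    suc Q * 50 * 31 ^ suc Q * 50 ^ suc Q ≤⟨ *-monoˡ-≤ (50 ^ suc Q) (subst (λ z → z * 50 * 31 ^ z ≤ 19 * 50 ^ z) (m+[n∸m]≡n 6≤Q) (decay (suc Q ∸ 6))) ⟩
    19 * 50 ^ suc Q * 50 ^ suc Q ≡⟨ *-assoc 19 (50 ^ suc Q) _ ⟩
    19 * (50 ^ suc Q * 50 ^ suc Q) ≡⟨ cong (19 *_) (trans (sym (^-distribˡ-+-* 50 (suc Q) (suc Q))) (cong (λ z → 50 ^ (suc Q + z)) (sym (+-identityʳ (suc Q))))) ⟩
    19 * scale (suc Q) ∎)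
    where
    lem : ∀ q a b → q * (50 * (a * b)) ≡ q * 50 * a * b
    lem = solve-∀

free-codes-bound : ∀ Q → 5 ≤ Q → ∀ h xs ys → length xs ≡ h → All (_≡ free) xs → sumOn (wts Q) (codes Q (xs ++ ys) h) ≤ scale Q ^ h
free-codes-bound Q 5≤Q zero    []          ys _   _           = ≤-refl
free-codes-bound Q 5≤Q (suc h) (_ ∷ xs) ys len (refl ∷ fr) = begin
  sumOn (wts Q) (codes Q (free ∷ xs ++ ys) (suc h)) ≡⟨ sumOn-codes-suc Q free (xs ++ ys) h ⟩
  sumOn (λ s → wt Q s * sumOn (wts Q) (codes Q ((xs ++ ys) ∷ʳ prev s) h)) A
    ≤⟨ sumOn-mono A (λ s _ → ≤-trans (*-monoʳ-≤ (wt Q s) (subst (λ w → sumOn (wts Q) (codes Q w h) ≤ scale Q ^ h) (sym (++-assoc xs ys (prev s ∷ [])))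
         (free-codes-bound Q 5≤Q h xs (ys ∷ʳ prev s) (suc-injective len) fr))) (≤-reflexive (*-comm (wt Q s) _))) ⟩
  sumOn (λ s → scale Q ^ h * wt Q s) A ≡⟨ sumOn-*ˡ (scale Q ^ h) (wt Q) A ⟩
  scale Q ^ h * sumOn (wt Q) A ≤⟨ *-monoʳ-≤ (scale Q ^ h) (≤-trans (≤-reflexive (sumOn-filterᵇ (wt Q) (compatible free) (pairs Q)))
                                              (≤-trans (sumOn-mono (pairs Q) (λ s _ → ≤-reflexive (*-identityʳ (wt Q s)))) (pairs-weight Q 5≤Q))) ⟩
  scale Q ^ h * scale Q ≡⟨ *-comm (scale Q ^ h) (scale Q) ⟩
  scale Q ^ suc h ∎
  where
  open ≤-Reasoning
  A = allowed Q free

-- Offset and step `suc n` make every initial slot free and the window longer than the code. No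
-- `prev` slot is reached, and `pairs-weight` bounds every factor by 1.
free-interval-bound : ∀ Q → 5 ≤ Q → ∀ n → sumOn (wts Q) (intervalCodes Q (suc n) n (suc n)) ≤ scale Q ^ ⌊ n /2⌋
free-interval-bound Q 5≤Q n = subst (λ w → sumOn (wts Q) (codes Q w ⌊ n /2⌋) ≤ scale Q ^ ⌊ n /2⌋) (take++drop≡id h (window (suc n) n (suc n)))
  (free-codes-bound Q 5≤Q h (take h W) (drop h W)
    (trans (cong length (take-applyUpTo (initSlot (suc n) n (suc n)) h (suc n))) (trans (length-applyUpTo _ _) (m≤n⇒m⊓n≡m (≤-trans (⌊n/2⌋≤n n) (n≤1+n n)))))
    (subst (All (_≡ free)) (sym (take-applyUpTo (initSlot (suc n) n (suc n)) h (suc n)))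
      (AllP.applyUpTo⁺₁ (initSlot (suc n) n (suc n)) _ (λ {j} _ → cong (λ b → if b then (if suc n + (n ∸ j) <ᵇ suc n then both-large else left-large) else free)
         (<ᵇ-false {suc n + suc j} {suc n} (m≤m+n (suc n) (suc j)))))))
  where
  h = ⌊ n /2⌋
  W = window (suc n) n (suc n)

-- The middle coordinate of an interval of odd length, the only one outside all pairs; for even
-- length it is 0.
center : (ℕ → ℕ) → ℕ → ℕ
center u zero          = 0
center u (suc zero)    = u 1
center u (suc (suc n)) = center (u ∘ suc) n

intervalPairs-suc² : ∀ u n → intervalPairs u (suc (suc n)) ≡ (u 1 , u (suc (suc n))) ∷ intervalPairs (u ∘ suc) n
intervalPairs-suc² u n = cong ((u 1 , u (suc (suc n))) ∷_) (applyUpTo-cong ⌊ n /2⌋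
  (λ j j<h → cong (u (suc (suc j)) ,_) (cong u (+-∸-assoc 1 (≤-trans (<⇒≤ j<h) (⌊n/2⌋≤n n))))))

interval-sum : ∀ u n → sumTo n (u ∘ suc) ≡ size (intervalPairs u n) + center u n
interval-sum u zero          = refl
interval-sum u (suc zero)    = refl
interval-sum u (suc (suc n)) = begin
  sumTo (suc n) (u ∘ suc) + u (suc (suc n)) ≡⟨ cong (_+ u (suc (suc n))) (sumTo-front n (u ∘ suc)) ⟩
  u 1 + sumTo n (u ∘ suc ∘ suc) + u (suc (suc n)) ≡⟨ cong (λ z → u 1 + z + u (suc (suc n))) (interval-sum (u ∘ suc) n) ⟩
  u 1 + (size (intervalPairs (u ∘ suc) n) + c) + u (suc (suc n)) ≡⟨ lem (u 1) _ c (u (suc (suc n))) ⟩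
  u 1 + u (suc (suc n)) + size (intervalPairs (u ∘ suc) n) + c ≡⟨ cong (λ l → size l + c) (intervalPairs-suc² u n) ⟨
  size (intervalPairs u (suc (suc n))) + c ∎
  where
  open ≡-Reasoning
  c = center (u ∘ suc) n
  lem : ∀ a b c d → a + (b + c) + d ≡ a + d + b + c
  lem = solve-∀

center≤ : ∀ u n B → (∀ i → u i ≤ B) → center u n ≤ B
center≤ u zero          B le = z≤n
center≤ u (suc zero)    B le = le 1
center≤ u (suc (suc n)) B le = center≤ (u ∘ suc) n B (λ i → le (suc i))

center≤′ : ∀ u n B → (∀ i → 1 ≤ i → i ≤ n → u i ≤ B) → center u n ≤ B
center≤′ u zero          B le = z≤n
center≤′ u (suc zero)    B le = le 1 ≤-refl ≤-refl
center≤′ u (suc (suc n)) B le = center≤′ (u ∘ suc) n B (λ i 1≤i i≤n → le (suc i) (s≤s z≤n) (s≤s (m≤n⇒m≤1+n i≤n)))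

interval-decode : ∀ u u′ n → intervalPairs u n ≡ intervalPairs u′ n → center u n ≡ center u′ n →
  ∀ i → i < n → u (suc i) ≡ u′ (suc i)
interval-decode u u′ (suc zero)    _  ce zero    _ = ce
interval-decode u u′ (suc zero)    _  ce (suc i) (s≤s ())
interval-decode u u′ (suc (suc n)) pe ce i i<n = by i i<n
  where
  pe′ : (u 1 , u (suc (suc n))) ∷ intervalPairs (u ∘ suc) n ≡ (u′ 1 , u′ (suc (suc n))) ∷ intervalPairs (u′ ∘ suc) n
  pe′ = trans (sym (intervalPairs-suc² u n)) (trans pe (intervalPairs-suc² u′ n))
  inner : ∀ i → i < n → u (suc (suc i)) ≡ u′ (suc (suc i))
  inner = interval-decode (u ∘ suc) (u′ ∘ suc) n (∷-injectiveʳ pe′) ce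
  by : ∀ i → i < suc (suc n) → u (suc i) ≡ u′ (suc i)
  by zero    _ = cong proj₁ (∷-injectiveˡ pe′)
  by (suc i) (s≤s i<) with i <? n
  ... | yes p = inner i p
  ... | no ¬p = subst (λ z → u (suc z) ≡ u′ (suc z)) (cong suc (≤-antisym (≮⇒≥ ¬p) (≤-pred i<))) (cong proj₂ (∷-injectiveˡ pe′))

-- Tilings and growth rates

tilings : ℕ → List (List ℕ)
tilings zero          = [] ∷ []
tilings (suc zero)    = (1 ∷ []) ∷ []
tilings (suc (suc n)) = map (1 ∷_) (tilings (suc n)) ++ map (2 ∷_) (tilings n)

Z : ℕ → ℕ
Z zero          = 1
Z (suc zero)    = 1
Z (suc (suc n)) = Z (suc n) + Z n

length-tilings : ∀ n → length (tilings n) ≡ Z n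
length-tilings zero          = refl
length-tilings (suc zero)    = refl
length-tilings (suc (suc n)) = trans (length-++ (map (1 ∷_) (tilings (suc n))))
  (cong₂ _+_ (trans (length-map _ (tilings (suc n))) (length-tilings (suc n))) (trans (length-map _ (tilings n)) (length-tilings n)))

OneTwo : ℕ → Set
OneTwo c = 1 ≤ c × c ≤ 2

tilings-complete : ∀ u → All OneTwo u → u ∈ tilings (sum u)
tilings-complete [] _ = here refl
tilings-complete (1 ∷ u) (_ ∷ ot) = one (sum u) (tilings-complete u ot)
  where
  one : ∀ n {u} → u ∈ tilings n → 1 ∷ u ∈ tilings (suc n)
  one zero    (here refl) = here refl
  one (suc n) u∈          = ∈-++⁺ˡ (∈-map⁺ (1 ∷_) u∈)
tilings-complete (2 ∷ u) (_ ∷ ot) = ∈-++⁺ʳ (map (1 ∷_) (tilings (suc (sum u)))) (∈-map⁺ (2 ∷_) (tilings-complete u ot))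
tilings-complete (suc (suc (suc c)) ∷ u) ((_ , s≤s (s≤s ())) ∷ ot)

tilings-sound : ∀ n {u} → u ∈ tilings n → sum u ≡ n × All OneTwo u
tilings-sound zero       (here refl) = refl , []
tilings-sound (suc zero) (here refl) = refl , (≤-refl , s≤s z≤n) ∷ []
tilings-sound (suc (suc n)) u∈ with ∈-++⁻ (map (1 ∷_) (tilings (suc n))) u∈
... | inj₁ p with ∈-map⁻ (1 ∷_) p
...   | u′ , u′∈ , refl with tilings-sound (suc n) u′∈
...     | s , ot = cong suc s , (≤-refl , s≤s z≤n) ∷ ot
tilings-sound (suc (suc n)) u∈ | inj₂ p with ∈-map⁻ (2 ∷_) p
...   | u′ , u′∈ , refl with tilings-sound n u′∈
...     | s , ot = cong (suc ∘ suc) s , (s≤s z≤n , ≤-refl) ∷ ot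

tilings-unique : ∀ n → Unique (tilings n)
tilings-unique zero          = [] ∷ []
tilings-unique (suc zero)    = [] ∷ []
tilings-unique (suc (suc n)) = Uniq.++⁺ (Uniq.map⁺ ∷-injectiveʳ (tilings-unique (suc n))) (Uniq.map⁺ ∷-injectiveʳ (tilings-unique n))
  λ { (p , q) → disj p q }
  where
  disj : ∀ {u} → u ∈ map (1 ∷_) (tilings (suc n)) → u ∈ map (2 ∷_) (tilings n) → ⊥
  disj p q with ∈-map⁻ (1 ∷_) p | ∈-map⁻ (2 ∷_) q
  ... | _ , _ , refl | _ , _ , ()

Z-pos : ∀ n → 1 ≤ Z n
Z-pos zero          = ≤-refl
Z-pos (suc zero)    = ≤-refl
Z-pos (suc (suc n)) = ≤-trans (Z-pos (suc n)) (m≤m+n _ _)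

Z-suc : ∀ n → Z n ≤ Z (suc n)
Z-suc zero    = ≤-refl
Z-suc (suc n) = m≤m+n (Z (suc n)) (Z n)

Z-mono : ∀ {a b} → a ≤ b → Z a ≤ Z b
Z-mono {a} {b} a≤b = subst (λ z → Z a ≤ Z z) (m+[n∸m]≡n a≤b) (up (b ∸ a))
  where
  up : ∀ d → Z a ≤ Z (a + d)
  up zero    = ≤-reflexive (cong Z (sym (+-identityʳ a)))
  up (suc d) = ≤-trans (up d) (≤-trans (Z-suc (a + d)) (≤-reflexive (cong Z (sym (+-suc a d)))))

-- 21/13 is below the golden ratio: (21/13)² ≤ 21/13 + 1.
Z-growth : ∀ n t → 21 ^ t * Z n ≤ 2 * (13 ^ t * Z (t + n))
Z-growth n zero          = lin (Z n) (z≤n {0}) (lem (Z n))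
  where
  lem : ∀ z → 2 * (1 * z) + 0 ≡ 1 * z + 0 + z
  lem = solve-∀
Z-growth n (suc zero)    = lin (5 * Z n) (*-monoʳ-≤ 26 (Z-suc n)) (lem (Z n) (Z (suc n)))
  where
  lem : ∀ a b → 2 * (13 * b) + 26 * a ≡ 21 * a + 26 * b + 5 * a
  lem = solve-∀
Z-growth n (suc (suc t)) = lin (T * Z n)
  (*-monoʳ-≤ 13 (Z-growth n (suc t)) ⊕ *-monoʳ-≤ 169 (Z-growth n t)) (lem T (13 ^ t) (Z n) (Z (suc (t + n))) (Z (t + n)))
  where
  T = 21 ^ t
  lem : ∀ T S z a b → 2 * (13 * (13 * S) * (a + b)) + (13 * (21 * T * z) + 169 * (T * z))
    ≡ 21 * (21 * T) * z + (13 * (2 * (13 * S * a)) + 169 * (2 * (S * b))) + T * z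
  lem = solve-∀

-- This is (1 + 1/P)^n ≥ n/P with denominators cleared.
bernoulli : ∀ P n → n * P ^ n ≤ P * suc P ^ n
bernoulli P zero    = z≤n
bernoulli P (suc n) = begin
  suc n * (P * P ^ n) ≡⟨ lem₁ n P (P ^ n) ⟩
  P * (n * P ^ n) + P * P ^ n ≤⟨ *-monoʳ-≤ P (bernoulli P n) ⊕ *-monoʳ-≤ P (^-monoˡ-≤ n (n≤1+n P)) ⟩
  P * (P * suc P ^ n) + P * suc P ^ n ≡⟨ lem₂ P (suc P ^ n) ⟩
  P * (suc P * suc P ^ n) ∎
  where
  open ≤-Reasoning
  lem₁ : ∀ n P x → suc n * (P * x) ≡ P * (n * x) + P * x
  lem₁ = solve-∀
  lem₂ : ∀ P x → P * (P * x) + P * x ≡ P * (suc P * x)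
  lem₂ = solve-∀

-- Each use of `bernoulli` trades one factor n for an increase of the base by one.
polynomial-vs-exponential : ∀ j P → ∃ λ C → ∀ n → n ^ j * P ^ n ≤ C * (j + P) ^ n
polynomial-vs-exponential zero    P = 1 , λ n → ≤-refl
polynomial-vs-exponential (suc j) P with polynomial-vs-exponential j (suc P)
... | C , bd = P * C , λ n → begin
  n * n ^ j * P ^ n ≡⟨ lem₁ n (n ^ j) (P ^ n) ⟩
  n ^ j * (n * P ^ n) ≤⟨ *-monoʳ-≤ (n ^ j) (bernoulli P n) ⟩
  n ^ j * (P * suc P ^ n) ≡⟨ lem₂ (n ^ j) P (suc P ^ n) ⟩
  P * (n ^ j * suc P ^ n) ≤⟨ *-monoʳ-≤ P (bd n) ⟩
  P * (C * (j + suc P) ^ n) ≡⟨ trans (sym (*-assoc P C _)) (cong (λ z → P * C * z ^ n) (+-suc j P)) ⟩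
  P * C * (suc j + P) ^ n ∎
  where
  open ≤-Reasoning
  lem₁ : ∀ n a b → n * a * b ≡ a * (n * b)
  lem₁ = solve-∀
  lem₂ : ∀ a p b → a * (p * b) ≡ p * (a * b)
  lem₂ = solve-∀

^-*-distrib : ∀ a b n → (a * b) ^ n ≡ a ^ n * b ^ n
^-*-distrib a b zero    = refl
^-*-distrib a b (suc n) = trans (cong (a * b *_) (^-*-distrib a b n)) (lem a b (a ^ n) (b ^ n))
  where
  lem : ∀ a b x y → a * b * (x * y) ≡ a * x * (b * y)
  lem = solve-∀

-- By `Z-growth` the claim reduces to comparing 650^g, from 50 · 13, with 651^g, from 31 · 21.
-- Multiplying both bases by 7 opens seven unit steps from 4550 to 4557: six pay for the parameters
-- and the seventh leaves a factor g that outgrows the constants.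
deep-tail-small : ∀ e → ∃ λ G → ∀ g → G ≤ g → e * ((2 * g + 2) ^ 6 * (50 ^ g * 20 ^ 4)) ≤ 17 ^ 4 * (31 ^ g * Z g)
deep-tail-small e = from (polynomial-vs-exponential 7 4550)
  where
  open ≤-Reasoning
  from : (∃ λ C → ∀ n → n ^ 7 * 4550 ^ n ≤ C * 4557 ^ n) → _
  -- 16384 = 4 · 4^6, where 4^6 comes from 2 g + 2 ≤ 4 g, and 4 from the factor 2 of `Z-growth`
  -- through 2 · 20^4 ≤ 4 · 17^4.
  from (C , bd) = suc (e * 16384 * suc C) , main (20 ^ 4) (17 ^ 4) (≤ᵇ⇒≤ (2 * 20 ^ 4) (17 ^ 4 * 4) tt)
    where
    bd′ : ∀ g → g ^ 7 * 650 ^ g ≤ suc C * 651 ^ g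
    bd′ g = *-cancelˡ-≤ (7 ^ g) {{m^n≢0 7 g}} (begin
      7 ^ g * (g ^ 7 * 650 ^ g) ≡⟨ lem (7 ^ g) (g ^ 7) (650 ^ g) ⟩
      g ^ 7 * (7 ^ g * 650 ^ g) ≡⟨ cong (g ^ 7 *_) (^-*-distrib 7 650 g) ⟨
      g ^ 7 * 4550 ^ g ≤⟨ bd g ⟩
      C * 4557 ^ g ≤⟨ *-monoˡ-≤ (4557 ^ g) (n≤1+n C) ⟩
      suc C * 4557 ^ g ≡⟨ cong (suc C *_) (^-*-distrib 7 651 g) ⟩
      suc C * (7 ^ g * 651 ^ g) ≡⟨ lem (suc C) (7 ^ g) (651 ^ g) ⟩
      7 ^ g * (suc C * 651 ^ g) ∎)
      where
      lem : ∀ a b c → a * (b * c) ≡ b * (a * c)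
      lem = solve-∀
    main : ∀ A B → 2 * A ≤ B * 4 → ∀ g → suc (e * 16384 * suc C) ≤ g → e * ((2 * g + 2) ^ 6 * (50 ^ g * A)) ≤ B * (31 ^ g * Z g)
    main A B 2A≤4B g G≤g = *-cancelˡ-≤ (2 * 13 ^ g) {{m*n≢0 2 (13 ^ g) {{_}} {{m^n≢0 13 g}}}} (begin
      2 * 13 ^ g * (e * ((2 * g + 2) ^ 6 * (50 ^ g * A)))
        ≤⟨ *-monoʳ-≤ (2 * 13 ^ g) (*-monoʳ-≤ e (*-monoˡ-≤ (50 ^ g * A) (^-monoˡ-≤ 6 2g+2≤))) ⟩
      2 * 13 ^ g * (e * ((4 * g) ^ 6 * (50 ^ g * A)))
        ≡⟨ cong (λ z → 2 * 13 ^ g * (e * (z * (50 ^ g * A)))) (^-*-distrib 4 g 6) ⟩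
      2 * 13 ^ g * (e * (4 ^ 6 * g ^ 6 * (50 ^ g * A)))
        ≡⟨ lem₁ (13 ^ g) e (g ^ 6) (50 ^ g) (4 ^ 6) (A) ⟩
      2 * A * (e * 4 ^ 6 * (g ^ 6 * (13 ^ g * 50 ^ g)))
        ≤⟨ *-monoˡ-≤ (e * 4 ^ 6 * (g ^ 6 * (13 ^ g * 50 ^ g))) 2A≤4B ⟩
      B * 4 * (e * 4 ^ 6 * (g ^ 6 * (13 ^ g * 50 ^ g)))
        ≡⟨ lem₂ e (g ^ 6 * (13 ^ g * 50 ^ g)) (B) 4 (4 ^ 6) ⟩
      B * (e * (4 * 4 ^ 6) * (g ^ 6 * (13 ^ g * 50 ^ g)))
        ≡⟨ cong (λ z → B * (e * 16384 * (g ^ 6 * z))) (^-*-distrib 13 50 g) ⟨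
      B * (e * 16384 * (g ^ 6 * 650 ^ g))
        ≤⟨ *-monoʳ-≤ (B) (*-cancelˡ-≤ (suc C) (begin
             suc C * (e * 16384 * (g ^ 6 * 650 ^ g)) ≡⟨ lem₃ (suc C) (e * 16384) (g ^ 6) (650 ^ g) ⟩
             e * 16384 * suc C * g ^ 6 * 650 ^ g ≤⟨ *-monoˡ-≤ (650 ^ g) (*-monoˡ-≤ (g ^ 6) (<⇒≤ G≤g)) ⟩
             g * g ^ 6 * 650 ^ g ≤⟨ bd′ g ⟩
             suc C * 651 ^ g ∎)) ⟩
      B * 651 ^ g
        ≡⟨ cong (B *_) (^-*-distrib 31 21 g) ⟩
      B * (31 ^ g * 21 ^ g)
        ≤⟨ *-monoʳ-≤ (B) (*-monoʳ-≤ (31 ^ g) (subst₂ (λ x y → x ≤ 2 * (13 ^ g * Z y)) (*-identityʳ (21 ^ g)) (+-identityʳ g) (Z-growth 0 g))) ⟩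
      B * (31 ^ g * (2 * (13 ^ g * Z g)))
        ≡⟨ lem₄ (B) (31 ^ g) (13 ^ g) (Z g) ⟩
      2 * 13 ^ g * (B * (31 ^ g * Z g)) ∎)
      where
      2g+2≤ : 2 * g + 2 ≤ 4 * g
      2g+2≤ = lin 0 (*-monoʳ-≤ 2 (≤-trans (s≤s z≤n) G≤g)) (lem g)
        where
        lem : ∀ g → 4 * g + 2 * 1 ≡ 2 * g + 2 + 2 * g + 0
        lem = solve-∀
      lem₁ : ∀ a e x b c d → 2 * a * (e * (c * x * (b * d))) ≡ 2 * d * (e * c * (x * (a * b)))
      lem₁ = solve-∀
      lem₂ : ∀ e x s f c → s * f * (e * c * x) ≡ s * (e * (f * c) * x)
      lem₂ = solve-∀
      lem₃ : ∀ c e x y → c * (e * (x * y)) ≡ e * c * x * y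
      lem₃ = solve-∀
      lem₄ : ∀ s a b z → s * (a * (2 * (b * z))) ≡ 2 * b * (s * (a * z))
      lem₄ = solve-∀

-- A geometric series of ratio P / (P + 1) sums to P + 1 times its first term.
geometric-tail : ∀ P C (c : ℕ → ℕ) → (∀ n → c n * suc P ^ n ≤ C * P ^ n) →
  ∀ N D → sumTo N (λ i → c (D + i)) * suc P ^ D ≤ suc P * (C * P ^ D)
geometric-tail P C c le zero    D = z≤n
geometric-tail P C c le (suc N) D = *-cancelˡ-≤ (suc P) (begin
  suc P * (sumTo (suc N) (λ i → c (D + i)) * suc P ^ D)
    ≡⟨ cong (λ z → suc P * (z * suc P ^ D)) (trans (sumTo-front N (λ i → c (D + i))) (cong₂ _+_ (cong c (+-identityʳ D)) (sumTo-cong N (λ i _ → cong c (+-suc D i))))) ⟩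
  suc P * ((c D + S) * suc P ^ D) ≡⟨ lem₁ (suc P) (c D) S (suc P ^ D) ⟩
  suc P * (c D * suc P ^ D) + S * (suc P * suc P ^ D)
    ≤⟨ *-monoʳ-≤ (suc P) (le D) ⊕ geometric-tail P C c le N (suc D) ⟩
  suc P * (C * P ^ D) + suc P * (C * (P * P ^ D)) ≡⟨ lem₂ P C (P ^ D) ⟩
  suc P * (suc P * (C * P ^ D)) ∎)
  where
  open ≤-Reasoning
  S = sumTo N (λ i → c (suc D + i))
  lem₁ : ∀ p c s x → p * ((c + s) * x) ≡ p * (c * x) + s * (p * x)
  lem₁ = solve-∀
  lem₂ : ∀ P C x → suc P * (C * x) + suc P * (C * (P * x)) ≡ suc P * (suc P * (C * x))
  lem₂ = solve-∀

-- Chosen for `bernoulli`: (P / (P + 1))^D ≤ P / D, and with this D the right side is 1 / (e (P + 1)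
-- C), exactly what the tail of the series requires.
geometricCut : ℕ → ℕ → ℕ → ℕ
geometricCut P C e = e * (suc P * C) * P

geometric-tail-small : ∀ P .{{_ : NonZero P}} C e z (c : ℕ → ℕ) → (∀ n → c n * suc P ^ n ≤ C * z * P ^ n) →
  ∀ N → e * sumTo N (λ i → c (geometricCut P C e + i)) ≤ z
geometric-tail-small P C e z c le N = *-cancelʳ-≤ (e * S) z (suc P ^ D) {{m^n≢0 (suc P) D}} (begin
  e * S * suc P ^ D ≡⟨ *-assoc e S (suc P ^ D) ⟩
  e * (S * suc P ^ D) ≤⟨ *-monoʳ-≤ e (geometric-tail P (C * z) c le N D) ⟩
  e * (suc P * (C * z * P ^ D)) ≡⟨ lem₁ e (suc P) C z (P ^ D) ⟩
  z * (e * (suc P * C) * P ^ D) ≤⟨ *-monoʳ-≤ z (*-cancelˡ-≤ P (≤-trans (≤-reflexive (lem₂ P (e * (suc P * C)) (P ^ D))) (bernoulli P D))) ⟩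
  z * suc P ^ D ∎)
  where
  open ≤-Reasoning
  D = geometricCut P C e
  S = sumTo N (λ i → c (D + i))
  lem₁ : ∀ e p C z x → e * (p * (C * z * x)) ≡ z * (e * (p * C) * x)
  lem₁ = solve-∀
  lem₂ : ∀ p x y → p * (x * y) ≡ x * p * y
  lem₂ = solve-∀

-- Words of depth at least 3

-- The last maximum is taken because strictness to its right gives the upper bound q - 1 of the
-- second interval, matching the weaker pair bound q - 1 there.
last-maximum : ∀ (u : ℕ → ℕ) m → ∃ λ l → l ≤ m × (∀ i → i ≤ m → u i ≤ u l) × (∀ i → l < i → i ≤ m → suc (u i) ≤ u l)
last-maximum u zero = 0 , z≤n , (λ { zero _ → ≤-refl ; (suc i) () }) , λ i 0<i i≤0 → contradiction (≤-trans 0<i i≤0) λ ()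
last-maximum u (suc m) with last-maximum u m
... | l , l≤m , max , after with u l ≤? u (suc m)
... | yes le = suc m , ≤-refl , max′ , λ i m<i i≤m → contradiction i≤m (<⇒≱ m<i)
  where
  max′ : ∀ i → i ≤ suc m → u i ≤ u (suc m)
  max′ i i≤ with m≤n⇒m<n∨m≡n i≤
  ... | inj₁ i< = ≤-trans (max i (≤-pred i<)) le
  ... | inj₂ refl = ≤-refl
... | no nle = l , m≤n⇒m≤1+n l≤m , max′ , after′
  where
  max′ : ∀ i → i ≤ suc m → u i ≤ u l
  max′ i i≤ with m≤n⇒m<n∨m≡n i≤
  ... | inj₁ i< = max i (≤-pred i<)
  ... | inj₂ refl = <⇒≤ (≰⇒> nle)
  after′ : ∀ i → l < i → i ≤ suc m → suc (u i) ≤ u l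
  after′ i l<i i≤ with m≤n⇒m<n∨m≡n i≤
  ... | inj₁ i< = after i l<i (≤-pred i<)
  ... | inj₂ refl = ≰⇒> nle

module _ {m : ℕ} {k : ℕ → ℕ} (K : Kunz m k) where

  open Kunz K

  k-pos′ : ∀ i → 1 ≤ i → i ≤ m → 1 ≤ k i
  k-pos′ (suc i) _ i≤m = k-pos i i≤m

  -- suc a is the first index with k = 1, or suc m if there is none.
  first-one : ∃ λ a → a ≤ m × (∀ i → 1 ≤ i → i ≤ m → i < suc a → 2 ≤ k i) × (suc a ≤ m → k (suc a) ≤ 1)
  first-one with least (λ i → (k (suc i) ≤ᵇ 1) ∨ not (i <ᵇ m)) m (lem m)
    where
    lem : ∀ m → (k (suc m) ≤ᵇ 1) ∨ not (m <ᵇ m) ≡ true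
    lem m = trans (cong (λ b → (k (suc m) ≤ᵇ 1) ∨ not b) (<ᵇ-false {m} {m} ≤-refl)) (∨-zeroʳ (k (suc m) ≤ᵇ 1))
  ... | a , a≤m , pa , below = a , a≤m , large , one
    where
    ∨-false⁻ : ∀ {x y} → x ∨ y ≡ false → x ≡ false
    ∨-false⁻ {false} _ = refl
    ∨-left : ∀ {x y} → x ∨ not y ≡ true → y ≡ true → x ≡ true
    ∨-left {true} _ _ = refl
    ∨-left {false} {true} () _
    large : ∀ i → 1 ≤ i → i ≤ m → i < suc a → 2 ≤ k i
    large (suc i) _ _ (s≤s i<a) = ≰⇒> (λ le → true≢false (≤ᵇ-true le) (∨-false⁻ (below i i<a)))
    one : suc a ≤ m → k (suc a) ≤ 1
    one a<m = ≤ᵇ-true⁻ (∨-left {y = a <ᵇ m} pa (<ᵇ-true a<m))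

  module _ {n : ℕ} (n<m : n < m) (max : ∀ i → i ≤ m → k i ≤ k (suc n)) (after : ∀ i → suc n < i → i ≤ m → suc (k i) ≤ k (suc n)) where

    private
      q = k (suc n)
      n′ = m ∸ suc n
      n+n′ : suc n + n′ ≡ m
      n+n′ = m+[n∸m]≡n n<m

    first-interval : ∀ a → (∀ i → 1 ≤ i → i ≤ n → i < suc a → 2 ≤ k i) → (suc a ≤ n → k (suc a) ≤ 1) → Interval q 0 n (suc a) k
    first-interval a large one = record
      { pos   = λ i 1≤i i≤n → k-pos′ i 1≤i (≤-trans i≤n (<⇒≤ n<m))
      ; upper = λ i 1≤i i≤n → max i (≤-trans i≤n (<⇒≤ n<m))
      ; pair  = λ i j i+j _ _ → subst (λ z → k z ≤ k i + k j) i+j (k-sub i j (≤-trans (≤-reflexive i+j) n<m))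
      ; chain = λ i 1≤i i+a≤n → ≤-trans (k-sub i (suc a) (≤-trans i+a≤n (<⇒≤ n<m)))
                  (≤-trans (+-monoʳ-≤ (k i) (one (≤-trans (m≤n+m (suc a) i) i+a≤n))) (≤-reflexive (+-comm (k i) 1)))
      ; large = large
      }

    second-interval : ∀ a → (∀ i → 1 ≤ i → i ≤ m → i < suc a → 2 ≤ k i) → (suc a ≤ m → k (suc a) ≤ 1) →
      Interval (q ∸ 1) (suc n) n′ (suc a) (λ i → k (suc n + i))
    second-interval a large one = record
      { pos   = λ i 1≤i i≤n′ → k-pos′ _ (s≤s z≤n) (in-range i i≤n′)
      ; upper = λ i 1≤i i≤n′ → ∸-monoˡ-≤ 1 (after _ (≤-trans (≤-reflexive (+-comm 1 (suc n))) (+-monoʳ-≤ (suc n) 1≤i)) (in-range i i≤n′))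
      ; pair  = λ i j i+j 1≤i 1≤j → ∸-monoˡ-≤ 1 (k-wrap (suc n + i) (suc n + j) (suc n)
                  (in-range i (≤-pred (≤-trans (≤-trans (≤-reflexive (+-comm 1 i)) (+-monoʳ-≤ i 1≤j)) (≤-reflexive i+j))))
                  (in-range j (≤-pred (≤-trans (+-monoˡ-≤ j 1≤i) (≤-reflexive i+j))))
                  (trans (lem (suc n) i j) (cong (suc n +_) (trans (cong (suc n +_) i+j) (trans (+-suc (suc n) n′) (cong suc n+n′))))))
      ; chain = λ i 1≤i i+a≤n′ → ≤-trans (≤-reflexive (cong k (sym (+-assoc (suc n) i (suc a)))))
                  (≤-trans (k-sub (suc n + i) (suc a) (≤-trans (≤-reflexive (+-assoc (suc n) i (suc a))) (in-range (i + suc a) i+a≤n′)))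
                  (≤-trans (+-monoʳ-≤ (k (suc n + i)) (one (≤-trans (m≤n+m (suc a) i) (≤-trans i+a≤n′ (m∸n≤m m (suc n)))))) (≤-reflexive (+-comm _ 1))))
      ; large = λ i 1≤i i≤n′ lt → large (suc n + i) (s≤s z≤n) (in-range i i≤n′) lt
      }
      where
      in-range : ∀ i → i ≤ n′ → suc n + i ≤ m
      in-range i i≤ = ≤-trans (+-monoʳ-≤ (suc n) i≤) (≤-reflexive n+n′)
      lem : ∀ s i j → s + i + (s + j) ≡ s + (s + (i + j))
      lem = solve-∀

-- A step and an offset beyond the end of the interval make `chain` and `large` vacuous, while the
-- pair condition stays.
unchained : ∀ {Q o n a u} → Interval Q o n a u → Interval Q (suc n) n (suc n) u
unchained {n = n} I = record
  { pos = pos ; upper = upper ; pair = pair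
  ; chain = λ i _ i+n≤n → contradiction (≤-trans (m≤n+m (suc n) i) i+n≤n) (<⇒≱ ≤-refl)
  ; large = λ i _ _ lt → contradiction (≤-trans (m≤m+n (suc n) i) (≤-pred lt)) (<⇒≱ ≤-refl) }
  where open Interval I

-- Counting codes of bounded size

fits : ℕ → List State × List State → Bool
fits g (l , l′) = size l + size l′ ≤ᵇ g

codePairs : ℕ → List (List State) → List (List State) → List (List State × List State)
codePairs g L L′ = filterᵇ (fits g) (concatMap (λ l → map (l ,_) L′) L)

-- Rankin's trick: a pair of codes of total size at most g has normalised weight at least (31/50)^g,
-- so their number is at most (50/31)^g times the total weight.
codePairs-bound : ∀ g Q Q′ win win′ h h′ A B →
  sumOn (wts Q) (codes Q win h) * sumOn (wts Q′) (codes Q′ win′ h′) * A ≤ scale Q ^ h * scale Q′ ^ h′ * B →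
  length (codePairs g (codes Q win h) (codes Q′ win′ h′)) * (31 ^ g * A) ≤ 50 ^ g * B
codePairs-bound g Q Q′ win win′ h h′ A B le = *-cancelˡ-≤ T {{m*n≢0 (scale Q ^ h) (scale Q′ ^ h′) {{m^n≢0 (scale Q) h {{m^n≢0 50 (2 * Q)}}}} {{m^n≢0 (scale Q′) h′ {{m^n≢0 50 (2 * Q′)}}}}}} (begin
  T * (length P * (31 ^ g * A)) ≡⟨ lem₁ T (length P) (31 ^ g) A ⟩
  length P * (T * 31 ^ g) * A ≡⟨ cong (_* A) (sumOn-const (T * 31 ^ g) P) ⟨
  sumOn (λ _ → T * 31 ^ g) P * A ≤⟨ *-monoˡ-≤ A (sumOn-mono P (λ { (l , l′) ∈P → each l l′ ∈P })) ⟩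
  sumOn (λ x → 50 ^ g * w x) P * A ≡⟨ cong (_* A) (sumOn-*ˡ (50 ^ g) w P) ⟩
  50 ^ g * sumOn w P * A ≤⟨ *-monoˡ-≤ A (*-monoʳ-≤ (50 ^ g) total) ⟩
  50 ^ g * (S * S′) * A ≡⟨ *-assoc (50 ^ g) (S * S′) A ⟩
  50 ^ g * (S * S′ * A) ≤⟨ *-monoʳ-≤ (50 ^ g) le ⟩
  50 ^ g * (T * B) ≡⟨ lem₂ (50 ^ g) T B ⟩
  T * (50 ^ g * B) ∎)
  where
  open ≤-Reasoning
  L = codes Q win h
  L′ = codes Q′ win′ h′
  P = codePairs g L L′
  T = scale Q ^ h * scale Q′ ^ h′
  S = sumOn (wts Q) L
  S′ = sumOn (wts Q′) L′
  w : List State × List State → ℕ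
  w (l , l′) = wts Q l * wts Q′ l′
  lem₁ : ∀ t p x a → t * (p * (x * a)) ≡ p * (t * x) * a
  lem₁ = solve-∀
  lem₂ : ∀ t p x → t * (p * x) ≡ p * (t * x)
  lem₂ = solve-∀
  total : sumOn w P ≤ S * S′
  total = begin
    sumOn w P ≡⟨ sumOn-filterᵇ w (fits g) (concatMap (λ l → map (l ,_) L′) L) ⟩
    sumOn (λ x → w x * b2n (fits g x)) (concatMap (λ l → map (l ,_) L′) L)
      ≤⟨ sumOn-mono (concatMap (λ l → map (l ,_) L′) L) (λ x _ → ≤-trans (*-monoʳ-≤ (w x) (b2n≤1 (fits g x))) (≤-reflexive (*-identityʳ (w x)))) ⟩
    sumOn w (concatMap (λ l → map (l ,_) L′) L) ≡⟨ sumOn-concatMap w (λ l → map (l ,_) L′) L ⟩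
    sumOn (λ l → sumOn w (map (l ,_) L′)) L
      ≡⟨ sumOn-cong L (λ l _ → trans (sumOn-map w (l ,_) L′) (trans (sumOn-*ˡ (wts Q l) (wts Q′) L′) (*-comm (wts Q l) S′))) ⟩
    sumOn (λ l → S′ * wts Q l) L ≡⟨ trans (sumOn-*ˡ S′ (wts Q) L) (*-comm S′ S) ⟩
    S * S′ ∎
  each : ∀ l l′ → (l , l′) ∈ P → T * 31 ^ g ≤ 50 ^ g * (wts Q l * wts Q′ l′)
  each l l′ ∈P with ∈-filterᵇ⁻ (fits g) {xs = concatMap (λ l → map (l ,_) L′) L} ∈P
  ... | ∈c , le′ with ∈-concatMap-elim (λ l → map (l ,_) L′) L ∈c
  ... | l₀ , l₀∈ , q with ∈-map⁻ (l₀ ,_) q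
  ... | l₁ , l₁∈ , refl with codes-shape Q win h l₀∈ | codes-shape Q′ win′ h′ l₁∈
  ... | refl , all∈ | refl , all∈′ = begin
    T * 31 ^ g ≡⟨ cong (λ z → T * 31 ^ z) s+d ⟩
    T * 31 ^ (s + s′ + d) ≡⟨ cong (T *_) (trans (^-distribˡ-+-* 31 (s + s′) d) (cong (_* 31 ^ d) (^-distribˡ-+-* 31 s s′))) ⟩
    T * (31 ^ s * 31 ^ s′ * 31 ^ d) ≤⟨ *-monoʳ-≤ T (*-monoʳ-≤ (31 ^ s * 31 ^ s′) (^-monoˡ-≤ d (≤ᵇ⇒≤ 31 50 tt))) ⟩
    T * (31 ^ s * 31 ^ s′ * 50 ^ d) ≡⟨ lem₃ (scale Q ^ length l₀) (scale Q′ ^ length l₁) (31 ^ s) (31 ^ s′) (50 ^ d) ⟩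
    31 ^ s * scale Q ^ length l₀ * (31 ^ s′ * scale Q′ ^ length l₁) * 50 ^ d
      ≡⟨ cong (_* 50 ^ d) (cong₂ _*_ (wts-size Q all∈) (wts-size Q′ all∈′)) ⟨
    wts Q l₀ * 50 ^ s * (wts Q′ l₁ * 50 ^ s′) * 50 ^ d ≡⟨ lem₄ (wts Q l₀) (50 ^ s) (wts Q′ l₁) (50 ^ s′) (50 ^ d) ⟩
    50 ^ s * 50 ^ s′ * 50 ^ d * (wts Q l₀ * wts Q′ l₁)
      ≡⟨ cong (_* (wts Q l₀ * wts Q′ l₁)) (trans (cong (50 ^_) s+d) (trans (^-distribˡ-+-* 50 (s + s′) d) (cong (_* 50 ^ d) (^-distribˡ-+-* 50 s s′)))) ⟨
    50 ^ g * (wts Q l₀ * wts Q′ l₁) ∎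
    where
    s = size l₀
    s′ = size l₁
    d = g ∸ (s + s′)
    s+d : g ≡ s + s′ + d
    s+d = sym (m+[n∸m]≡n (≤ᵇ-true⁻ {s + s′} {g} le′))
    lem₃ : ∀ a b x y z → a * b * (x * y * z) ≡ x * a * (y * b) * z
    lem₃ = solve-∀
    lem₄ : ∀ w a w′ b z → w * a * (w′ * b) * z ≡ a * b * z * (w * w′)
    lem₄ = solve-∀

∈-codePairs⁺ : ∀ g {L L′ l l′} → l ∈ L → l′ ∈ L′ → size l + size l′ ≤ g → (l , l′) ∈ codePairs g L L′
∈-codePairs⁺ g {l = l} l∈ l′∈ le = ∈-filterᵇ⁺ (fits g)
  (∈-concatMap-intro _ l∈ (∈-map⁺ (l ,_) l′∈)) (≤ᵇ-true le)

-- The multiplicity is suc m, the maximum q is last attained at suc n and suc a is the first position of a 1.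
-- From q = 6 on, no chain condition is needed.
deepCodes : ℕ → ℕ → ℕ → ℕ → ℕ → List (List State × List State)
deepCodes g m n q a = if q ≤ᵇ 5
  then codePairs g (intervalCodes q 0 n (suc a)) (intervalCodes (q ∸ 1) (suc n) (m ∸ suc n) (suc a))
  else codePairs g (intervalCodes q (suc n) n (suc n)) (intervalCodes (q ∸ 1) (suc (m ∸ suc n)) (m ∸ suc n) (suc (m ∸ suc n)))

deepCodes-bound : ∀ g m n q a → 4 ≤ q → length (deepCodes g m n q a) * (31 ^ g * 17 ^ 4) ≤ 50 ^ g * 20 ^ 4
deepCodes-bound g m n 4 a _ = codePairs-bound g 4 3 (window 0 n (suc a)) (window (suc n) (m ∸ suc n) (suc a)) ⌊ n /2⌋ ⌊ m ∸ suc n /2⌋ (17 ^ 4) (20 ^ 4) (both-intervals-bound 4 3 test-4 test-3 n (m ∸ suc n) (suc a) (s≤s z≤n))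
deepCodes-bound g m n 5 a _ = codePairs-bound g 5 4 (window 0 n (suc a)) (window (suc n) (m ∸ suc n) (suc a)) ⌊ n /2⌋ ⌊ m ∸ suc n /2⌋ (17 ^ 4) (20 ^ 4) (both-intervals-bound 5 4 test-5 test-4 n (m ∸ suc n) (suc a) (s≤s z≤n))
-- From q = 6 on both q and q - 1 are at least 5, so the total weight is at most 1; the factor
-- (20/17)^4 only makes the bound uniform in q.
deepCodes-bound g m n (suc (suc (suc (suc (suc (suc q)))))) a _ = codePairs-bound g (6 + q) (5 + q)
  (window (suc n) n (suc n)) (window (suc n′) n′ (suc n′)) ⌊ n /2⌋ ⌊ n′ /2⌋ (17 ^ 4) (20 ^ 4)
  (*-mono-≤ (*-mono-≤ (free-interval-bound (6 + q) (m≤m+n 5 (suc q)) n) (free-interval-bound (5 + q) (m≤m+n 5 q) n′)) (≤ᵇ⇒≤ (17 ^ 4) (20 ^ 4) tt))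
  where n′ = m ∸ suc n
deepCodes-bound g m n 1 a (s≤s ())
deepCodes-bound g m n 2 a (s≤s (s≤s ()))
deepCodes-bound g m n 3 a (s≤s (s≤s (s≤s ())))

paramLists : ℕ → ℕ → List (List ℕ)
paramLists R zero    = [] ∷ []
paramLists R (suc j) = concatMap (λ x → map (x ∷_) (paramLists R j)) (upTo R)

length-paramLists : ∀ R j → length (paramLists R j) ≡ R ^ j
length-paramLists R zero    = refl
length-paramLists R (suc j) = trans (length-concatMap (λ x → map (x ∷_) (paramLists R j)) (upTo R))
  (trans (sumOn-cong {h = λ _ → R ^ j} (upTo R) (λ x _ → trans (length-map (x ∷_) (paramLists R j)) (length-paramLists R j)))
  (trans (sumOn-const (R ^ j) (upTo R)) (cong (_* R ^ j) (length-upTo R))))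

∈-paramLists : ∀ {R ps} → All (_< R) ps → ps ∈ paramLists R (length ps)
∈-paramLists []         = here refl
∈-paramLists (p< ∷ ps<) = ∈-concatMap-intro _ (∈-upTo⁺ p<) (∈-map⁺ _ (∈-paramLists ps<))

deepCodesAt : ℕ → List ℕ → List (List State × List State)
deepCodesAt g (m ∷ n ∷ q ∷ a ∷ _) = if 4 ≤ᵇ q then deepCodes g m n q a else []
deepCodesAt g _                   = []

-- The six parameters are m, n, q, a and the two middle coordinates. The last two do not restrict
-- the codes, but decoding needs them.
allDeepCodes : ℕ → List (List ℕ × (List State × List State))
allDeepCodes g = concatMap (λ ps → map (ps ,_) (deepCodesAt g ps)) (paramLists (2 * g + 2) 6)

allDeepCodes-bound : ∀ g → length (allDeepCodes g) * (31 ^ g * 17 ^ 4) ≤ (2 * g + 2) ^ 6 * (50 ^ g * 20 ^ 4)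
allDeepCodes-bound g = begin
  length (allDeepCodes g) * A ≡⟨ cong (_* A) (trans (length-concatMap _ Ps) (sumOn-cong Ps (λ ps _ → length-map (ps ,_) (deepCodesAt g ps)))) ⟩
  sumOn (length ∘ deepCodesAt g) Ps * A ≡⟨ trans (*-comm _ A) (sym (sumOn-*ˡ A (length ∘ deepCodesAt g) Ps)) ⟩
  sumOn (λ ps → A * length (deepCodesAt g ps)) Ps ≤⟨ sumOn-mono Ps (λ ps _ → ≤-trans (≤-reflexive (*-comm A _)) (each ps)) ⟩
  sumOn (λ _ → B) Ps ≡⟨ trans (sumOn-const B Ps) (cong (_* B) (length-paramLists (2 * g + 2) 6)) ⟩
  (2 * g + 2) ^ 6 * B ∎
  where
  open ≤-Reasoning
  A = 31 ^ g * 17 ^ 4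
  B = 50 ^ g * 20 ^ 4
  Ps = paramLists (2 * g + 2) 6
  each : ∀ ps → length (deepCodesAt g ps) * A ≤ B
  each []                  = z≤n
  each (_ ∷ [])            = z≤n
  each (_ ∷ _ ∷ [])        = z≤n
  each (_ ∷ _ ∷ _ ∷ [])    = z≤n
  each (m ∷ n ∷ q ∷ a ∷ _) with 4 ≤ᵇ q in e
  ... | false = z≤n
  ... | true  = deepCodes-bound g m n q a (≤ᵇ-true⁻ {4} {q} e)

after : (ℕ → ℕ) → ℕ → ℕ → ℕ
after k n i = k (suc n + i)

word-sum : ∀ {m k} n → Kunz m k → n < m →
  sumTo (suc m) k ≡ size (intervalPairs k n) + center k n + k (suc n) + sumTo (m ∸ suc n) (after k n ∘ suc)
word-sum {m} {k} n K n<m = begin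
  sumTo (suc m) k ≡⟨ cong (λ z → sumTo (suc z) k) (sym (m+[n∸m]≡n n<m)) ⟩
  sumTo (suc (suc n + n′)) k ≡⟨ sumTo-split (suc (suc n)) n′ k ⟩
  sumTo (suc (suc n)) k + sumTo n′ (λ i → k (suc (suc n) + i))
    ≡⟨ cong₂ _+_ (cong (_+ k (suc n)) (trans (sumTo-front n k) (cong₂ _+_ (Kunz.k-zero K) (interval-sum k n))))
         (sumTo-cong n′ (λ i _ → cong k (sym (+-suc (suc n) i)))) ⟩
  size (intervalPairs k n) + center k n + k (suc n) + sumTo n′ (after k n ∘ suc) ∎
  where
  open ≡-Reasoning
  n′ = m ∸ suc n

word-ext : ∀ {m k k′} n → n < m → Kunz m k → Kunz m k′ → intervalPairs k n ≡ intervalPairs k′ n → center k n ≡ center k′ n →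
  k (suc n) ≡ k′ (suc n) → (∀ i → i < m ∸ suc n → after k n (suc i) ≡ after k′ n (suc i)) → ∀ i → i ≤ m → k i ≡ k′ i
word-ext n n<m K K′ pe ce qe ae zero _ = trans (Kunz.k-zero K) (sym (Kunz.k-zero K′))
word-ext {m} {k} {k′} n n<m K K′ pe ce qe ae (suc i) i<m with <-cmp i n
... | tri< i<n _ _ = interval-decode k k′ n pe ce i i<n
... | tri≈ _ refl _ = qe
... | tri> _ _ n<i = subst (λ z → k z ≡ k′ z) eq (ae (i ∸ suc n) (∸-monoˡ-< i<m n<i))
  where
  eq : suc n + suc (i ∸ suc n) ≡ suc i
  eq = trans (+-suc (suc n) (i ∸ suc n)) (cong suc (m+[n∸m]≡n n<i))

record DeepCoded (g : ℕ) (H : List ℕ) (c : List ℕ × (List State × List State)) : Set where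
  constructor deepCoded
  field
    m n a : ℕ
    k     : ℕ → ℕ
    kunz  : Kunz m k
    n<m   : n < m
    H≡    : H ≡ gapList g m k
    c≡    : c ≡ (m ∷ n ∷ k (suc n) ∷ a ∷ center k n ∷ center (after k n) (m ∸ suc n) ∷ [] ,
                 intervalPairs k n , intervalPairs (after k n) (m ∸ suc n))

deepCoded-injective : ∀ {g H H′ c} → DeepCoded g H c → DeepCoded g H′ c → H ≡ H′
deepCoded-injective {g} (deepCoded m n a k K n<m H≡ c≡) (deepCoded m′ n′ a′ k′ K′ n<m′ H≡′ c≡′) =
  go (∷-injectiveˡ params) (∷-injectiveˡ (∷-injectiveʳ params))
  where
  eq = trans (sym c≡) c≡′
  params = cong proj₁ eq
  go : m ≡ m′ → n ≡ n′ → _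
  go refl refl = trans H≡ (trans (gapList-cong g m (word-ext n n<m K K′ (cong (proj₁ ∘ proj₂) eq)
      (∷-injectiveˡ (tl (tl (tl (tl params))))) (∷-injectiveˡ (tl (tl params)))
      (interval-decode (after k n) (after k′ n) (m ∸ suc n) (cong (proj₂ ∘ proj₂) eq) (∷-injectiveˡ (tl (tl (tl (tl (tl params)))))))))
    (sym H≡′))
    where
    tl : ∀ {x y : ℕ} {xs ys} → x ∷ xs ≡ y ∷ ys → xs ≡ ys
    tl = ∷-injectiveʳ

-- After the last 3 all coordinates are 1 or 2, so this part is kept exactly, as a tiling of what
-- remains of g after the pairs, the middle coordinate c and the maximum 3.
shallowCodesAt : ℕ → ℕ → ℕ → ℕ → List (List State × List ℕ)
shallowCodesAt g n a c = concatMap (λ l → map (l ,_) (tilings (g ∸ (size l + (c + 3)))))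
  (filterᵇ (λ l → size l ≤ᵇ g) (intervalCodes 3 0 n (suc a)))

ShallowCode : Set
ShallowCode = ℕ × ℕ × ℕ × List State × List ℕ

shallowCell : ℕ → ℕ → ℕ → ℕ → List ShallowCode
shallowCell g n a c = map (λ x → n , a , c , x) (shallowCodesAt g n a c)

shallowCodes : ℕ → ℕ → List ShallowCode
shallowCodes g n = concatMap (λ a → concatMap (shallowCell g n a) (upTo 4)) (upTo (suc n))

-- For a code of size t, `Z-growth` bounds the number of tilings by 2 (13/21)^t Z g, which is 2
-- (650/651)^t Z g times the normalised weight (31/50)^t. Every coordinate is at least 1, so t ≥ 2 ⌊
-- n /2⌋, which gives the decay in n; the weights add up to at most 20/17.
shallowCodesAt-bound : ∀ g n a c →
  length (shallowCodesAt g n a c) * (651 ^ (2 * ⌊ n /2⌋) * 17) ≤ 40 * (650 ^ (2 * ⌊ n /2⌋) * Z g)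
shallowCodesAt-bound g n a c = *-cancelˡ-≤ T {{m^n≢0 (scale 3) h {{m^n≢0 50 6}}}} (begin
  T * (length (shallowCodesAt g n a c) * (X * 17))
    ≡⟨ cong (λ z → T * (z * (X * 17))) (trans (length-concatMap _ Ls) (sumOn-cong {h = f} Ls (λ l _ → trans (length-map (l ,_) (tilings (g ∸ (size l + (c + 3))))) (length-tilings (g ∸ (size l + (c + 3))))))) ⟩
  T * (sumOn f Ls * (X * 17)) ≡⟨ lem₁ T (sumOn f Ls) X ⟩
  T * X * sumOn f Ls * 17 ≡⟨ cong (_* 17) (sumOn-*ˡ (T * X) f Ls) ⟨
  sumOn (λ l → T * X * f l) Ls * 17 ≤⟨ *-monoˡ-≤ 17 (sumOn-mono Ls each) ⟩
  sumOn (λ l → 2 * (Y * Z g) * wts 3 l) Ls * 17 ≡⟨ cong (_* 17) (sumOn-*ˡ (2 * (Y * Z g)) (wts 3) Ls) ⟩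
  2 * (Y * Z g) * sumOn (wts 3) Ls * 17
    ≤⟨ *-monoˡ-≤ 17 (*-monoʳ-≤ (2 * (Y * Z g)) (≤-trans (≤-reflexive (sumOn-filterᵇ (wts 3) small L))
         (sumOn-mono L (λ l _ → ≤-trans (*-monoʳ-≤ (wts 3 l) (b2n≤1 (small l))) (≤-reflexive (*-identityʳ (wts 3 l))))))) ⟩
  2 * (Y * Z g) * S * 17 ≡⟨ *-assoc (2 * (Y * Z g)) S 17 ⟩
  2 * (Y * Z g) * (S * 17) ≤⟨ *-monoʳ-≤ (2 * (Y * Z g)) (first-interval-bound 3 test-3 n (suc a)) ⟩
  2 * (Y * Z g) * (T * 20) ≡⟨ lem₂ (Y * Z g) T ⟩
  T * (40 * (Y * Z g)) ∎)
  where
  open ≤-Reasoning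
  h = ⌊ n /2⌋
  T = scale 3 ^ h
  X = 651 ^ (2 * h)
  Y = 650 ^ (2 * h)
  L = intervalCodes 3 0 n (suc a)
  S = sumOn (wts 3) L
  small : List State → Bool
  small l = size l ≤ᵇ g
  Ls = filterᵇ small L
  f : List State → ℕ
  f l = Z (g ∸ (size l + (c + 3)))
  lem₁ : ∀ t s x → t * (s * (x * 17)) ≡ t * x * s * 17
  lem₁ = solve-∀
  lem₂ : ∀ y t → 2 * y * (t * 20) ≡ t * (40 * y)
  lem₂ = solve-∀
  each : ∀ l → l ∈ Ls → T * X * f l ≤ 2 * (Y * Z g) * wts 3 l
  each l l∈ with ∈-filterᵇ⁻ small {xs = L} l∈
  ... | l∈L , le with codes-shape 3 (window 0 n (suc a)) h l∈L
  ... | len , all∈ = ≤-trans (*-monoʳ-≤ (T * X) (Z-mono (∸-monoʳ-≤ g (m≤m+n t (c + 3))))) (*-cancelˡ-≤ (651 ^ t) {{m^n≢0 651 t}} (begin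
    651 ^ t * (T * X * Z (g ∸ t)) ≡⟨ cong (_* (T * X * Z (g ∸ t))) (^-*-distrib 31 21 t) ⟩
    31 ^ t * 21 ^ t * (T * X * Z (g ∸ t)) ≡⟨ lem₃ (31 ^ t) (21 ^ t) T X (Z (g ∸ t)) ⟩
    31 ^ t * T * (21 ^ t * Z (g ∸ t)) * X
      ≡⟨ cong (λ z → z * (21 ^ t * Z (g ∸ t)) * X) (trans (cong (λ z → 31 ^ t * scale 3 ^ z) (sym len)) (sym (wts-size 3 all∈))) ⟩
    w * 50 ^ t * (21 ^ t * Z (g ∸ t)) * X ≤⟨ *-monoˡ-≤ X (*-monoʳ-≤ (w * 50 ^ t) (Z-growth (g ∸ t) t)) ⟩
    w * 50 ^ t * (2 * (13 ^ t * Z (t + (g ∸ t)))) * X ≡⟨ cong (λ z → w * 50 ^ t * (2 * (13 ^ t * Z z)) * X) (m+[n∸m]≡n t≤g) ⟩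
    w * 50 ^ t * (2 * (13 ^ t * Z g)) * X ≡⟨ lem₄ w (50 ^ t) (13 ^ t) (Z g) X ⟩
    2 * Z g * w * (13 ^ t * 50 ^ t * X) ≡⟨ cong (λ z → 2 * Z g * w * (z * X)) (^-*-distrib 13 50 t) ⟨
    2 * Z g * w * (650 ^ t * X) ≤⟨ *-monoʳ-≤ (2 * Z g * w) swap-powers ⟩
    2 * Z g * w * (651 ^ t * Y) ≡⟨ lem₅ (Z g) w (651 ^ t) Y ⟩
    651 ^ t * (2 * (Y * Z g) * w) ∎))
    where
    t = size l
    w = wts 3 l
    t≤g : t ≤ g
    t≤g = ≤ᵇ-true⁻ le
    2h≤t : 2 * h ≤ t
    2h≤t = subst (λ z → 2 * z ≤ t) len (size-lower 3 all∈)
    d = t ∸ 2 * h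
    pow : ∀ x → x ^ t ≡ x ^ (2 * h) * x ^ d
    pow x = trans (cong (x ^_) (sym (m+[n∸m]≡n 2h≤t))) (^-distribˡ-+-* x (2 * h) d)
    swap-powers : 650 ^ t * X ≤ 651 ^ t * Y
    swap-powers = begin
      650 ^ t * X ≡⟨ cong (_* X) (pow 650) ⟩
      Y * 650 ^ d * X ≤⟨ *-monoˡ-≤ X (*-monoʳ-≤ Y (^-monoˡ-≤ d (n≤1+n 650))) ⟩
      Y * 651 ^ d * X ≡⟨ lem₆ Y (651 ^ d) X ⟩
      X * 651 ^ d * Y ≡⟨ cong (_* Y) (pow 651) ⟨
      651 ^ t * Y ∎
      where
      lem₆ : ∀ a b c → a * b * c ≡ c * b * a
      lem₆ = solve-∀
    lem₃ : ∀ a b t x z → a * b * (t * x * z) ≡ a * t * (b * z) * x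
    lem₃ = solve-∀
    lem₄ : ∀ w a b z x → w * a * (2 * (b * z)) * x ≡ 2 * z * w * (b * a * x)
    lem₄ = solve-∀
    lem₅ : ∀ z w a y → 2 * z * w * (a * y) ≡ a * (2 * (y * z) * w)
    lem₅ = solve-∀

-- Doubling turns 650/651 into 1300/1302; the n + 1 choices of `a` are then absorbed by moving from
-- 1300 up to 1301. The constant is 24719 = 19 · 1301, where 17 · 19 = 323 exceeds 320 = 4 · 40 · 2:
-- four middle coordinates, the bound of one cell, and 2 for an odd n.
shallowCodes-bound : ∀ g n → length (shallowCodes g n) * 1302 ^ n ≤ 24719 * Z g * 1301 ^ n
shallowCodes-bound g n = *-cancelˡ-≤ 17 (begin
  17 * (c * 1302 ^ n) ≡⟨ cong (λ z → 17 * (c * z)) (trans (^-*-distrib 651 2 n) (cong (_* 2 ^ n) (pow 651))) ⟩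
  17 * (c * (651 ^ hh * 651 ^ r * 2 ^ n)) ≡⟨ lem₁ c (651 ^ hh) (651 ^ r) (2 ^ n) ⟩
  c * (651 ^ hh * 17) * (651 ^ r * 2 ^ n) ≤⟨ *-mono-≤ count (*-monoˡ-≤ (2 ^ n) r-bound) ⟩
  suc n * (4 * B) * (2 * 650 ^ r * 2 ^ n) ≡⟨ lem₂ (suc n) (650 ^ hh) (Z g) (650 ^ r) (2 ^ n) 4 40 2 ⟩
  320 * (Z g * (suc n * (650 ^ hh * 650 ^ r * 2 ^ n)))
    ≡⟨ cong (λ z → 320 * (Z g * (suc n * z))) (trans (cong (_* 2 ^ n) (sym (pow 650))) (sym (^-*-distrib 650 2 n))) ⟩
  320 * (Z g * (suc n * 1300 ^ n)) ≤⟨ *-mono-≤ (m≤m+n 320 3) (*-monoʳ-≤ (Z g) one-more) ⟩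
  323 * (Z g * (1301 * 1301 ^ n)) ≡⟨ lem₃ (Z g) (1301 ^ n) 17 19 1301 ⟩
  17 * (24719 * Z g * 1301 ^ n) ∎)
  where
  open ≤-Reasoning
  c = length (shallowCodes g n)
  hh = 2 * ⌊ n /2⌋
  hh≡ : ⌊ n /2⌋ + ⌊ n /2⌋ ≡ hh
  hh≡ = cong (⌊ n /2⌋ +_) (sym (+-identityʳ ⌊ n /2⌋))
  r = n ∸ hh
  B = 40 * (650 ^ hh * Z g)
  pow : ∀ x → x ^ n ≡ x ^ hh * x ^ r
  pow x = trans (cong (x ^_) (sym (m+[n∸m]≡n (subst (_≤ n) hh≡ (2⌊n/2⌋≤n n))))) (^-distribˡ-+-* x hh r)
  r≤1 : r ≤ 1
  r≤1 = m≤n+o⇒m∸n≤o n hh (≤-trans (n≤1+2⌊n/2⌋ n) (≤-reflexive (trans (cong suc hh≡) (+-comm 1 hh))))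
  r-bound : 651 ^ r ≤ 2 * 650 ^ r
  r-bound with r | r≤1
  ... | zero     | _ = s≤s z≤n
  ... | suc zero | _ = ≤ᵇ⇒≤ 651 1300 tt
  ... | suc (suc _) | s≤s ()
  one-more : suc n * 1300 ^ n ≤ 1301 * 1301 ^ n
  one-more = ^-monoˡ-≤ n (n≤1+n 1300) ⊕ bernoulli 1300 n
  count : c * (651 ^ hh * 17) ≤ suc n * (4 * B)
  count = begin
    c * A
      ≡⟨ cong (_* A) (trans (length-concatMap (λ a → concatMap (shallowCell g n a) (upTo 4)) (upTo (suc n))) (sumOn-cong {h = λ a → sumOn (f a) (upTo 4)} (upTo (suc n)) (λ a _ →
           trans (length-concatMap (shallowCell g n a) (upTo 4)) (sumOn-cong {h = f a} (upTo 4) (λ c _ → length-map (λ x → n , a , c , x) (shallowCodesAt g n a c)))))) ⟩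
    sumOn (λ a → sumOn (f a) (upTo 4)) (upTo (suc n)) * A ≡⟨ trans (*-comm _ A) (sym (sumOn-*ˡ A (λ a → sumOn (f a) (upTo 4)) (upTo (suc n)))) ⟩
    sumOn (λ a → A * sumOn (f a) (upTo 4)) (upTo (suc n))
      ≤⟨ sumOn-mono (upTo (suc n)) (λ a _ → ≤-trans (≤-reflexive (sym (sumOn-*ˡ A (f a) (upTo 4))))
           (≤-trans (sumOn-mono {h = λ _ → B} (upTo 4) (λ c _ → ≤-trans (≤-reflexive (*-comm A (f a c))) (shallowCodesAt-bound g n a c))) (≤-reflexive (sumOn-const B (upTo 4))))) ⟩
    sumOn (λ _ → 4 * B) (upTo (suc n)) ≡⟨ trans (sumOn-const (4 * B) (upTo (suc n))) (cong (_* (4 * B)) (length-upTo (suc n))) ⟩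
    suc n * (4 * B) ∎
    where
    A = 651 ^ hh * 17
    f : ℕ → ℕ → ℕ
    f a c = length (shallowCodesAt g n a c)
  lem₁ : ∀ c a b d → 17 * (c * (a * b * d)) ≡ c * (a * 17) * (b * d)
  lem₁ = solve-∀
  lem₂ : ∀ n a z b d p q r → n * (p * (q * (a * z))) * (r * b * d) ≡ p * q * r * (z * (n * (a * b * d)))
  lem₂ = solve-∀
  lem₃ : ∀ z x p q r → p * q * (z * (r * x)) ≡ p * (q * r * z * x)
  lem₃ = solve-∀

record ShallowCoded (g : ℕ) (H : List ℕ) (c : ShallowCode) : Set where
  constructor shallowCoded
  field
    m n a : ℕ
    k     : ℕ → ℕ
    kunz  : Kunz m k
    n<m   : n < m
    q≡    : k (suc n) ≡ 3
    H≡    : H ≡ gapList g m k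
    c≡    : c ≡ (n , a , center k n , intervalPairs k n , applyUpTo (after k n ∘ suc) (m ∸ suc n))

applyUpTo-injective : ∀ (f h : ℕ → ℕ) n n′ → applyUpTo f n ≡ applyUpTo h n′ → n ≡ n′ × (∀ i → i < n → f i ≡ h i)
applyUpTo-injective f h zero    zero     eq = refl , λ _ ()
applyUpTo-injective f h (suc n) (suc n′) eq with applyUpTo-injective (f ∘ suc) (h ∘ suc) n n′ (∷-injectiveʳ eq)
... | refl , same = refl , λ { zero _ → ∷-injectiveˡ eq ; (suc i) (s≤s i<) → same i i< }

-- The multiplicity is not recorded: it is recovered from n and the number of coordinates after the
-- maximum.
shallowCoded-injective : ∀ {g H H′ c} → ShallowCoded g H c → ShallowCoded g H′ c → H ≡ H′
shallowCoded-injective {g} (shallowCoded m n a k K n<m q≡ H≡ c≡) (shallowCoded m′ n′ a′ k′ K′ n<m′ q≡′ H≡′ c≡′) =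
  go (cong proj₁ eq)
  where
  eq = trans (sym c≡) c≡′
  go : n ≡ n′ → _
  go refl with applyUpTo-injective (after k n ∘ suc) (after k′ n ∘ suc) (m ∸ suc n) (m′ ∸ suc n) (cong (proj₂ ∘ proj₂ ∘ proj₂ ∘ proj₂) eq)
  ... | m≡ , same = go′ (trans (sym (m∸n+n≡m n<m)) (trans (cong (_+ suc n) m≡) (m∸n+n≡m n<m′)))
    where
    go′ : m ≡ m′ → _
    go′ refl = trans H≡ (trans (gapList-cong g m (word-ext n n<m K K′ (cong (proj₁ ∘ proj₂ ∘ proj₂ ∘ proj₂) eq)
      (cong (proj₁ ∘ proj₂ ∘ proj₂) eq) (trans q≡ (sym q≡′)) same)) (sym H≡′))

-- Tame words and the codes of all others

record Tame (D m : ℕ) (k : ℕ → ℕ) : Set where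
  field
    D≤m    : D ≤ m
    prefix : ∀ i → i ≤ D → k i ≤ 3
    suffix : ∀ i → D < i → i ≤ m → k i ≤ 2

TailCode : Set
TailCode = (List ℕ × (List State × List State)) ⊎ ShallowCode

TailCoded : ℕ → List ℕ → TailCode → Set
TailCoded g H (inj₁ c) = DeepCoded g H c
TailCoded g H (inj₂ c) = ShallowCoded g H c

tailCodes : ℕ → ℕ → List TailCode
tailCodes g D = map inj₁ (allDeepCodes g) ++ map inj₂ (concatMap (λ i → shallowCodes g (D + i)) (upTo (2 * g)))

-- Tame are the words of depth at most 2 and those of depth 3 whose last 3 is among the first D
-- coordinates. Their coordinates are at most 3, so 3 D ≤ g leaves room for a prefix of length D. A
-- maximum at index 0 would give genus 0.
tame-or-coded : ∀ {g H} D → 3 * D ≤ g → 1 ≤ g → (d : KunzData g H) →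
  Tame D (KunzData.m d) (KunzData.k d) ⊎ (∃ λ c → c ∈ tailCodes g D × TailCoded g H c)
tame-or-coded {g} {H} D 3D≤g 1≤g d with last-maximum (KunzData.k d) (KunzData.m d)
... | zero , _ , max , _ = contradiction (trans (sym k-sum) (sumTo-0 (suc m) k (λ i i≤m → n≤0⇒n≡0 (≤-trans (max i (≤-pred i≤m)) (≤-reflexive (Kunz.k-zero kunz))))))
    λ { refl → contradiction 1≤g λ () }
  where open KunzData d
... | suc n , n<m , max , aft = by-depth (k (suc n)) refl
  where
  open KunzData d
  n′ = m ∸ suc n
  total : size (intervalPairs k n) + center k n + k (suc n) + sumTo n′ (after k n ∘ suc) ≡ g
  total = trans (sym (word-sum n kunz n<m)) k-sum

  tame : k (suc n) ≤ 3 → (∀ i → D < i → i ≤ m → k i ≤ 2) → Tame D m k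
  tame q≤3 suf = record { D≤m = D≤m ; prefix = λ i i≤D → ≤-trans (max i (≤-trans i≤D D≤m)) q≤3 ; suffix = suf }
    where
    open ≤-Reasoning
    D≤m : D ≤ m
    D≤m = *-cancelˡ-≤ 3 (begin
      3 * D ≤⟨ 3D≤g ⟩
      g ≡⟨ trans (sym k-sum) (trans (sumTo-front m k) (cong (_+ sumTo m (k ∘ suc)) (Kunz.k-zero kunz))) ⟩
      sumTo m (k ∘ suc) ≤⟨ sumTo-mono m (λ i i<m → ≤-trans (max (suc i) i<m) q≤3) ⟩
      sumTo m (λ _ → 3) ≡⟨ trans (sumTo-const m 3) (*-comm m 3) ⟩
      3 * m ∎)

  open Σ (first-one kunz) renaming (proj₁ to a; proj₂ to first)
  a≤m = proj₁ first
  large = proj₁ (proj₂ first)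
  one = proj₂ (proj₂ first)

  deep : 4 ≤ k (suc n) → ∃ λ c → c ∈ tailCodes g D × TailCoded g H c
  deep 4≤q = inj₁ (ps , intervalPairs k n , intervalPairs (after k n) n′) ,
    ∈-++⁺ˡ (∈-map⁺ inj₁ (∈-concatMap-intro _ (∈-paramLists ps<) (∈-map⁺ (ps ,_) in-codes))) ,
    deepCoded m n a k kunz n<m H≡ refl
    where
    ps = m ∷ n ∷ k (suc n) ∷ a ∷ center k n ∷ center (after k n) n′ ∷ []
    bound : ∀ {x} → x ≤ suc (2 * g) → x < 2 * g + 2
    bound x≤ = ≤-trans (s≤s x≤) (≤-reflexive (+-comm 2 (2 * g)))
    m≤′ : m ≤ suc (2 * g)
    m≤′ = m≤n⇒m≤1+n m≤
    ps< : All (_< 2 * g + 2) ps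
    ps< = bound m≤′ ∷ bound (≤-trans (<⇒≤ n<m) m≤′) ∷ bound (k≤ (suc n)) ∷ bound (≤-trans a≤m m≤′)
      ∷ bound (center≤ k n _ k≤) ∷ bound (center≤ (after k n) n′ _ (λ i → k≤ (suc n + i))) ∷ []
    I₁ : Interval (k (suc n)) 0 n (suc a) k
    I₁ = first-interval kunz n<m max aft a (λ i 1≤i i≤n → large i 1≤i (≤-trans i≤n (<⇒≤ n<m))) (λ le → one (≤-trans le (<⇒≤ n<m)))
    I₂ : Interval (k (suc n) ∸ 1) (suc n) n′ (suc a) (after k n)
    I₂ = second-interval kunz n<m max aft a large one
    size≤ : size (intervalPairs k n) + size (intervalPairs (after k n) n′) ≤ g
    size≤ = lin (center k n + k (suc n) + center (after k n) n′) (z≤n {0})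
      (trans (+-identityʳ g) (trans (sym total) (trans (cong (size (intervalPairs k n) + center k n + k (suc n) +_) (interval-sum (after k n) n′))
        (lem (size (intervalPairs k n)) (center k n) (k (suc n)) (size (intervalPairs (after k n) n′)) (center (after k n) n′)))))
      where
      lem : ∀ s c q t e → s + c + q + (t + e) ≡ s + t + 0 + (c + q + e)
      lem = solve-∀
    in-codes : (intervalPairs k n , intervalPairs (after k n) n′) ∈ deepCodesAt g ps
    in-codes = subst (λ b → (intervalPairs k n , intervalPairs (after k n) n′) ∈ (if b then deepCodes g m n (k (suc n)) a else []))
      (sym (≤ᵇ-true 4≤q)) sub
      where
      sub : (intervalPairs k n , intervalPairs (after k n) n′) ∈ deepCodes g m n (k (suc n)) a
      sub with k (suc n) ≤ᵇ 5
      ... | true  = ∈-codePairs⁺ g (intervalPairs∈codes I₁) (intervalPairs∈codes I₂) size≤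
      ... | false = ∈-codePairs⁺ g (intervalPairs∈codes (unchained I₁)) (intervalPairs∈codes (unchained I₂)) size≤

  shallow : k (suc n) ≡ 3 → D ≤ n → ∃ λ c → c ∈ tailCodes g D × TailCoded g H c
  shallow q≡3 D≤n = inj₂ (n , a′ , center k n , intervalPairs k n , suf) ,
    ∈-++⁺ʳ (map inj₁ (allDeepCodes g)) (∈-map⁺ inj₂ (∈-concatMap-intro (λ i → shallowCodes g (D + i)) {x = n ∸ D}
      (∈-upTo⁺ (≤-trans (s≤s (m∸n≤m n D)) (≤-trans n<m m≤)))
      (subst (λ z → (n , a′ , center k n , intervalPairs k n , suf) ∈ shallowCodes g z) (sym (m+[n∸m]≡n D≤n)) in-codes))) ,
    shallowCoded m n a′ k kunz n<m q≡3 H≡ refl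
    where
    -- `suc a′` is the first position of a 1 among 1 ... n, or `suc n` if there is none. The
    -- interval ends at n, so nothing is lost, and the parameter stays in `upTo (suc n)`.
    a′ = a ⊓ n
    suf = applyUpTo (after k n ∘ suc) n′
    I : Interval 3 0 n (suc a′) k
    I = subst (λ q → Interval q 0 n (suc a′) k) q≡3 (first-interval kunz n<m max aft a′
      (λ i 1≤i i≤n i<a → large i 1≤i (≤-trans i≤n (<⇒≤ n<m)) (≤-trans i<a (s≤s (m⊓n≤m a n))))
      (λ a′<n → subst (λ z → k (suc z) ≤ 1) (sym (a′≡ a′<n)) (one (≤-trans (≤-trans (≤-reflexive (cong suc (sym (a′≡ a′<n)))) a′<n) (<⇒≤ n<m)))))
      where
      a′≡ : a′ < n → a′ ≡ a
      a′≡ lt with a ≤? n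
      ... | yes le = m≤n⇒m⊓n≡m le
      ... | no nle = contradiction (subst (_< n) (m≥n⇒m⊓n≡n (<⇒≤ (≰⇒> nle))) lt) (<⇒≱ ≤-refl)
    suf-sum : sum suf ≡ sumTo n′ (after k n ∘ suc)
    suf-sum = trans (cong sum (sym (map-upTo (after k n ∘ suc) n′))) (sumOn-upTo (after k n ∘ suc) n′)
    total′ : size (intervalPairs k n) + (center k n + 3) + sum suf ≡ g
    total′ = trans (cong₂ _+_ (sym (+-assoc (size (intervalPairs k n)) (center k n) 3)) suf-sum)
      (trans (cong (λ z → size (intervalPairs k n) + center k n + z + sumTo n′ (after k n ∘ suc)) (sym q≡3)) total)
    suf∈ : suf ∈ tilings (g ∸ (size (intervalPairs k n) + (center k n + 3)))
    suf∈ = subst (λ z → suf ∈ tilings z) (sym (trans (cong (_∸ s) (sym total′)) (m+n∸m≡n s (sum suf))))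
      (tilings-complete suf (AllP.applyUpTo⁺₁ (after k n ∘ suc) n′ (λ {i} i<n′ →
        k-pos′ kunz _ (s≤s z≤n) (in-range i i<n′) ,
        ≤-pred (≤-trans (aft _ (≤-trans (s≤s (m≤m+n (suc n) i)) (≤-reflexive (sym (+-suc (suc n) i)))) (in-range i i<n′)) (≤-reflexive q≡3)))))
      where
      s = size (intervalPairs k n) + (center k n + 3)
      in-range : ∀ i → i < n′ → suc n + suc i ≤ m
      in-range i i<n′ = ≤-trans (+-monoʳ-≤ (suc n) i<n′) (≤-reflexive (m+[n∸m]≡n n<m))
    size≤ : size (intervalPairs k n) ≤ g
    size≤ = ≤-trans (m≤m+n _ _) (≤-trans (m≤m+n _ (sum suf)) (≤-reflexive total′))
    c<4 : center k n < 4
    c<4 = s≤s (center≤′ k n 3 (Interval.upper I))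
    in-codes : (n , a′ , center k n , intervalPairs k n , suf) ∈ shallowCodes g n
    in-codes = ∈-concatMap-intro (λ a → concatMap (shallowCell g n a) (upTo 4)) (∈-upTo⁺ (s≤s (m⊓n≤n a n))) (∈-concatMap-intro (shallowCell g n a′) (∈-upTo⁺ c<4)
      (∈-map⁺ (λ x → n , a′ , center k n , x) (∈-concatMap-intro (λ l → map (l ,_) (tilings (g ∸ (size l + (center k n + 3))))) (∈-filterᵇ⁺ (λ l → size l ≤ᵇ g) (intervalPairs∈codes I) (≤ᵇ-true size≤))
        (∈-map⁺ (intervalPairs k n ,_) suf∈))))

  by-depth : ∀ q → k (suc n) ≡ q → Tame D m k ⊎ (∃ λ c → c ∈ tailCodes g D × TailCoded g H c)
  by-depth 3 q≡ with suc n ≤? D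
  ... | yes n<D = inj₁ (tame (≤-reflexive q≡) (λ i D<i i≤m → ≤-pred (≤-trans (aft i (≤-<-trans n<D D<i) i≤m) (≤-reflexive q≡))))
  ... | no n≮D  = inj₂ (shallow q≡ (≤-pred (≰⇒> n≮D)))
  by-depth (suc (suc (suc (suc q)))) q≡ = inj₂ (deep (≤-trans (m≤m+n 4 q) (≤-reflexive (sym q≡))))
  by-depth 0 q≡ = inj₁ (tame (≤-trans (≤-reflexive q≡) z≤n) (λ i _ i≤m → ≤-trans (max i i≤m) (≤-trans (≤-reflexive q≡) z≤n)))
  by-depth 1 q≡ = inj₁ (tame (≤-trans (≤-reflexive q≡) (≤ᵇ⇒≤ 1 3 tt)) (λ i _ i≤m → ≤-trans (max i i≤m) (≤-trans (≤-reflexive q≡) (≤ᵇ⇒≤ 1 2 tt))))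
  by-depth 2 q≡ = inj₁ (tame (≤-trans (≤-reflexive q≡) (≤ᵇ⇒≤ 2 3 tt)) (λ i _ i≤m → ≤-trans (max i i≤m) (≤-reflexive q≡)))

tailCoded-injective : ∀ {g H H′ c} → TailCoded g H c → TailCoded g H′ c → H ≡ H′
tailCoded-injective {c = inj₁ c} = deepCoded-injective
tailCoded-injective {c = inj₂ c} = shallowCoded-injective

allDeepCodes-small : ∀ e g → e * ((2 * g + 2) ^ 6 * (50 ^ g * 20 ^ 4)) ≤ 17 ^ 4 * (31 ^ g * Z g) → e * length (allDeepCodes g) ≤ Z g
allDeepCodes-small e g = go (length (allDeepCodes g)) (17 ^ 4) {{_}} (20 ^ 4) (allDeepCodes-bound g)
  where
  open ≤-Reasoning
  go : ∀ L A .{{_ : NonZero A}} B → L * (31 ^ g * A) ≤ (2 * g + 2) ^ 6 * (50 ^ g * B) →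
    e * ((2 * g + 2) ^ 6 * (50 ^ g * B)) ≤ A * (31 ^ g * Z g) → e * L ≤ Z g
  go L A B le small = *-cancelʳ-≤ (e * L) (Z g) (31 ^ g * A) {{m*n≢0 (31 ^ g) A {{m^n≢0 31 g}}}} (begin
    e * L * (31 ^ g * A) ≡⟨ *-assoc e L (31 ^ g * A) ⟩
    e * (L * (31 ^ g * A)) ≤⟨ *-monoʳ-≤ e le ⟩
    e * ((2 * g + 2) ^ 6 * (50 ^ g * B)) ≤⟨ small ⟩
    A * (31 ^ g * Z g) ≡⟨ lem A (31 ^ g) (Z g) ⟩
    Z g * (31 ^ g * A) ∎)
    where
    lem : ∀ a b z → a * (b * z) ≡ z * (b * a)
    lem = solve-∀

tailCodes-length : ∀ g D → length (tailCodes g D) ≡ length (allDeepCodes g) + sumTo (2 * g) (λ i → length (shallowCodes g (D + i)))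
tailCodes-length g D = trans (length-++ (map inj₁ (allDeepCodes g))) (cong₂ _+_ (length-map inj₁ (allDeepCodes g))
  (trans (length-map inj₂ (concatMap (λ i → shallowCodes g (D + i)) (upTo (2 * g)))) (trans (length-concatMap (λ i → shallowCodes g (D + i)) (upTo (2 * g)))
    (sumOn-upTo (λ i → length (shallowCodes g (D + i))) (2 * g)))))

-- The deep and the shallow codes get half of 1/e each. That D depends on e alone matters: the
-- prefixes stay fixed while g grows, and so do the error constants of their classes.
tailCodes-small : ∀ e → ∃ λ D → ∃ λ G → ∀ g → G ≤ g → e * length (tailCodes g D) ≤ Z g
tailCodes-small e = geometricCut 1301 24719 (2 * e) , proj₁ deep , λ g G≤g →
  combine g (geometricCut 1301 24719 (2 * e)) (allDeepCodes-small (2 * e) g (proj₂ deep g G≤g))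
    (geometric-tail-small 1301 24719 (2 * e) (Z g) (λ n → length (shallowCodes g n)) (shallowCodes-bound g) (2 * g))
  where
  open ≤-Reasoning
  deep = deep-tail-small (2 * e)
  lem : ∀ e a b → 2 * (e * (a + b)) ≡ 2 * e * a + 2 * e * b
  lem = solve-∀
  combine : ∀ g D → 2 * e * length (allDeepCodes g) ≤ Z g → 2 * e * sumTo (2 * g) (λ i → length (shallowCodes g (D + i))) ≤ Z g →
    e * length (tailCodes g D) ≤ Z g
  combine g D le₁ le₂ = *-cancelˡ-≤ 2 (begin
    2 * (e * length (tailCodes g D)) ≡⟨ cong (λ z → 2 * (e * z)) (tailCodes-length g D) ⟩
    2 * (e * (length (allDeepCodes g) + sumTo (2 * g) (λ i → length (shallowCodes g (D + i)))))
      ≡⟨ lem e (length (allDeepCodes g)) (sumTo (2 * g) (λ i → length (shallowCodes g (D + i)))) ⟩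
    2 * e * length (allDeepCodes g) + 2 * e * sumTo (2 * g) (λ i → length (shallowCodes g (D + i))) ≤⟨ le₁ ⊕ le₂ ⟩
    Z g + Z g ≡⟨ cong (Z g +_) (sym (+-identityʳ (Z g))) ⟩
    2 * Z g ∎)

-- Moments of the inversion number of a tiling

twos : List ℕ → ℕ
twos []      = 0
twos (2 ∷ u) = suc (twos u)
twos (_ ∷ u) = twos u

-- The number of pairs i < j with u i = 1 and u j = 2; up to lower order terms it is the weight.
inv : List ℕ → ℕ
inv []      = 0
inv (2 ∷ u) = inv u
inv (_ ∷ u) = inv u + twos u

sumOn-tilings : ∀ f n → sumOn f (tilings (2 + n)) ≡ sumOn (f ∘ (1 ∷_)) (tilings (1 + n)) + sumOn (f ∘ (2 ∷_)) (tilings n)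
sumOn-tilings f n = trans (sumOn-++ f (map (1 ∷_) (tilings (1 + n))) (map (2 ∷_) (tilings n)))
  (cong₂ _+_ (sumOn-map f (1 ∷_) (tilings (1 + n))) (sumOn-map f (2 ∷_) (tilings n)))

count₁ : ℕ → ℕ
count₁ n = sumOn (λ _ → 1) (tilings n)

J₁ J₂ I₁ IJ I₂ : ℕ → ℕ
J₁ n = sumOn twos (tilings n)
J₂ n = sumOn (λ u → twos u * twos u) (tilings n)
I₁ n = sumOn inv (tilings n)
IJ n = sumOn (λ u → inv u * twos u) (tilings n)
I₂ n = sumOn (λ u → inv u * inv u) (tilings n)

count₁≡Z : ∀ n → count₁ n ≡ Z n
count₁≡Z n = trans (sym (length≡sumOn (tilings n))) (length-tilings n)

J₁-rec : ∀ n → J₁ (2 + n) ≡ J₁ (1 + n) + (Z n + J₁ n)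
J₁-rec n = trans (sumOn-tilings twos n) (cong (J₁ (1 + n) +_)
  (trans (sumOn-+ (λ _ → 1) twos (tilings n)) (cong (_+ J₁ n) (count₁≡Z n))))

J₂-rec : ∀ n → J₂ (2 + n) ≡ J₂ (1 + n) + (Z n + 2 * J₁ n + J₂ n)
J₂-rec n = trans (sumOn-tilings (λ u → twos u * twos u) n) (cong (J₂ (1 + n) +_)
  (trans (sumOn-cong (tilings n) (λ u _ → lem (twos u)))
  (trans (sumOn-+ (λ u → 1 + 2 * twos u) (λ u → twos u * twos u) (tilings n))
  (cong (_+ J₂ n) (trans (sumOn-+ (λ _ → 1) (λ u → 2 * twos u) (tilings n)) (cong₂ _+_ (count₁≡Z n) (sumOn-*ˡ 2 twos (tilings n))))))))
  where
  lem : ∀ j → suc j * suc j ≡ 1 + 2 * j + j * j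
  lem = solve-∀

I₁-rec : ∀ n → I₁ (2 + n) ≡ I₁ (1 + n) + J₁ (1 + n) + I₁ n
I₁-rec n = trans (sumOn-tilings inv n) (cong (_+ I₁ n) (sumOn-+ inv twos (tilings (1 + n))))

IJ-rec : ∀ n → IJ (2 + n) ≡ IJ (1 + n) + J₂ (1 + n) + (I₁ n + IJ n)
IJ-rec n = trans (sumOn-tilings (λ u → inv u * twos u) n) (cong₂ _+_
  (trans (sumOn-cong (tilings (1 + n)) (λ u _ → *-distribʳ-+ (twos u) (inv u) (twos u)))
    (sumOn-+ (λ u → inv u * twos u) (λ u → twos u * twos u) (tilings (1 + n))))
  (trans (sumOn-cong (tilings n) (λ u _ → *-suc (inv u) (twos u))) (sumOn-+ inv (λ u → inv u * twos u) (tilings n))))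

I₂-rec : ∀ n → I₂ (2 + n) ≡ I₂ (1 + n) + 2 * IJ (1 + n) + J₂ (1 + n) + I₂ n
I₂-rec n = trans (sumOn-tilings (λ u → inv u * inv u) n) (cong (_+ I₂ n)
  (trans (sumOn-cong (tilings (1 + n)) (λ u _ → lem (inv u) (twos u)))
  (trans (sumOn-+ (λ u → inv u * inv u + 2 * (inv u * twos u)) (λ u → twos u * twos u) (tilings (1 + n)))
  (cong (_+ J₂ (1 + n)) (trans (sumOn-+ (λ u → inv u * inv u) (λ u → 2 * (inv u * twos u)) (tilings (1 + n)))
    (cong (I₂ (1 + n) +_) (sumOn-*ˡ 2 (λ u → inv u * twos u) (tilings (1 + n)))))))))
  where
  lem : ∀ i j → (i + j) * (i + j) ≡ i * i + 2 * (i * j) + j * j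
  lem = solve-∀

-- Closed forms in n, Z n and Z (n + 1), each with the negative terms moved to the left.
record Moments (n a b : ℕ) : Set where
  field
    j₁ : 5 * J₁ n + (1 + n) * b ≡ (1 + 3 * n) * a
    j₂ : 25 * J₂ n + (a + (4 * n + 5 * (n * n)) * b) ≡ (7 * n + 10 * (n * n)) * a + b
    i₁ : 50 * I₁ n + ((9 * n + 5 * (n * n)) * a + 2 * b) ≡ 2 * a + (3 * n + 5 * (n * n)) * b
    ij : 50 * IJ n + ((5 * (n * n) + 4 * (n * n * n)) * a + (2 + 3 * n) * b) ≡ (2 + 7 * n) * a + (2 * (n * n) + 3 * (n * n * n)) * b
    i₂ : 1500 * I₂ n + ((118 * n + 240 * (n * n) + 20 * (n * n * n)) * a + (84 + 15 * (n * n * n * n)) * b)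
       ≡ (84 + 30 * (n * n * n * n)) * a + (56 * n + 165 * (n * n) + 10 * (n * n * n)) * b

-- `N` holds the negative terms of the new closed form and `S` those of the closed forms it is built
-- from; adding `S` to both sides avoids subtraction.
cancel-middle : ∀ c S {X X′ N P Q} → X ≡ X′ → c * X′ + S ≡ Q → Q + N ≡ P + S → c * X + N ≡ P
cancel-middle c S {X} {X′} {N} {P} {Q} e₀ e₁ e₂ = +-cancelʳ-≡ S (c * X + N) P
  (trans (cong (λ x → c * x + N + S) e₀) (trans (lem (c * X′) N S) (trans (cong (_+ N) e₁) e₂)))
  where
  lem : ∀ a b c → a + b + c ≡ a + c + b
  lem = solve-∀

-- The identities `r` regroup each recurrence until the left sides of earlier closed forms appear.
-- What then remains are the identities `s` between polynomials in n, a and b.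
moments-step : ∀ n {a b} → Z n ≡ a → Z (1 + n) ≡ b → Moments n a b → Moments (1 + n) b (b + a) → Moments (2 + n) (b + a) (b + a + b)
moments-step n {a} {b} Za Zb M M′ = record
  { j₁ = cancel-middle 5 (N′j₁ + Nj₁) (trans (J₁-rec n) (cong (λ z → J₁ (1 + n) + (z + J₁ n)) Za))
           (trans (r₁ (J₁ (1 + n)) (J₁ n) a N′j₁ Nj₁) (cong₂ (λ x y → x + (5 * a + y)) M′.j₁ M.j₁)) (s₁ n a b)
  ; j₂ = cancel-middle 25 (N′j₂ + 10 * Nj₁ + Nj₂) (trans (J₂-rec n) (cong (λ z → J₂ (1 + n) + (z + 2 * J₁ n + J₂ n)) Za))
           (trans (r₂ (J₂ (1 + n)) (J₁ n) (J₂ n) a N′j₂ Nj₁ Nj₂) (cong₂ _+_ (cong₂ (λ x y → x + (25 * a + 10 * y)) M′.j₂ M.j₁) M.j₂)) (s₂ n a b)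
  ; i₁ = cancel-middle 50 (N′i₁ + 10 * N′j₁ + Ni₁) (I₁-rec n)
           (trans (r₃ (I₁ (1 + n)) (J₁ (1 + n)) (I₁ n) N′i₁ N′j₁ Ni₁) (cong₂ _+_ (cong₂ (λ x y → x + 10 * y) M′.i₁ M′.j₁) M.i₁)) (s₃ n a b)
  ; ij = cancel-middle 50 (N′ij + 2 * N′j₂ + (Ni₁ + Nij)) (IJ-rec n)
           (trans (r₄ (IJ (1 + n)) (J₂ (1 + n)) (I₁ n) (IJ n) N′ij N′j₂ Ni₁ Nij) (cong₂ _+_ (cong₂ (λ x y → x + 2 * y) M′.ij M′.j₂) (cong₂ _+_ M.i₁ M.ij))) (s₄ n a b)
  ; i₂ = cancel-middle 1500 (N′i₂ + 60 * N′ij + 60 * N′j₂ + Ni₂) (I₂-rec n)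
           (trans (r₅ (I₂ (1 + n)) (IJ (1 + n)) (J₂ (1 + n)) (I₂ n) N′i₂ N′ij N′j₂ Ni₂ 1500 60 50 25 2 refl refl)
             (cong₂ _+_ (cong₂ _+_ (cong₂ (λ x y → x + 60 * y) M′.i₂ M′.ij) (cong (60 *_) M′.j₂)) M.i₂)) (s₅ n a b)
  }
  where
  module M = Moments M
  module M′ = Moments M′
  n′ = 1 + n
  b′ = b + a
  Nj₁ = (1 + n) * b
  N′j₁ = (1 + n′) * b′
  Nj₂ = a + (4 * n + 5 * (n * n)) * b
  N′j₂ = b + (4 * n′ + 5 * (n′ * n′)) * b′
  Ni₁ = (9 * n + 5 * (n * n)) * a + 2 * b
  N′i₁ = (9 * n′ + 5 * (n′ * n′)) * b + 2 * b′
  Nij = (5 * (n * n) + 4 * (n * n * n)) * a + (2 + 3 * n) * b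
  N′ij = (5 * (n′ * n′) + 4 * (n′ * n′ * n′)) * b + (2 + 3 * n′) * b′
  Ni₂ = (118 * n + 240 * (n * n) + 20 * (n * n * n)) * a + (84 + 15 * (n * n * n * n)) * b
  N′i₂ = (118 * n′ + 240 * (n′ * n′) + 20 * (n′ * n′ * n′)) * b + (84 + 15 * (n′ * n′ * n′ * n′)) * b′
  r₁ : ∀ x y a p q → 5 * (x + (a + y)) + (p + q) ≡ 5 * x + p + (5 * a + (5 * y + q))
  r₁ = solve-∀
  r₂ : ∀ x y z a p q r → 25 * (x + (a + 2 * y + z)) + (p + 10 * q + r) ≡ 25 * x + p + (25 * a + 10 * (5 * y + q)) + (25 * z + r)
  r₂ = solve-∀
  r₃ : ∀ x y z p q r → 50 * (x + y + z) + (p + 10 * q + r) ≡ 50 * x + p + 10 * (5 * y + q) + (50 * z + r)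
  r₃ = solve-∀
  r₄ : ∀ x y z w p q r s → 50 * (x + y + (z + w)) + (p + 2 * q + (r + s)) ≡ 50 * x + p + 2 * (25 * y + q) + (50 * z + r + (50 * w + s))
  r₄ = solve-∀
  r₅ : ∀ x y z w p q r s k c d e t → k * t ≡ c * d → k ≡ c * e →
    k * (x + t * y + z + w) + (p + c * q + c * r + s) ≡ k * x + p + c * (d * y + q) + c * (e * z + r) + (k * w + s)
  r₅ x y z w p q r s k c d e t kt ke = trans (u₁ x y z w p q r s k c t) (trans (cong₂ (λ f h → k * x + p + (f * y + c * q) + (h * z + c * r) + (k * w + s)) kt ke)
    (u₂ (k * x + p) (k * w + s) y z q r c d e))
    where
    u₁ : ∀ x y z w p q r s k c t → k * (x + t * y + z + w) + (p + c * q + c * r + s) ≡ k * x + p + (k * t * y + c * q) + (k * z + c * r) + (k * w + s)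
    u₁ = solve-∀
    u₂ : ∀ h l y z q r c d e → h + (c * d * y + c * q) + (c * e * z + c * r) + l ≡ h + c * (d * y + q) + c * (e * z + r) + l
    u₂ = solve-∀
  s₁ : ∀ n a b → (1 + 3 * (1 + n)) * b + (5 * a + (1 + 3 * n) * a) + (1 + (2 + n)) * (b + a + b)
     ≡ (1 + 3 * (2 + n)) * (b + a) + ((1 + (1 + n)) * (b + a) + (1 + n) * b)
  s₁ = solve-∀
  s₂ : ∀ n a b → (7 * (1 + n) + 10 * ((1 + n) * (1 + n))) * b + (b + a) + (25 * a + 10 * ((1 + 3 * n) * a)) + ((7 * n + 10 * (n * n)) * a + b)
       + ((b + a) + (4 * (2 + n) + 5 * ((2 + n) * (2 + n))) * (b + a + b))
     ≡ (7 * (2 + n) + 10 * ((2 + n) * (2 + n))) * (b + a) + (b + a + b)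
       + (b + (4 * (1 + n) + 5 * ((1 + n) * (1 + n))) * (b + a) + 10 * ((1 + n) * b) + (a + (4 * n + 5 * (n * n)) * b))
  s₂ = solve-∀
  s₃ : ∀ n a b → 2 * b + (3 * (1 + n) + 5 * ((1 + n) * (1 + n))) * (b + a) + 10 * ((1 + 3 * (1 + n)) * b) + (2 * a + (3 * n + 5 * (n * n)) * b)
       + ((9 * (2 + n) + 5 * ((2 + n) * (2 + n))) * (b + a) + 2 * (b + a + b))
     ≡ 2 * (b + a) + (3 * (2 + n) + 5 * ((2 + n) * (2 + n))) * (b + a + b)
       + ((9 * (1 + n) + 5 * ((1 + n) * (1 + n))) * b + 2 * (b + a) + 10 * ((1 + (1 + n)) * (b + a)) + ((9 * n + 5 * (n * n)) * a + 2 * b))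
  s₃ = solve-∀
  s₄ : ∀ n a b → (2 + 7 * (1 + n)) * b + (2 * ((1 + n) * (1 + n)) + 3 * ((1 + n) * (1 + n) * (1 + n))) * (b + a)
       + 2 * ((7 * (1 + n) + 10 * ((1 + n) * (1 + n))) * b + (b + a))
       + (2 * a + (3 * n + 5 * (n * n)) * b + ((2 + 7 * n) * a + (2 * (n * n) + 3 * (n * n * n)) * b))
       + ((5 * ((2 + n) * (2 + n)) + 4 * ((2 + n) * (2 + n) * (2 + n))) * (b + a) + (2 + 3 * (2 + n)) * (b + a + b))
     ≡ (2 + 7 * (2 + n)) * (b + a) + (2 * ((2 + n) * (2 + n)) + 3 * ((2 + n) * (2 + n) * (2 + n))) * (b + a + b)
       + ((5 * ((1 + n) * (1 + n)) + 4 * ((1 + n) * (1 + n) * (1 + n))) * b + (2 + 3 * (1 + n)) * (b + a)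
          + 2 * (b + (4 * (1 + n) + 5 * ((1 + n) * (1 + n))) * (b + a))
          + ((9 * n + 5 * (n * n)) * a + 2 * b + ((5 * (n * n) + 4 * (n * n * n)) * a + (2 + 3 * n) * b)))
  s₄ = solve-∀
  s₅ : ∀ n a b → (84 + 30 * ((1 + n) * (1 + n) * (1 + n) * (1 + n))) * b + (56 * (1 + n) + 165 * ((1 + n) * (1 + n)) + 10 * ((1 + n) * (1 + n) * (1 + n))) * (b + a)
       + 60 * ((2 + 7 * (1 + n)) * b + (2 * ((1 + n) * (1 + n)) + 3 * ((1 + n) * (1 + n) * (1 + n))) * (b + a))
       + 60 * ((7 * (1 + n) + 10 * ((1 + n) * (1 + n))) * b + (b + a))
       + ((84 + 30 * (n * n * n * n)) * a + (56 * n + 165 * (n * n) + 10 * (n * n * n)) * b)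
       + ((118 * (2 + n) + 240 * ((2 + n) * (2 + n)) + 20 * ((2 + n) * (2 + n) * (2 + n))) * (b + a) + (84 + 15 * ((2 + n) * (2 + n) * (2 + n) * (2 + n))) * (b + a + b))
     ≡ (84 + 30 * ((2 + n) * (2 + n) * (2 + n) * (2 + n))) * (b + a) + (56 * (2 + n) + 165 * ((2 + n) * (2 + n)) + 10 * ((2 + n) * (2 + n) * (2 + n))) * (b + a + b)
       + ((118 * (1 + n) + 240 * ((1 + n) * (1 + n)) + 20 * ((1 + n) * (1 + n) * (1 + n))) * b + (84 + 15 * ((1 + n) * (1 + n) * (1 + n) * (1 + n))) * (b + a)
          + 60 * ((5 * ((1 + n) * (1 + n)) + 4 * ((1 + n) * (1 + n) * (1 + n))) * b + (2 + 3 * (1 + n)) * (b + a))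
          + 60 * (b + (4 * (1 + n) + 5 * ((1 + n) * (1 + n))) * (b + a))
          + ((118 * n + 240 * (n * n) + 20 * (n * n * n)) * a + (84 + 15 * (n * n * n * n)) * b))
  s₅ = solve-∀

moments : ∀ n → Moments n (Z n) (Z (1 + n)) × Moments (1 + n) (Z (1 + n)) (Z (2 + n))
moments zero    = record { j₁ = refl ; j₂ = refl ; i₁ = refl ; ij = refl ; i₂ = refl }
                , record { j₁ = refl ; j₂ = refl ; i₁ = refl ; ij = refl ; i₂ = refl }
moments (suc n) with moments n
... | M , M′ = M′ , moments-step n refl refl M M′

module _ (n : ℕ) where

  private
    N = 2 + n
    a = Z N
    b = Z (1 + N)
    c = N * N * N
    X = 1500 * I₂ N

    b≤2a : b ≤ 2 * a
    b≤2a = lin 0 (Z-suc (1 + n)) (lem a (Z (1 + n)))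
      where
      lem : ∀ a y → 2 * a + y ≡ a + y + a + 0
      lem = solve-∀

    -- Since 2 a - b = Z N - Z (N - 1) = Z n for N = n + 2, the quartic terms 30 N⁴ a and -15 N⁴ b
    -- merge into 15 N⁴ Z n. This is the source of the factor 1/φ² in the limit.
    centered : X + ((118 * N + 240 * (N * N) + 20 * c) * a + 84 * b) ≡ 84 * a + 15 * (N * c * Z n) + (56 * N + 165 * (N * N) + 10 * c) * b
    centered = +-cancelʳ-≡ (15 * (N * c) * b) _ _ (begin
      X + ((118 * N + 240 * (N * N) + 20 * c) * a + 84 * b) + 15 * (N * c) * b
        ≡⟨ lem₁ X (118 * N + 240 * (N * N) + 20 * c) a 84 b N ⟩
      X + ((118 * N + 240 * (N * N) + 20 * c) * a + (84 + 15 * (N * N * N * N)) * b)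
        ≡⟨ Moments.i₂ (proj₁ (moments N)) ⟩
      (84 + 30 * (N * N * N * N)) * a + (56 * N + 165 * (N * N) + 10 * c) * b
        ≡⟨ lem₂ N (Z (1 + n)) (Z n) (56 * N + 165 * (N * N) + 10 * c) 84 ⟩
      84 * a + 15 * (N * c * Z n) + (56 * N + 165 * (N * N) + 10 * c) * b + 15 * (N * c) * b ∎)
      where
      open ≡-Reasoning
      lem₁ : ∀ x p a q b N → x + (p * a + q * b) + 15 * (N * (N * N * N)) * b ≡ x + (p * a + (q + 15 * (N * N * N * N)) * b)
      lem₁ = solve-∀
      lem₂ : ∀ N y z p q → (q + 30 * (N * N * N * N)) * (y + z) + p * (y + z + y)
        ≡ q * (y + z) + 15 * (N * (N * N * N) * z) + p * (y + z + y) + 15 * (N * (N * N * N)) * (y + z + y)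
      lem₂ = solve-∀

    N≤c : N ≤ c
    N≤c = ≤-trans (m≤m*n N N) (m≤m*n (N * N) N)

    N²≤c : N * N ≤ c
    N²≤c = m≤m*n (N * N) N

    1≤c : 1 ≤ c
    1≤c = ≤-trans (s≤s z≤n) N≤c

    84b≤ : ∀ k → k * b ≤ k * (c * (2 * a))
    84b≤ k = *-monoʳ-≤ k (≤-trans (≤-reflexive (sym (*-identityˡ b))) (*-mono-≤ 1≤c b≤2a))

  -- With b ≤ 2 a the lower order coefficients add up to 84 + 2 (56 + 165 + 10) = 546 ≤ 15 · 37. For
  -- the lower bound they are 118 + 240 + 20 + 2 · 84, again 546.
  second-moment-upper : 100 * I₂ N ≤ N * c * Z n + 37 * (c * a)
  second-moment-upper = *-cancelˡ-≤ 15 (begin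
    15 * (100 * I₂ N) ≡⟨ *-assoc 15 100 (I₂ N) ⟨
    X ≤⟨ m≤m+n X _ ⟩
    X + ((118 * N + 240 * (N * N) + 20 * c) * a + 84 * b) ≡⟨ centered ⟩
    84 * a + 15 * (N * c * Z n) + (56 * N + 165 * (N * N) + 10 * c) * b
      ≤⟨ +-monoˡ-≤ (15 * (N * c * Z n)) (*-monoʳ-≤ 84 (≤-trans (≤-reflexive (sym (*-identityˡ a))) (*-monoˡ-≤ a 1≤c)))
         ⊕ *-mono-≤ {56 * N + 165 * (N * N) + 10 * c} {56 * c + 165 * c + 10 * c} (+-monoˡ-≤ (10 * c) (*-monoʳ-≤ 56 N≤c ⊕ *-monoʳ-≤ 165 N²≤c)) b≤2a ⟩
    84 * (c * a) + 15 * (N * c * Z n) + (56 * c + 165 * c + 10 * c) * (2 * a) ≤⟨ lin (9 * (c * a)) (z≤n {0}) (lem c a (N * c * Z n)) ⟩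
    15 * (N * c * Z n + 37 * (c * a)) ∎)
    where
    open ≤-Reasoning
    lem : ∀ c a z → 15 * (z + 37 * (c * a)) + 0 ≡ 84 * (c * a) + 15 * z + (56 * c + 165 * c + 10 * c) * (2 * a) + 0 + 9 * (c * a)
    lem = solve-∀

  second-moment-lower : N * c * Z n ≤ 100 * I₂ N + 37 * (c * a)
  second-moment-lower = *-cancelˡ-≤ 15 (begin
    15 * (N * c * Z n) ≤⟨ m≤n+m _ (84 * a) ⟩
    84 * a + 15 * (N * c * Z n) ≤⟨ m≤m+n _ _ ⟩
    84 * a + 15 * (N * c * Z n) + (56 * N + 165 * (N * N) + 10 * c) * b ≡⟨ centered ⟨
    X + ((118 * N + 240 * (N * N) + 20 * c) * a + 84 * b)
      ≤⟨ +-monoʳ-≤ X (*-monoˡ-≤ a (+-monoˡ-≤ (20 * c) (*-monoʳ-≤ 118 N≤c ⊕ *-monoʳ-≤ 240 N²≤c)) ⊕ 84b≤ 84) ⟩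
    X + ((118 * c + 240 * c + 20 * c) * a + 84 * (c * (2 * a))) ≤⟨ lin (9 * (c * a)) (z≤n {0}) (trans (cong (_+ 0) (trans (*-distribˡ-+ 15 (100 * I₂ N) (37 * (c * a))) (cong (_+ 15 * (37 * (c * a))) (sym (*-assoc 15 100 (I₂ N)))))) (lem c a X)) ⟩
    15 * (100 * I₂ N + 37 * (c * a)) ∎)
    where
    open ≤-Reasoning
    lem : ∀ c a x → x + 15 * (37 * (c * a)) + 0 ≡ x + ((118 * c + 240 * c + 20 * c) * a + 84 * (c * (2 * a))) + 0 + 9 * (c * a)
    lem = solve-∀

-- The weight of a word of coordinates

nth : List ℕ → ℕ → ℕ
nth []       _       = 0
nth (x ∷ xs) zero    = x
nth (x ∷ xs) (suc i) = nth xs i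

-- Words list the coordinates from index 1 on; coordinate 0 is 0.
wordK : List ℕ → ℕ → ℕ
wordK ks = nth (0 ∷ ks)

wordGaps : ℕ → List ℕ → List ℕ
wordGaps g ks = gapList g (length ks) (wordK ks)

sumTo-nth : ∀ ks → sumTo (length ks) (nth ks) ≡ sum ks
sumTo-nth []       = refl
sumTo-nth (c ∷ ks) = trans (sumTo-front (length ks) (nth (c ∷ ks))) (cong (c +_) (sumTo-nth ks))

wordK-sum : ∀ ks → sumTo (suc (length ks)) (wordK ks) ≡ sum ks
wordK-sum ks = sumTo-nth (0 ∷ ks)

triangle : ℕ → ℕ
triangle c = sumTo c id

triangle-+ : ∀ a b → triangle (a + b) ≡ triangle a + triangle b + a * b
triangle-+ a zero    = trans (cong triangle (+-identityʳ a)) (trans (sym (+-identityʳ _)) (cong₂ _+_ (sym (+-identityʳ (triangle a))) (sym (*-zeroʳ a))))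
triangle-+ a (suc b) = trans (cong triangle (+-suc a b)) (trans (cong (_+ (a + b)) (triangle-+ a b)) (lem (triangle a) (triangle b) a b))
  where
  lem : ∀ x y a b → x + y + a * b + (a + b) ≡ x + (y + b) + a * suc b
  lem = solve-∀

2*triangle : ∀ g → triangle (suc g) * 2 ≡ g * suc g
2*triangle zero    = refl
2*triangle (suc g) = trans (*-distribʳ-+ 2 (triangle (suc g)) (suc g)) (trans (cong (_+ suc g * 2) (2*triangle g)) (lem g))
  where
  lem : ∀ g → g * suc g + suc g * 2 ≡ suc g * suc (suc g)
  lem = solve-∀

-- A coordinate c at position o contributes the gaps o, o + M, ..., o + (c - 1) M.
gapSum : ℕ → ℕ → List ℕ → ℕ
gapSum M o []       = 0
gapSum M o (c ∷ ks) = c * o + triangle c * M + gapSum M (suc o) ks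

triangles : List ℕ → ℕ
triangles = sumOn triangle

gapSum-shift : ∀ M o ks → gapSum M (suc o) ks ≡ gapSum M o ks + sum ks
gapSum-shift M o []       = refl
gapSum-shift M o (c ∷ ks) = trans (cong (c * suc o + triangle c * M +_) (gapSum-shift M (suc o) ks)) (lem c o (triangle c * M) (gapSum M (suc o) ks) (sum ks))
  where
  lem : ∀ c o t f s → c * suc o + t + (f + s) ≡ c * o + t + f + (c + s)
  lem = solve-∀

gapSum-suc : ∀ M o ks → gapSum (suc M) o ks ≡ gapSum M o ks + triangles ks
gapSum-suc M o []       = refl
gapSum-suc M o (c ∷ ks) = trans (cong (c * o + triangle c * suc M +_) (gapSum-suc M (suc o) ks)) (lem (c * o) (triangle c) M (gapSum M (suc o) ks) (triangles ks))
  where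
  lem : ∀ c t M f s → c + t * suc M + (f + s) ≡ c + t * M + f + (t + s)
  lem = solve-∀

wordSum : List ℕ → ℕ
wordSum ks = gapSum (suc (length ks)) 1 ks

-- Prepending a coordinate moves the others up by one position, which adds 1 for each of their gaps,
-- and raises the multiplicity by one, which adds their triangular numbers.
wordSum-∷ : ∀ c ks → wordSum (c ∷ ks) ≡ wordSum ks + (c + triangle c * suc (suc (length ks)) + triangles ks + sum ks)
wordSum-∷ c ks = trans (cong (c * 1 + triangle c * suc (suc (length ks)) +_)
    (trans (gapSum-shift (suc (suc (length ks))) 1 ks) (cong (_+ sum ks) (gapSum-suc (suc (length ks)) 1 ks))))
  (lem c (triangle c * suc (suc (length ks))) (wordSum ks) (triangles ks) (sum ks))
  where
  lem : ∀ c t w s g → c * 1 + t + (w + s + g) ≡ w + (c + t + s + g)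
  lem = solve-∀

gapSum≡ : ∀ M o ks → sumTo (length ks) (λ i → sumTo (nth ks i) (λ j → o + i + j * M)) ≡ gapSum M o ks
gapSum≡ M o []       = refl
gapSum≡ M o (c ∷ ks) = trans (sumTo-front (length ks) _) (cong₂ _+_
  (trans (sumTo-+ c (λ _ → o + 0) (λ j → j * M)) (cong₂ _+_ (trans (sumTo-const c (o + 0)) (cong (c *_) (+-identityʳ o))) (sumTo-*ʳ c id M)))
  (trans (sumTo-cong (length ks) (λ i _ → sumTo-cong (nth ks i) (λ j _ → cong (_+ j * M) (+-suc o i)))) (gapSum≡ M (suc o) ks)))

wordSum≡ : ∀ ks → sumTo (suc (length ks)) (λ i → sumTo (wordK ks i) (λ j → i + j * suc (length ks))) ≡ wordSum ks
wordSum≡ ks = trans (sumTo-front (length ks) _) (gapSum≡ (suc (length ks)) 1 ks)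

weight-word : ∀ {g} ks → Kunz (length ks) (wordK ks) → sum ks ≡ g → weight (wordGaps g ks) ≡ wordSum ks ∸ triangle (suc g)
weight-word {g} ks K s = cong₂ _∸_ (trans (gapList-sum K total) (wordSum≡ ks))
  (trans (cong (λ z → (z * suc z) / 2) (gapList-length K total)) (trans (cong (_/ 2) (sym (2*triangle g))) (m*n/n≡m (triangle (suc g)) 2)))
  where
  total : sumTo (suc (length ks)) (wordK ks) ≡ g
  total = trans (wordK-sum ks) s

tiling-stats : ∀ u → All OneTwo u → triangles u ≡ twos u × sum u ≡ length u + twos u
tiling-stats [] _ = refl , refl
tiling-stats (1 ∷ u) (_ ∷ ot) with tiling-stats u ot
... | t , s = t , cong suc s
tiling-stats (2 ∷ u) (_ ∷ ot) with tiling-stats u ot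
... | t , s = cong suc t , trans (cong (2 +_) s) (cong suc (sym (+-suc (length u) (twos u))))
tiling-stats (suc (suc (suc c)) ∷ u) ((_ , s≤s (s≤s ())) ∷ ot)

-- A new 1 in front forms an inversion with every later 2, a new 2 with none. Without the triangular
-- number the weight of a tiling is thus exactly `inv u + twos u`, and the last term is at most the
-- genus.
tiling-wordSum : ∀ u → All OneTwo u → wordSum u ≡ triangle (suc (sum u)) + inv u + twos u
tiling-wordSum [] _ = refl
tiling-wordSum (1 ∷ u) (_ ∷ ot) with tiling-stats u ot
... | t , s = begin
  wordSum (1 ∷ u) ≡⟨ wordSum-∷ 1 u ⟩
  wordSum u + (1 + 0 + triangles u + sum u) ≡⟨ cong₂ (λ x y → x + (1 + 0 + y + sum u)) (tiling-wordSum u ot) t ⟩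
  triangle (suc (sum u)) + inv u + twos u + (1 + 0 + twos u + sum u) ≡⟨ lem (triangle (suc (sum u))) (inv u) (twos u) (sum u) ⟩
  triangle (suc (sum u)) + suc (sum u) + (inv u + twos u) + twos u ∎
  where
  open ≡-Reasoning
  lem : ∀ T i j s → T + i + j + (1 + 0 + j + s) ≡ T + suc s + (i + j) + j
  lem = solve-∀
tiling-wordSum (2 ∷ u) (_ ∷ ot) with tiling-stats u ot
... | t , s = begin
  wordSum (2 ∷ u) ≡⟨ wordSum-∷ 2 u ⟩
  wordSum u + (2 + 1 * suc (suc (length u)) + triangles u + sum u) ≡⟨ cong₂ (λ x y → x + (2 + 1 * suc (suc (length u)) + y + sum u)) (tiling-wordSum u ot) t ⟩
  T + inv u + twos u + (2 + 1 * suc (suc (length u)) + twos u + sum u)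
    ≡⟨ lem₁ T (inv u) (twos u) (length u) (sum u) ⟩
  T + (length u + twos u) + sum u + 3 + inv u + suc (twos u) ≡⟨ cong (λ z → T + z + sum u + 3 + inv u + suc (twos u)) s ⟨
  T + sum u + sum u + 3 + inv u + suc (twos u) ≡⟨ lem₂ T (sum u) (inv u) (twos u) ⟩
  T + suc (sum u) + suc (suc (sum u)) + inv u + suc (twos u) ∎
  where
  open ≡-Reasoning
  T = triangle (suc (sum u))
  lem₁ : ∀ T i j l s → T + i + j + (2 + 1 * suc (suc l) + j + s) ≡ T + (l + j) + s + 3 + i + suc j
  lem₁ = solve-∀
  lem₂ : ∀ T s i j → T + s + s + 3 + i + suc j ≡ T + suc s + suc (suc s) + i + suc j
  lem₂ = solve-∀
tiling-wordSum (suc (suc (suc c)) ∷ u) ((_ , s≤s (s≤s ())) ∷ ot)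

OneTwoThree : ℕ → Set
OneTwoThree c = 1 ≤ c × c ≤ 3

triangle≤3 : ∀ c → c ≤ 3 → triangle c ≤ c × triangle c ≤ 3
triangle≤3 0 _ = z≤n , z≤n
triangle≤3 1 _ = z≤n , z≤n
triangle≤3 2 _ = s≤s z≤n , s≤s z≤n
triangle≤3 3 _ = ≤-refl , ≤-refl
triangle≤3 (suc (suc (suc (suc c)))) (s≤s (s≤s (s≤s ())))

small-word : ∀ ks → All OneTwoThree ks → length ks ≤ sum ks × triangles ks ≤ sum ks
small-word [] _ = z≤n , z≤n
small-word (c ∷ ks) ((1≤c , c≤3) ∷ as) with small-word ks as
... | l , t = 1≤c ⊕ l , proj₁ (triangle≤3 c c≤3) ⊕ t

-- G bounds `twos u`, and each of the d prefix coordinates changes the comparison by at most 5 G +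
-- 6.
weightError : ℕ → ℕ → ℕ
weightError d G = d * (5 * G + 6) + G

-- The induction peels off the prefix, whose sum shrinks; the bound G stays fixed so that every
-- peeled coordinate has the same cost.
wordSum-inv : ∀ G p u → All OneTwoThree p → All OneTwo u → sum (p ++ u) ≤ G →
  (wordSum (p ++ u) ≤ triangle (suc (sum (p ++ u))) + inv u + weightError (length p) G) ×
  (triangle (suc (sum (p ++ u))) + inv u ≤ wordSum (p ++ u) + weightError (length p) G)
wordSum-inv G [] u _ ot s≤G = ≤-trans (≤-reflexive (tiling-wordSum u ot)) (+-monoʳ-≤ (triangle (suc (sum u)) + inv u) twos≤G)
  , ≤-trans (m≤m+n _ (twos u)) (≤-trans (≤-reflexive (sym (tiling-wordSum u ot))) (m≤m+n _ G))
  where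
  twos≤G : twos u ≤ G
  twos≤G = ≤-trans (≤-trans (m≤n+m (twos u) (length u)) (≤-reflexive (sym (proj₂ (tiling-stats u ot))))) s≤G
wordSum-inv G (c ∷ p) u ((1≤c , c≤3) ∷ as) ot s≤G with wordSum-inv G p u as ot (≤-trans (m≤n+m _ c) s≤G)
... | up , low = upper , lower
  where
  open ≤-Reasoning
  ks = p ++ u
  g = sum ks
  w = wordSum ks
  T = triangle (suc g)
  t = triangle c
  E = weightError (length p) G
  12⇒123 : ∀ {u} → All OneTwo u → All OneTwoThree u
  12⇒123 []              = []
  12⇒123 ((x , y) ∷ ot′) = (x , m≤n⇒m≤1+n y) ∷ 12⇒123 ot′
  small = small-word ks (AllP.++⁺ as (12⇒123 ot))
  g≤G : g ≤ G
  g≤G = ≤-trans (m≤n+m g c) s≤G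
  triangle-step : triangle (suc (c + g)) ≡ T + (c * g + t + c)
  triangle-step = trans (cong triangle (sym (+-suc c g))) (trans (triangle-+ c (suc g)) (lem t T c g))
    where
    lem : ∀ t T c g → t + T + c * suc g ≡ T + (c * g + t + c)
    lem = solve-∀
  upper : wordSum (c ∷ ks) ≤ triangle (suc (c + g)) + inv u + weightError (suc (length p)) G
  upper = begin
    wordSum (c ∷ ks) ≡⟨ wordSum-∷ c ks ⟩
    w + (c + t * suc (suc (length ks)) + triangles ks + g)
      ≤⟨ up ⊕ ((+-monoʳ-≤ c (*-mono-≤ (proj₂ (triangle≤3 c c≤3)) (s≤s (s≤s (≤-trans (proj₁ small) g≤G)))) ⊕ ≤-trans (proj₂ small) g≤G) ⊕ g≤G) ⟩
    T + inv u + E + (c + 3 * suc (suc G) + G + G) ≤⟨ lin (c * g + t) (z≤n {0}) (lem T (inv u) E c G (c * g) t) ⟩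
    T + (c * g + t + c) + inv u + (5 * G + 6 + E) ≡⟨ cong₂ (λ x y → x + inv u + y) (sym triangle-step) (sym (+-assoc (5 * G + 6) (length p * (5 * G + 6)) G)) ⟩
    triangle (suc (c + g)) + inv u + weightError (suc (length p)) G ∎
    where
    lem : ∀ T i E c G cg t → T + (cg + t + c) + i + (5 * G + 6 + E) + 0 ≡ T + i + E + (c + 3 * suc (suc G) + G + G) + 0 + (cg + t)
    lem = solve-∀
  lower : triangle (suc (c + g)) + inv u ≤ wordSum (c ∷ ks) + weightError (suc (length p)) G
  lower = begin
    triangle (suc (c + g)) + inv u ≡⟨ cong (_+ inv u) triangle-step ⟩
    T + (c * g + t + c) + inv u ≡⟨ lem₁ T (c * g) t c (inv u) ⟩
    T + inv u + (c * g + t + c) ≤⟨ low ⊕ ((*-mono-≤ c≤3 g≤G ⊕ proj₂ (triangle≤3 c c≤3)) ⊕ c≤3) ⟩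
    w + E + (3 * G + 3 + 3) ≤⟨ lin (2 * G) (m≤m+n w (c + t * suc (suc (length ks)) + triangles ks + g)) (lem₂ w E G _) ⟩
    w + (c + t * suc (suc (length ks)) + triangles ks + g) + (5 * G + 6 + E)
      ≡⟨ cong₂ _+_ (sym (wordSum-∷ c ks)) (sym (+-assoc (5 * G + 6) (length p * (5 * G + 6)) G)) ⟩
    wordSum (c ∷ ks) + weightError (suc (length p)) G ∎
    where
    lem₁ : ∀ T x t c i → T + (x + t + c) + i ≡ T + i + (x + t + c)
    lem₁ = solve-∀
    lem₂ : ∀ w E G y → y + (5 * G + 6 + E) + w ≡ w + E + (3 * G + 3 + 3) + y + 2 * G
    lem₂ = solve-∀

weight-inv : ∀ {g} p u → All OneTwoThree p → All OneTwo u → Kunz (length (p ++ u)) (wordK (p ++ u)) → sum (p ++ u) ≡ g →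
  (weight (wordGaps g (p ++ u)) ≤ inv u + weightError (length p) g) × (inv u ≤ weight (wordGaps g (p ++ u)) + weightError (length p) g)
weight-inv {g} p u as ot K refl with wordSum-inv g p u as ot ≤-refl
... | up , low = subst (λ w → w ≤ inv u + E) (sym w≡) (m≤n+o⇒m∸n≤o (wordSum ks) T (≤-trans up (≤-reflexive (+-assoc T (inv u) E))))
    , subst (λ w → inv u ≤ w + E) (sym w≡) (+-cancelˡ-≤ T (inv u) (wordSum ks ∸ T + E)
        (≤-trans low (≤-trans (+-monoˡ-≤ E (m≤n+m∸n (wordSum ks) T)) (≤-reflexive (+-assoc T (wordSum ks ∸ T) E)))))
  where
  ks = p ++ u
  T = triangle (suc g)
  E = weightError (length p) g
  w≡ : weight (wordGaps g ks) ≡ wordSum ks ∸ T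
  w≡ = weight-word ks K refl

-- Words with a short prefix

nth-++ˡ : ∀ xs ys {i} → i < length xs → nth (xs ++ ys) i ≡ nth xs i
nth-++ˡ (x ∷ xs) ys {zero}  _       = refl
nth-++ˡ (x ∷ xs) ys {suc i} (s≤s p) = nth-++ˡ xs ys p

nth-++ʳ : ∀ xs ys i → nth (xs ++ ys) (length xs + i) ≡ nth ys i
nth-++ʳ []       ys i = refl
nth-++ʳ (x ∷ xs) ys i = nth-++ʳ xs ys i

nth-All : ∀ {P : ℕ → Set} {xs i} → All P xs → i < length xs → P (nth xs i)
nth-All {i = zero}  (p ∷ ps) _       = p
nth-All {i = suc i} (p ∷ ps) (s≤s q) = nth-All ps q

nth-applyUpTo : ∀ f {n i} → i < n → nth (applyUpTo f n) i ≡ f i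
nth-applyUpTo f {suc n} {zero}  _       = refl
nth-applyUpTo f {suc n} {suc i} (s≤s p) = nth-applyUpTo (f ∘ suc) p

nth-ext : ∀ xs ys → length xs ≡ length ys → (∀ i → i < length xs → nth xs i ≡ nth ys i) → xs ≡ ys
nth-ext []       []       _   _  = refl
nth-ext (x ∷ xs) (y ∷ ys) len eq = cong₂ _∷_ (eq 0 (s≤s z≤n)) (nth-ext xs ys (suc-injective len) (λ i i< → eq (suc i) (s≤s i<)))

applyUpTo-+ : ∀ {A : Set} (f : ℕ → A) n k → applyUpTo f n ++ applyUpTo (λ i → f (n + i)) k ≡ applyUpTo f (n + k)
applyUpTo-+ f zero    k = refl
applyUpTo-+ f (suc n) k = cong (f 0 ∷_) (applyUpTo-+ (f ∘ suc) n k)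

unique-map-∈ : ∀ {A B : Set} (f : A → B) {xs} → (∀ {x y} → x ∈ xs → y ∈ xs → f x ≡ f y → x ≡ y) → Unique xs → Unique (map f xs)
unique-map-∈ f inj []       = []
unique-map-∈ f {x ∷ xs} inj (x∉ ∷ u) = All.tabulate (λ {y} y∈ eq → sep y∈ eq) ∷ unique-map-∈ f (λ p q → inj (there p) (there q)) u
  where
  sep : ∀ {y} → y ∈ map f xs → f x ≡ y → ⊥
  sep y∈ eq with ∈-map⁻ f y∈
  ... | x′ , x′∈ , refl = All.lookup x∉ x′∈ (inj (here refl) (there x′∈) eq)

unique-concatMap : ∀ {A B : Set} (f : A → List B) {xs} → (∀ x → x ∈ xs → Unique (f x)) →
  (∀ {x y z} → x ∈ xs → y ∈ xs → z ∈ f x → z ∈ f y → x ≡ y) → Unique xs → Unique (concatMap f xs)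
unique-concatMap f uf inj [] = []
unique-concatMap f {x ∷ xs} uf inj (x∉ ∷ u) = Uniq.++⁺ (uf x (here refl))
  (unique-concatMap f (λ y y∈ → uf y (there y∈)) (λ p q → inj (there p) (there q)) u)
  λ { (p , q) → disj p q }
  where
  disj : ∀ {z} → z ∈ f x → z ∈ concatMap f xs → ⊥
  disj p q with ∈-concatMap-elim f xs q
  ... | y , y∈ , z∈ = All.lookup x∉ y∈ (inj (here refl) (there y∈) p z∈)

seqs : ℕ → List (List ℕ)
seqs zero    = [] ∷ []
seqs (suc D) = concatMap (λ c → map (c ∷_) (seqs D)) (rangeFrom1 3)

seqs-complete : ∀ {p} → All OneTwoThree p → p ∈ seqs (length p)
seqs-complete []                   = here refl
seqs-complete {c ∷ p} ((1≤c , c≤3) ∷ as) = ∈-concatMap-intro (λ c → map (c ∷_) (seqs (length p))) (∈-rangeFrom1⁺ 1≤c c≤3) (∈-map⁺ (c ∷_) (seqs-complete as))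

seqs-sound : ∀ D {p} → p ∈ seqs D → length p ≡ D × All OneTwoThree p
seqs-sound zero    (here refl) = refl , []
seqs-sound (suc D) p∈ with ∈-concatMap-elim (λ c → map (c ∷_) (seqs D)) (rangeFrom1 3) p∈
... | c , c∈ , q with ∈-map⁻ (c ∷_) q
... | p′ , p′∈ , refl with seqs-sound D p′∈
... | len , as = cong suc len , ∈-rangeFrom1⁻ 3 c∈ ∷ as

seqs-unique : ∀ D → Unique (seqs D)
seqs-unique zero    = [] ∷ []
seqs-unique (suc D) = unique-concatMap (λ c → map (c ∷_) (seqs D)) (λ c _ → Uniq.map⁺ ∷-injectiveʳ (seqs-unique D))
  (λ {x} {y} _ _ p q → same p q) (Uniq.applyUpTo⁺₁ suc 3 (λ i<j _ eq → <⇒≢ i<j (suc-injective eq)))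
  where
  same : ∀ {x y z} → z ∈ map (x ∷_) (seqs D) → z ∈ map (y ∷_) (seqs D) → x ≡ y
  same p q with ∈-map⁻ _ p | ∈-map⁻ _ q
  ... | _ , _ , e | _ , _ , e′ = ∷-injectiveˡ (trans (sym e) e′)

admissibleAt : ℕ → List ℕ → ℕ → ℕ → Bool
admissibleAt D p i j = (D <ᵇ i + j) ∨ (wordK p (i + j) ≤ᵇ wordK p i + wordK p j)

admissible : ℕ → List ℕ → Bool
admissible D p = all (λ i → all (admissibleAt D p i) (upTo (suc D))) (upTo (suc D))

prefixes : ℕ → List (List ℕ)
prefixes D = filterᵇ (admissible D) (seqs D)

prefixes-sound : ∀ D {p} → p ∈ prefixes D → length p ≡ D × All OneTwoThree p ×
  (∀ i j → i + j ≤ D → wordK p (i + j) ≤ wordK p i + wordK p j)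
prefixes-sound D {p} p∈ with ∈-filterᵇ⁻ (admissible D) {xs = seqs D} p∈
... | p∈S , adm with seqs-sound D p∈S
... | len , as = len , as , λ i j i+j≤D → ≤ᵇ-true⁻ (right (<ᵇ-false {D} {i + j} i+j≤D)
    (all-elim (admissibleAt D p i) (upTo (suc D)) (all-elim (λ i → all (admissibleAt D p i) (upTo (suc D))) (upTo (suc D)) adm i
      (∈-upTo⁺ (s≤s (≤-trans (m≤m+n i j) i+j≤D)))) j (∈-upTo⁺ (s≤s (≤-trans (m≤n+m j i) i+j≤D)))))
  where
  right : ∀ {x y} → x ≡ false → x ∨ y ≡ true → y ≡ true
  right refl e = e

prefixes-complete : ∀ {p} → All OneTwoThree p → (∀ i j → i + j ≤ length p → wordK p (i + j) ≤ wordK p i + wordK p j) → p ∈ prefixes (length p)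
prefixes-complete {p} as sub = ∈-filterᵇ⁺ (admissible D) (seqs-complete as)
  (all-intro _ (upTo (suc D)) (λ i _ → all-intro (admissibleAt D p i) (upTo (suc D)) (λ j _ → ok i j)))
  where
  D = length p
  ok : ∀ i j → admissibleAt D p i j ≡ true
  ok i j with D <ᵇ i + j in e
  ... | true  = refl
  ... | false = ≤ᵇ-true (sub i j (<ᵇ-false⁻ {D} {i + j} e))

module _ D {p u} (p∈ : p ∈ prefixes D) (ot : All OneTwo u) where

  private
    ks = p ++ u
    len = proj₁ (prefixes-sound D p∈)
    as = proj₁ (proj₂ (prefixes-sound D p∈))
    sub = proj₂ (proj₂ (prefixes-sound D p∈))
    all-ks : All OneTwoThree ks
    all-ks = AllP.++⁺ as (All.map (λ (x , y) → x , m≤n⇒m≤1+n y) ot)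
    k = wordK ks
    m = length ks
    k-low : ∀ i → 1 ≤ i → i ≤ m → 1 ≤ k i
    k-low (suc i) _ i≤m = proj₁ (nth-All all-ks i≤m)
    k-high : ∀ i → i ≤ m → k i ≤ 3
    k-high zero    _   = z≤n
    k-high (suc i) i≤m = proj₂ (nth-All all-ks i≤m)
    k-prefix : ∀ i → i ≤ D → k i ≡ wordK p i
    k-prefix i i≤D = nth-++ˡ (0 ∷ p) u (s≤s (≤-trans i≤D (≤-reflexive (sym len))))
    k-suffix : ∀ i → D < i → i ≤ m → k i ≤ 2
    k-suffix i D<i i≤m = subst (_≤ 2) (sym (trans (cong k (sym i≡)) (nth-++ʳ (0 ∷ p) u r))) (proj₂ (nth-All ot r<))
      where
      r = i ∸ suc (length p)
      i≡ : suc (length p) + r ≡ i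
      i≡ = m+[n∸m]≡n (≤-trans (s≤s (≤-reflexive len)) D<i)
      r< : r < length u
      r< = +-cancelˡ-≤ (length p) (suc r) (length u) (≤-trans (≤-reflexive (trans (+-suc (length p) r) i≡)) (≤-trans i≤m (≤-reflexive (length-++ p))))

  -- Beyond the prefix every coordinate is at most 2 = 1 + 1, so subadditivity has to be checked
  -- only inside the prefix. The wrapped inequality is automatic, as all coordinates are at most 3 =
  -- 1 + 1 + 1. Hence an admissible prefix may be followed by any tiling.
  word-Kunz : Kunz (length (p ++ u)) (wordK (p ++ u))
  word-Kunz = record
    { k-zero = refl
    ; k-pos  = λ i i<m → k-low (suc i) (s≤s z≤n) i<m
    ; k-sub  = k-sub′
    ; k-wrap = λ i j l i≤m j≤m eq → ≤-trans (k-high l (l≤m i j l i≤m j≤m eq))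
        (s≤s (k-low i (pos i j l j≤m eq) i≤m ⊕ k-low j (pos j i l i≤m (trans (+-comm j i) eq)) j≤m))
    }
    where
    k-sub′ : ∀ i j → i + j ≤ m → k (i + j) ≤ k i + k j
    k-sub′ zero    j       _ = ≤-refl
    k-sub′ (suc i) zero    _ = ≤-trans (≤-reflexive (cong k (+-identityʳ (suc i)))) (m≤m+n (k (suc i)) 0)
    k-sub′ (suc i) (suc j) le with suc i + suc j ≤? D
    ... | yes ≤D = subst₂ _≤_ (sym (k-prefix _ ≤D)) (sym (cong₂ _+_ (k-prefix (suc i) (≤-trans (m≤m+n (suc i) (suc j)) ≤D)) (k-prefix (suc j) (≤-trans (m≤n+m (suc j) (suc i)) ≤D)))) (sub (suc i) (suc j) ≤D)
    ... | no ≰D  = ≤-trans (k-suffix _ (≰⇒> ≰D) le) (k-low (suc i) (s≤s z≤n) (≤-trans (m≤m+n (suc i) (suc j)) le) ⊕ k-low (suc j) (s≤s z≤n) (≤-trans (m≤n+m (suc j) (suc i)) le))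
    l≤m : ∀ i j l → i ≤ m → j ≤ m → i + j ≡ l + suc m → l ≤ m
    l≤m i j l i≤m j≤m eq = +-cancelʳ-≤ (suc m) l m (≤-trans (≤-reflexive (sym eq)) (≤-trans (i≤m ⊕ j≤m) (+-monoʳ-≤ m (n≤1+n m))))
    pos : ∀ i j l → j ≤ m → i + j ≡ l + suc m → 1 ≤ i
    pos zero    j l j≤m eq = contradiction (≤-trans (m≤n+m (suc m) l) (≤-trans (≤-reflexive (sym eq)) j≤m)) (<⇒≱ ≤-refl)
    pos (suc i) j l j≤m eq = s≤s z≤n

goodWords : ℕ → ℕ → List (List ℕ)
goodWords g D = concatMap (λ p → map (p ++_) (tilings (g ∸ sum p))) (prefixes D)

goodSets : ℕ → ℕ → List (List ℕ)
goodSets g D = map (wordGaps g) (goodWords g D)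

sum≤3D : ∀ {D p} → p ∈ prefixes D → sum p ≤ 3 * D
sum≤3D {D} {p} p∈ with prefixes-sound D p∈
... | refl , as , _ = go as
  where
  go : ∀ {p} → All OneTwoThree p → sum p ≤ 3 * length p
  go []                           = z≤n
  go {c ∷ p} ((_ , c≤3) ∷ as) = ≤-trans (c≤3 ⊕ go as) (≤-reflexive (sym (*-suc 3 (length p))))

module _ (g D : ℕ) (3D≤g : 3 * D ≤ g) where

  sum-good : ∀ {p u} → p ∈ prefixes D → u ∈ tilings (g ∸ sum p) → sum (p ++ u) ≡ g
  sum-good {p} {u} p∈ u∈ = trans (sum-++ p u) (trans (cong (sum p +_) (proj₁ (tilings-sound (g ∸ sum p) u∈)))
    (m+[n∸m]≡n (≤-trans (sum≤3D {D} p∈) 3D≤g)))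

  goodWords-sound : ∀ {ks} → ks ∈ goodWords g D → Kunz (length ks) (wordK ks) × sumTo (suc (length ks)) (wordK ks) ≡ g
  goodWords-sound ks∈ with ∈-concatMap-elim (λ p → map (p ++_) (tilings (g ∸ sum p))) (prefixes D) ks∈
  ... | p , p∈ , q with ∈-map⁻ (p ++_) q
  ... | u , u∈ , refl = word-Kunz D p∈ (proj₂ (tilings-sound (g ∸ sum p) u∈)) , trans (wordK-sum (p ++ u)) (sum-good p∈ u∈)

  goodSets⊆gapSets : ∀ H → H ∈ goodSets g D → H ∈ gapSets g
  goodSets⊆gapSets H H∈ with ∈-map⁻ (wordGaps g) H∈
  ... | ks , ks∈ , refl with goodWords-sound ks∈
  ... | K , s = gapList∈gapSets K s

  -- All prefixes have the same length D, so a word determines its prefix, and `gapList-injective`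
  -- separates different words.
  goodSets-unique : Unique (goodSets g D)
  goodSets-unique = unique-map-∈ (wordGaps g) inj
    (unique-concatMap (λ p → map (p ++_) (tilings (g ∸ sum p)))
      (λ p _ → Uniq.map⁺ (++-injective p) (tilings-unique (g ∸ sum p)))
      same-prefix (Uniq.filter⁺ _ (seqs-unique D)))
    where
    ++-injective : ∀ (p : List ℕ) {u v} → p ++ u ≡ p ++ v → u ≡ v
    ++-injective []      e = e
    ++-injective (x ∷ p) e = ++-injective p (∷-injectiveʳ e)
    prefix≡ : ∀ (p q : List ℕ) {u v} → length p ≡ length q → p ++ u ≡ q ++ v → p ≡ q
    prefix≡ []      []      _ _ = refl
    prefix≡ (x ∷ p) (y ∷ q) l e = cong₂ _∷_ (∷-injectiveˡ e) (prefix≡ p q (suc-injective l) (∷-injectiveʳ e))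
    same-prefix : ∀ {p q ks} → p ∈ prefixes D → q ∈ prefixes D → ks ∈ map (p ++_) (tilings (g ∸ sum p)) → ks ∈ map (q ++_) (tilings (g ∸ sum q)) → p ≡ q
    same-prefix {p} {q} p∈ q∈ a b with ∈-map⁻ (p ++_) a | ∈-map⁻ (q ++_) b
    ... | _ , _ , e | _ , _ , e′ = prefix≡ p q (trans (proj₁ (prefixes-sound D p∈)) (sym (proj₁ (prefixes-sound D q∈)))) (trans (sym e) e′)
    inj : ∀ {ks ks′} → ks ∈ goodWords g D → ks′ ∈ goodWords g D → wordGaps g ks ≡ wordGaps g ks′ → ks ≡ ks′
    inj {ks} {ks′} ks∈ ks′∈ eq with goodWords-sound ks∈ | goodWords-sound ks′∈
    ... | K , s | K′ , s′ with gapList-injective K K′ s s′ eq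
    ... | len , same = nth-ext ks ks′ len (λ i i< → same (suc i) i<)

  tame⇒good : ∀ {H} (d : KunzData g H) → Tame D (KunzData.m d) (KunzData.k d) → H ∈ goodSets g D
  tame⇒good {H} d t = subst (_∈ goodSets g D) (sym H≡word) (∈-map⁺ (wordGaps g)
      (∈-concatMap-intro (λ p → map (p ++_) (tilings (g ∸ sum p))) p∈ (∈-map⁺ (p ++_) u∈)))
    where
    open KunzData d
    open Kunz kunz
    open Tame t
    p = applyUpTo (k ∘ suc) D
    u = applyUpTo (λ i → k (suc (D + i))) (m ∸ D)
    ks≡ : p ++ u ≡ applyUpTo (k ∘ suc) m
    ks≡ = trans (applyUpTo-+ (k ∘ suc) D (m ∸ D)) (cong (applyUpTo (k ∘ suc)) (m+[n∸m]≡n D≤m))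
    word≡ : ∀ n i → i ≤ n → wordK (applyUpTo (k ∘ suc) n) i ≡ k i
    word≡ n zero    _   = sym k-zero
    word≡ n (suc i) i<n = nth-applyUpTo (k ∘ suc) i<n
    H≡word : H ≡ wordGaps g (p ++ u)
    H≡word = trans H≡ (trans (gapList-cong g m (λ i i≤m → sym (word≡ m i i≤m)))
      (trans (cong (λ z → gapList g z (wordK (applyUpTo (k ∘ suc) m))) (sym (length-applyUpTo (k ∘ suc) m))) (cong (wordGaps g) (sym ks≡))))
    len : length p ≡ D
    len = length-applyUpTo (k ∘ suc) D
    p∈ : p ∈ prefixes D
    p∈ = subst (λ z → p ∈ prefixes z) len (prefixes-complete
      (AllP.applyUpTo⁺₁ (k ∘ suc) D (λ {i} i<D → k-pos i (≤-trans i<D D≤m) , prefix (suc i) i<D))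
      (λ i j le → let le′ = ≤-trans le (≤-reflexive len) in subst₂ _≤_ (sym (word≡ D (i + j) le′))
        (sym (cong₂ _+_ (word≡ D i (≤-trans (m≤m+n i j) le′)) (word≡ D j (≤-trans (m≤n+m j i) le′)))) (k-sub i j (≤-trans le′ D≤m))))
    sum-ks : sum p + sum u ≡ g
    sum-ks = trans (sym (sum-++ p u)) (trans (cong sum ks≡) (trans (cong sum (sym (map-upTo (k ∘ suc) m)))
      (trans (sumOn-upTo (k ∘ suc) m) (trans (cong (_+ sumTo m (k ∘ suc)) (sym k-zero)) (trans (sym (sumTo-front m k)) k-sum)))))
    u∈ : u ∈ tilings (g ∸ sum p)
    u∈ = subst (λ z → u ∈ tilings z) (sym (trans (cong (_∸ sum p) (sym sum-ks)) (m+n∸m≡n (sum p) (sum u))))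
      (tilings-complete u (AllP.applyUpTo⁺₁ _ (m ∸ D) (λ {i} i< → k-pos (D + i) (in-range i i<) , suffix _ (s≤s (m≤m+n D i)) (in-range i i<))))
      where
      in-range : ∀ i → i < m ∸ D → D + i < m
      in-range i i< = ≤-trans (≤-reflexive (sym (+-suc D i))) (≤-trans (+-monoʳ-≤ D i<) (≤-reflexive (m+[n∸m]≡n D≤m)))

  length-goodSets : length (goodSets g D) ≡ sumOn (λ p → Z (g ∸ sum p)) (prefixes D)
  length-goodSets = trans (length-map (wordGaps g) (goodWords g D)) (trans (length-concatMap (λ p → map (p ++_) (tilings (g ∸ sum p))) (prefixes D))
    (sumOn-cong (prefixes D) (λ p _ → trans (length-map (p ++_) (tilings (g ∸ sum p))) (length-tilings (g ∸ sum p)))))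

-- The second moment within one prefix class

weight² : List ℕ → ℕ
weight² H = weight H * weight H

classMoment : ℕ → List ℕ → ℕ
classMoment g p = sumOn (λ u → weight² (wordGaps g (p ++ u))) (tilings (g ∸ sum p))

moment-goodSets : ∀ g D → sumOn weight² (goodSets g D) ≡ sumOn (classMoment g) (prefixes D)
moment-goodSets g D = trans (sumOn-map weight² (wordGaps g) (goodWords g D))
  (trans (sumOn-concatMap (weight² ∘ wordGaps g) (λ p → map (p ++_) (tilings (g ∸ sum p))) (prefixes D))
  (sumOn-cong (prefixes D) (λ p _ → sumOn-map (weight² ∘ wordGaps g) (p ++_) (tilings (g ∸ sum p)))))

inv-bound : ∀ u → All OneTwo u → twos u ≤ sum u × inv u ≤ sum u * sum u
inv-bound [] _ = z≤n , z≤n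
inv-bound (1 ∷ u) (_ ∷ ot) with inv-bound u ot
... | t , i = m≤n⇒m≤1+n t , lin (suc (sum u)) (i ⊕ t) (lem (inv u) (twos u) (sum u))
  where
  lem : ∀ i j s → suc s * suc s + (i + j) ≡ i + j + (s * s + s) + suc s
  lem = solve-∀
inv-bound (2 ∷ u) (_ ∷ ot) with inv-bound u ot
... | t , i = s≤s (m≤n⇒m≤1+n t) , ≤-trans i (*-mono-≤ (m≤n+m (sum u) 2) (m≤n+m (sum u) 2))
inv-bound (suc (suc (suc c)) ∷ u) ((_ , s≤s (s≤s ())) ∷ ot)

squareError : ℕ → ℕ
squareError x = 2 * (1 + x) * x + x * x

-- The cross term i E has order g² · g, so an error O(g) in the weight costs O(g³) in its square.
-- The extra x in `squareError` comes from replacing w by i + E in the second estimate.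
square-close : ∀ g x i w E → 1 ≤ g → i ≤ g * g → E ≤ x * g → w ≤ i + E → i ≤ w + E →
  (w * w ≤ i * i + squareError x * (g * g * g)) × (i * i ≤ w * w + squareError x * (g * g * g))
square-close g x i w E 1≤g i≤ E≤ w≤ i≤w = upper , lower
  where
  open ≤-Reasoning
  g² = g * g
  E² : E * E ≤ x * x * (g² * g)
  E² = begin
    E * E ≤⟨ *-mono-≤ E≤ E≤ ⟩
    x * g * (x * g) ≡⟨ lem x g ⟩
    x * x * (g * g) ≤⟨ *-monoʳ-≤ (x * x) (≤-trans (≤-reflexive (sym (*-identityʳ g²))) (*-monoʳ-≤ g² 1≤g)) ⟩
    x * x * (g² * g) ∎
    where
    lem : ∀ x g → x * g * (x * g) ≡ x * x * (g * g)
    lem = solve-∀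
  iE : i * E ≤ x * (g² * g)
  iE = ≤-trans (*-mono-≤ i≤ E≤) (≤-reflexive (lem g x))
    where
    lem : ∀ g x → g * g * (x * g) ≡ x * (g * g * g)
    lem = solve-∀
  upper : w * w ≤ i * i + squareError x * (g² * g)
  upper = begin
    w * w ≤⟨ *-mono-≤ w≤ w≤ ⟩
    (i + E) * (i + E) ≤⟨ lin (2 * (x * x * (g² * g))) (*-monoʳ-≤ 2 iE ⊕ E²) (lem i E x (g² * g)) ⟩
    i * i + squareError x * (g² * g) ∎
    where
    lem : ∀ i E x c → i * i + (2 * (1 + x) * x + x * x) * c + (2 * (i * E) + E * E) ≡ (i + E) * (i + E) + (2 * (x * c) + x * x * c) + 2 * (x * x * c)
    lem = solve-∀
  wE : w * E ≤ (1 + x) * x * (g² * g)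
  wE = begin
    w * E ≤⟨ *-monoˡ-≤ E w≤ ⟩
    (i + E) * E ≡⟨ *-distribʳ-+ E i E ⟩
    i * E + E * E ≤⟨ iE ⊕ E² ⟩
    x * (g² * g) + x * x * (g² * g) ≡⟨ lem x (g² * g) ⟩
    (1 + x) * x * (g² * g) ∎
    where
    lem : ∀ x c → x * c + x * x * c ≡ (1 + x) * x * c
    lem = solve-∀
  lower : i * i ≤ w * w + squareError x * (g² * g)
  lower = begin
    i * i ≤⟨ *-mono-≤ i≤w i≤w ⟩
    (w + E) * (w + E) ≤⟨ lin 0 (*-monoʳ-≤ 2 wE ⊕ E²) (lem w E x (g² * g)) ⟩
    w * w + squareError x * (g² * g) ∎
    where
    lem : ∀ i E x c → i * i + (2 * (1 + x) * x + x * x) * c + (2 * (i * E) + E * E) ≡ (i + E) * (i + E) + (2 * ((1 + x) * x * c) + x * x * c) + 0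
    lem = solve-∀

-- Three errors of order g³: the weight against `inv`, where `weightError D g` ≤ (11 D + 1) g; the
-- 37 of the closed form; and 12 D from replacing n⁴ by g⁴ for n = g - sum p.
classError : ℕ → ℕ
classError D = 100 * squareError (11 * D + 1) + 37 + 12 * D

module _ g D {p} (p∈ : p ∈ prefixes D) (large : 3 * D + 2 ≤ g) where

  private
    n = g ∸ sum p
    s = sum p
    x = 11 * D + 1
    q = squareError x
    g³ = g * g * g
    s≤3D : s ≤ 3 * D
    s≤3D = sum≤3D {D} p∈
    n+s : n + s ≡ g
    n+s = m∸n+n≡m (≤-trans s≤3D (≤-trans (m≤m+n (3 * D) 2) large))
    2≤n : 2 ≤ n
    2≤n = m+n≤o⇒m≤o∸n 2 (≤-trans (+-monoʳ-≤ 2 s≤3D) (≤-trans (≤-reflexive (+-comm 2 (3 * D))) large))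
    n₂ = n ∸ 2
    n≡ : 2 + n₂ ≡ n
    n≡ = m+[n∸m]≡n 2≤n
    n≤g : n ≤ g
    n≤g = m∸n≤m g s
    1≤g : 1 ≤ g
    1≤g = ≤-trans (≤-trans (s≤s z≤n) 2≤n) n≤g
    E = weightError D g
    E≤ : E ≤ x * g
    E≤ = lin {6 * D * 1} {6 * D * g} 0 (*-monoʳ-≤ (6 * D) 1≤g) (lem D g)
      where
      lem : ∀ D g → (11 * D + 1) * g + 6 * D * 1 ≡ D * (5 * g + 6) + g + 6 * D * g + 0
      lem = solve-∀
    close : ∀ u → u ∈ tilings n → let w = weight (wordGaps g (p ++ u)) in
      (w * w ≤ inv u * inv u + q * g³) × (inv u * inv u ≤ w * w + q * g³)
    close u u∈ with prefixes-sound D p∈ | tilings-sound n u∈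
    ... | len , as , _ | su , ot with weight-inv p u as ot (word-Kunz D p∈ ot) (trans (sum-++ p u) (trans (cong (s +_) su) (trans (+-comm s n) n+s)))
    ... | up , low = square-close g x (inv u) (weight (wordGaps g (p ++ u))) E 1≤g
        (≤-trans (proj₂ (inv-bound u ot)) (*-mono-≤ (≤-trans (≤-reflexive su) n≤g) (≤-trans (≤-reflexive su) n≤g)))
        E≤ (subst (λ d → weight (wordGaps g (p ++ u)) ≤ inv u + weightError d g) len up) (subst (λ d → inv u ≤ weight (wordGaps g (p ++ u)) + weightError d g) len low)
    W = classMoment g p
    z = Z n₂
    Zn = Z n
    split : ∀ f → sumOn (λ u → f u + q * g³) (tilings n) ≡ sumOn f (tilings n) + Zn * (q * g³)
    split f = trans (sumOn-+ f (λ _ → q * g³) (tilings n)) (cong (sumOn f (tilings n) +_) (trans (sumOn-const (q * g³) (tilings n)) (cong (_* (q * g³)) (length-tilings n))))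
    W≤ : W ≤ I₂ n + Zn * (q * g³)
    W≤ = ≤-trans (sumOn-mono (tilings n) (λ u u∈ → proj₁ (close u u∈))) (≤-reflexive (split (λ u → inv u * inv u)))
    I≤ : I₂ n ≤ W + Zn * (q * g³)
    I≤ = ≤-trans (sumOn-mono (tilings n) (λ u u∈ → proj₂ (close u u∈))) (≤-reflexive (split (λ u → weight² (wordGaps g (p ++ u)))))
    n³≤ : n * n * n ≤ g³
    n³≤ = *-mono-≤ (*-mono-≤ n≤g n≤g) n≤g
    upper′ : 100 * I₂ n ≤ n * (n * n * n) * z + 37 * (n * n * n * Zn)
    upper′ = subst (λ y → 100 * I₂ y ≤ y * (y * y * y) * z + 37 * (y * y * y * Z y)) n≡ (second-moment-upper n₂)
    lower′ : n * (n * n * n) * z ≤ 100 * I₂ n + 37 * (n * n * n * Zn)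
    lower′ = subst (λ y → y * (y * y * y) * z ≤ 100 * I₂ y + 37 * (y * y * y * Z y)) n≡ (second-moment-lower n₂)
    z≤Zn : z ≤ Zn
    z≤Zn = Z-mono (m∸n≤m n 2)

  open ≤-Reasoning

  classMoment-upper : 100 * classMoment g p ≤ g * g³ * Z (g ∸ sum p ∸ 2) + classError D * (g³ * Z (g ∸ sum p))
  classMoment-upper = begin
    100 * W ≤⟨ *-monoʳ-≤ 100 W≤ ⟩
    100 * (I₂ n + Zn * (q * g³)) ≡⟨ *-distribˡ-+ 100 (I₂ n) _ ⟩
    100 * I₂ n + 100 * (Zn * (q * g³)) ≤⟨ +-monoˡ-≤ _ upper′ ⟩
    n * (n * n * n) * z + 37 * (n * n * n * Zn) + 100 * (Zn * (q * g³))
      ≤⟨ +-monoˡ-≤ (100 * (Zn * (q * g³))) (*-monoˡ-≤ z (*-mono-≤ n≤g n³≤) ⊕ *-monoʳ-≤ 37 (*-monoˡ-≤ Zn n³≤)) ⟩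
    g * g³ * z + 37 * (g³ * Zn) + 100 * (Zn * (q * g³)) ≤⟨ lin (12 * D * (g³ * Zn)) (z≤n {0}) (lem (g * g³ * z) g³ Zn q D) ⟩
    g * g³ * z + classError D * (g³ * Zn) ∎
    where
    lem : ∀ a c y q D → a + (100 * q + 37 + 12 * D) * (c * y) + 0 ≡ a + 37 * (c * y) + 100 * (y * (q * c)) + 0 + 12 * D * (c * y)
    lem = solve-∀

  classMoment-lower : g * g³ * Z (g ∸ sum p ∸ 2) ≤ 100 * classMoment g p + classError D * (g³ * Z (g ∸ sum p))
  classMoment-lower = begin
    g * g³ * z ≤⟨ *-monoˡ-≤ z fourth ⟩
    (n * (n * n * n) + 12 * D * g³) * z ≡⟨ *-distribʳ-+ z (n * (n * n * n)) (12 * D * g³) ⟩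
    n * (n * n * n) * z + 12 * D * g³ * z ≤⟨ lower′ ⊕ *-monoʳ-≤ (12 * D * g³) z≤Zn ⟩
    100 * I₂ n + 37 * (n * n * n * Zn) + 12 * D * g³ * Zn
      ≤⟨ +-monoˡ-≤ (12 * D * g³ * Zn) (*-monoʳ-≤ 100 I≤ ⊕ *-monoʳ-≤ 37 (*-monoˡ-≤ Zn n³≤)) ⟩
    100 * (W + Zn * (q * g³)) + 37 * (g³ * Zn) + 12 * D * g³ * Zn ≡⟨ lem W Zn q g³ D ⟩
    100 * W + classError D * (g³ * Zn) ∎
    where
    lem : ∀ w y q c D → 100 * (w + y * (q * c)) + 37 * (c * y) + 12 * D * c * y ≡ 100 * w + (100 * q + 37 + 12 * D) * (c * y)
    lem = solve-∀
    -- With s = g - n, the difference g⁴ - n⁴ is at most 4 s g³, and s ≤ 3 D.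
    fourth : g * g³ ≤ n * (n * n * n) + 12 * D * g³
    fourth = subst (λ h → h * (h * h * h) ≤ n * (n * n * n) + 12 * D * (h * h * h)) n+s
      (lin (6 * (n * n * (s * s)) + 8 * (n * (s * s * s)) + 3 * (s * s * s * s)) (*-monoˡ-≤ (4 * ((n + s) * (n + s) * (n + s))) s≤3D) (lem₂ n s D))
      where
      lem₂ : ∀ n s D → n * (n * n * n) + 12 * D * ((n + s) * (n + s) * (n + s)) + s * (4 * ((n + s) * (n + s) * (n + s)))
        ≡ (n + s) * ((n + s) * (n + s) * (n + s)) + 3 * D * (4 * ((n + s) * (n + s) * (n + s))) + (6 * (n * n * (s * s)) + 8 * (n * (s * s * s)) + 3 * (s * s * s * s))
      lem₂ = solve-∀

-- Cassini's identity for one parity only, so that its sign is fixed; a step of the induction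
-- advances the index by two.
cassini : ∀ i → Z (1 + 2 * i) * Z (1 + 2 * i) + Z (1 + 2 * i) * Z (2 + 2 * i) + 1 ≡ Z (2 + 2 * i) * Z (2 + 2 * i)
cassini zero    = refl
cassini (suc i) = subst (λ j → Z (1 + j) * Z (1 + j) + Z (1 + j) * Z (2 + j) + 1 ≡ Z (2 + j) * Z (2 + j)) (sym (*-suc 2 i))
  (step (Z (1 + 2 * i)) (Z (2 + 2 * i)) (cassini i))
  where
  step : ∀ α β → α * α + α * β + 1 ≡ β * β → (β + α) * (β + α) + (β + α) * (β + α + β) + 1 ≡ (β + α + β) * (β + α + β)
  step α β eq = trans (lem₁ α β) (trans (cong (_+ (3 * (β * β) + 4 * (α * β) + α * α)) eq) (lem₂ α β))
    where
    lem₁ : ∀ α β → (β + α) * (β + α) + (β + α) * (β + α + β) + 1 ≡ α * α + α * β + 1 + (3 * (β * β) + 4 * (α * β) + α * α)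
    lem₁ = solve-∀
    lem₂ : ∀ α β → β * β + (3 * (β * β) + 4 * (α * β) + α * α) ≡ (β + α + β) * (β + α + β)
    lem₂ = solve-∀

-- α / (α + β) and β / (α + 2 β) are ratios Z n / Z (n + 2) of both parities, hence they enclose all later ones.
record Enclosure (i α β : ℕ) : Set where
  field
    below : ∀ n → 2 + 2 * i ≤ n → α * Z (2 + n) ≤ (β + α) * Z n
    above : ∀ n → 2 + 2 * i ≤ n → (β + α + β) * Z n ≤ β * Z (2 + n)

-- Both inequalities are linear in the sequence, so two consecutive instances yield all later ones
-- through the recurrence. Of the two starting instances one is an equality and the other is
-- `cassini`.
enclosure : ∀ i → Enclosure i (Z (1 + 2 * i)) (Z (2 + 2 * i))
enclosure i = record
  { below = λ n le → subst (λ n → α * Z (2 + n) ≤ (β + α) * Z n) (m+[n∸m]≡n (≤-trans (n≤1+n _) le)) (proj₁ (below′ (n ∸ (1 + 2 * i))))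
  ; above = λ n le → subst (λ n → (β + α + β) * Z n ≤ β * Z (2 + n)) (m+[n∸m]≡n le) (proj₁ (above′ (n ∸ (2 + 2 * i))))
  }
  where
  α = Z (1 + 2 * i)
  β = Z (2 + 2 * i)
  Below Above : ℕ → Set
  Below n = α * Z (2 + n) ≤ (β + α) * Z n
  Above n = (β + α + β) * Z n ≤ β * Z (2 + n)
  below′ : ∀ d → Below (1 + 2 * i + d) × Below (2 + 2 * i + d)
  below′ zero = subst (λ n → Below n × Below (suc n)) (sym (+-identityʳ (1 + 2 * i)))
    (≤-reflexive (*-comm α (β + α)) , lin 1 (z≤n {0}) (trans (+-identityʳ _) (trans (*-distribʳ-+ β β α) (trans (cong (_+ α * β) (sym (cassini i))) (lem α β)))))
    where
    lem : ∀ α β → α * α + α * β + 1 + α * β ≡ α * (β + α + β) + 0 + 1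
    lem = solve-∀
  below′ (suc d) with below′ d
  ... | p , q = subst Below (sym (+-suc (1 + 2 * i) d)) q , subst Below (sym (+-suc (2 + 2 * i) d))
    (lin 0 (q ⊕ p) (lem α (β + α) (Z (suc (2 + (1 + 2 * i + d)))) (Z (2 + (1 + 2 * i + d))) (Z (2 + 2 * i + d)) (Z (1 + 2 * i + d))))
    where
    lem : ∀ a b x y z w → b * (z + w) + (a * x + a * y) ≡ a * (x + y) + (b * z + b * w) + 0
    lem = solve-∀
  above′ : ∀ d → Above (2 + 2 * i + d) × Above (3 + 2 * i + d)
  above′ zero = subst (λ n → Above n × Above (suc n)) (sym (+-identityʳ (2 + 2 * i)))
    (≤-reflexive (*-comm (β + α + β) β) , lin 1 (z≤n {0}) (trans (lem₁ α β) (trans (cong (_+ (2 * (α * β) + 2 * (β * β))) (sym (cassini i))) (lem₂ α β))))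
    where
    lem₁ : ∀ α β → β * (β + α + β + (β + α)) + 0 ≡ β * β + (2 * (α * β) + 2 * (β * β))
    lem₁ = solve-∀
    lem₂ : ∀ α β → α * α + α * β + 1 + (2 * (α * β) + 2 * (β * β)) ≡ (β + α + β) * (β + α) + 0 + 1
    lem₂ = solve-∀
  above′ (suc d) with above′ d
  ... | p , q = subst Above (sym (+-suc (2 + 2 * i) d)) q , subst Above (sym (+-suc (3 + 2 * i) d))
    (lin 0 (q ⊕ p) (lem (β + α + β) β (Z (2 + (3 + 2 * i + d))) (Z (2 + (2 + 2 * i + d))) (Z (3 + 2 * i + d)) (Z (2 + 2 * i + d))))
    where
    lem : ∀ a b x y z w → b * (x + y) + (a * z + a * w) ≡ a * (z + w) + (b * x + b * y) + 0
    lem = solve-∀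

-- Good and negligible gap sets

sum≤ : ∀ {B} xs → All (_≤ B) xs → sum xs ≤ length xs * B
sum≤ []       []       = z≤n
sum≤ (x ∷ xs) (p ∷ ps) = p ⊕ sum≤ xs ps

-- The negligible sets need no better estimate than that of g gaps, each at most 2 g.
weight-bound : ∀ g {H} → KunzData g H → weight² H ≤ 4 * (g * (g * g * g))
weight-bound g {H} d = ≤-trans (*-mono-≤ w≤ w≤) (≤-reflexive (lem g))
  where
  open KunzData d
  x≤ : ∀ {x} → x ∈ gapList g m k → x ≤ 2 * g
  x≤ x∈ = ≤-pred (∈-upTo⁻ (proj₁ (∈-filterᵇ⁻ (gapᵇ m k) {xs = upTo (suc (2 * g))} x∈)))
  len : length H ≡ g
  len = trans (cong length H≡) (gapList-length kunz k-sum)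
  w≤ : weight H ≤ g * (2 * g)
  w≤ = ≤-trans (m∸n≤m (sum H) ((length H * suc (length H)) / 2)) (≤-trans (sum≤ H (subst (All (_≤ 2 * g)) (sym H≡) (All.tabulate x≤))) (≤-reflexive (cong (_* (2 * g)) len)))
  lem : ∀ g → g * (2 * g) * (g * (2 * g)) ≡ 4 * (g * (g * g * g))
  lem = solve-∀

record Decomposition (g D : ℕ) : Set where
  field
    rest  : List (List ℕ)
    perm  : gapSets g ↭ goodSets g D ++ rest
    rest≤ : length rest ≤ length (tailCodes g D)
    rest⊆ : ∀ H → H ∈ rest → H ∈ gapSets g

not-good⇒coded : ∀ g D {H} → 3 * D ≤ g → 1 ≤ g → KunzData g H → H ∉ goodSets g D → ∃ λ c → c ∈ tailCodes g D × TailCoded g H c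
not-good⇒coded g D 3D≤g 1≤g d H∉ = [ (λ t → contradiction (tame⇒good g D 3D≤g d t) H∉) , id ]′ (tame-or-coded D 3D≤g 1≤g d)

decompose : ∀ g D → 3 * D ≤ g → 1 ≤ g → Decomposition g D
decompose g D 3D≤g 1≤g with unique-⊆-split (goodSets g D) (gapSets g) (goodSets-unique g D 3D≤g) (gapSets-unique g) (goodSets⊆gapSets g D 3D≤g)
... | zs , perm , uz , props = record
  { rest = zs ; perm = perm ; rest⊆ = λ H H∈ → proj₁ (props H H∈)
  ; rest≤ = relational-pigeonhole (TailCoded g) zs (tailCodes g D) uz
      (λ H H∈ → not-good⇒coded g D 3D≤g 1≤g (kunzData g (proj₁ (props H H∈))) (proj₂ (props H H∈)))
      (λ {H} {H′} {c} → tailCoded-injective {g} {H} {H′} {c}) }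

-- For D = 0 the only prefix is empty, and the good sets are those of the tilings of length g.
Z≤count : ∀ g → Z g ≤ length (gapSets g)
Z≤count g with unique-⊆-split (goodSets g 0) (gapSets g) (goodSets-unique g 0 z≤n) (gapSets-unique g) (goodSets⊆gapSets g 0 z≤n)
... | zs , perm , _ = begin
  Z g ≡⟨ +-identityʳ (Z g) ⟨
  Z g + 0 ≡⟨ length-goodSets g 0 z≤n ⟨
  length (goodSets g 0) ≤⟨ m≤m+n _ (length zs) ⟩
  length (goodSets g 0) + length zs ≡⟨ length-++ (goodSets g 0) ⟨
  length (goodSets g 0 ++ zs) ≡⟨ ↭-length perm ⟨
  length (gapSets g) ∎
  where open ≤-Reasoning

totalMoment : ℕ → ℕ
totalMoment g = sumOn weight² (gapSets g)

-- The two ends of an enclosure a / b < a′ / b′ differ by 1 / (b b′) ≤ 1 / e.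
module _ (a b a′ b′ e M x : ℕ) where

  open ≤-Reasoning

  -- The bound comes with the upper end a′ / b′, but membership in the lower cut has to be certified
  -- by a rational below the limit, hence by the lower end a / b; `transfer-lower` does the reverse.
  -- The constant 500 covers 401 + 1 here and 2 + 1 there, and is a multiple of 5 in view of e = 5
  -- s.
  transfer-upper : .{{_ : NonZero b′}} → a′ * b ≡ a * b′ + 1 → e ≤ b * b′ →
    100 * b′ * e * M ≤ (a′ * e + 401 * b′) * x → 100 * b * e * M ≤ (a * e + 500 * b) * x
  transfer-upper det e≤ le = *-cancelˡ-≤ b′ (begin
    b′ * (100 * b * e * M) ≡⟨ lem₁ b′ b e M 100 ⟩
    b * (100 * b′ * e * M) ≤⟨ *-monoʳ-≤ b le ⟩
    b * ((a′ * e + 401 * b′) * x) ≡⟨ lem₂ b a′ e b′ x 401 ⟩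
    (a′ * b * e + 401 * (b * b′)) * x ≡⟨ cong (λ z → (z * e + 401 * (b * b′)) * x) det ⟩
    ((a * b′ + 1) * e + 401 * (b * b′)) * x
      ≤⟨ *-monoˡ-≤ x (lin {e} {b * b′} {(a * b′ + 1) * e + 401 * (b * b′)} {b′ * (a * e + 500 * b)} (98 * (b * b′)) e≤ (lem₃ a b b′ e 401 98)) ⟩
    b′ * (a * e + 500 * b) * x ≡⟨ *-assoc b′ (a * e + 500 * b) x ⟩
    b′ * ((a * e + 500 * b) * x) ∎)
    where
    lem₁ : ∀ b′ b e m h → b′ * (h * b * e * m) ≡ b * (h * b′ * e * m)
    lem₁ = solve-∀
    lem₂ : ∀ b a e b′ x h → b * ((a * e + h * b′) * x) ≡ (a * b * e + h * (b * b′)) * x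
    lem₂ = solve-∀
    lem₃ : ∀ a b b′ e h k → b′ * (a * e + (h + 1 + k) * b) + e ≡ (a * b′ + 1) * e + h * (b * b′) + b * b′ + k * (b * b′)
    lem₃ = solve-∀

  transfer-lower : .{{_ : NonZero b}} → a′ * b ≡ a * b′ + 1 → e ≤ b * b′ →
    a * e * x ≤ 100 * b * e * M + 2 * b * x → a′ * e * x ≤ 100 * b′ * e * M + 500 * b′ * x
  transfer-lower det e≤ le = *-cancelˡ-≤ b (begin
    b * (a′ * e * x) ≡⟨ lem₁ b a′ e x ⟩
    a′ * b * e * x ≡⟨ cong (λ z → z * e * x) det ⟩
    (a * b′ + 1) * e * x ≡⟨ lem₂ a b′ e x ⟩
    b′ * (a * e * x) + e * x ≤⟨ *-monoʳ-≤ b′ le ⊕ *-monoˡ-≤ x e≤ ⟩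
    b′ * (100 * b * e * M + 2 * b * x) + b * b′ * x
      ≤⟨ lin {0} {0} {b′ * (100 * b * e * M + 2 * b * x) + b * b′ * x} {b * (100 * b′ * e * M + 500 * b′ * x)} (497 * (b * b′ * x)) z≤n (lem₃ b′ b e M x 100 497) ⟩
    b * (100 * b′ * e * M + 500 * b′ * x) ∎)
    where
    lem₁ : ∀ b a e x → b * (a * e * x) ≡ a * b * e * x
    lem₁ = solve-∀
    lem₂ : ∀ a b e x → (a * b + 1) * e * x ≡ b * (a * e * x) + e * x
    lem₂ = solve-∀
    lem₃ : ∀ b′ b e m x h k → b * (h * b′ * e * m + (3 + k) * b′ * x) + 0 ≡ b′ * (h * b * e * m + 2 * b * x) + b * b′ * x + 0 + k * (b * b′ * x)
    lem₃ = solve-∀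

module _ (g D i : ℕ) (large : 3 * D + (4 + 2 * i) ≤ g) where

  open Enclosure (enclosure i)

  private
    α = Z (1 + 2 * i)
    β = Z (2 + 2 * i)
    C = classError D
    g³ = g * g * g
    g⁴ = g * g³
    Ps = prefixes D
    3D≤g : 3 * D ≤ g
    3D≤g = ≤-trans (m≤m+n _ _) large
    3D+2≤g : 3 * D + 2 ≤ g
    3D+2≤g = ≤-trans (+-monoʳ-≤ (3 * D) (m≤m+n 2 (2 + 2 * i))) large
    W = sumOn (classMoment g) Ps
    A = sumOn (λ p → Z (g ∸ sum p)) Ps
    late : ∀ p → p ∈ Ps → 2 + 2 * i ≤ g ∸ sum p ∸ 2
    late p p∈ = m+n≤o⇒m≤o∸n (2 + 2 * i) (m+n≤o⇒m≤o∸n (2 + 2 * i + 2) (≤-trans (+-monoʳ-≤ (2 + 2 * i + 2) (sum≤3D {D} p∈)) (≤-trans (≤-reflexive (lem i D)) large)))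
      where
      lem : ∀ i D → 2 + 2 * i + 2 + 3 * D ≡ 3 * D + (4 + 2 * i)
      lem = solve-∀
    n≡ : ∀ p → p ∈ Ps → 2 + (g ∸ sum p ∸ 2) ≡ g ∸ sum p
    n≡ p p∈ = m+[n∸m]≡n (m+n≤o⇒m≤o∸n 2 (≤-trans (+-monoʳ-≤ 2 (sum≤3D {D} p∈)) (≤-trans (≤-reflexive (+-comm 2 (3 * D))) 3D+2≤g)))

  open ≤-Reasoning

  good-upper : 100 * (β + α + β) * sumOn weight² (goodSets g D) ≤ (g⁴ * β + C * (β + α + β) * g³) * length (goodSets g D)
  good-upper = begin
    100 * b′ * sumOn weight² (goodSets g D) ≡⟨ cong (100 * b′ *_) (moment-goodSets g D) ⟩
    100 * b′ * W ≡⟨ sumOn-*ˡ (100 * b′) (classMoment g) Ps ⟨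
    sumOn (λ p → 100 * b′ * classMoment g p) Ps ≤⟨ sumOn-mono Ps each ⟩
    sumOn (λ p → (g⁴ * β + C * b′ * g³) * Z (g ∸ sum p)) Ps ≡⟨ sumOn-*ˡ (g⁴ * β + C * b′ * g³) (λ p → Z (g ∸ sum p)) Ps ⟩
    (g⁴ * β + C * b′ * g³) * A ≡⟨ cong ((g⁴ * β + C * b′ * g³) *_) (length-goodSets g D 3D≤g) ⟨
    (g⁴ * β + C * b′ * g³) * length (goodSets g D) ∎
    where
    b′ = β + α + β
    each : ∀ p → p ∈ Ps → 100 * b′ * classMoment g p ≤ (g⁴ * β + C * b′ * g³) * Z (g ∸ sum p)
    each p p∈ = begin
      100 * b′ * w ≡⟨ lem₁ b′ w 100 ⟩
      b′ * (100 * w) ≤⟨ *-monoʳ-≤ b′ (classMoment-upper g D p∈ 3D+2≤g) ⟩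
      b′ * (g⁴ * z + C * (g³ * Zn)) ≡⟨ lem₂ b′ g⁴ z C g³ Zn ⟩
      g⁴ * (b′ * z) + C * b′ * g³ * Zn ≤⟨ +-monoˡ-≤ (C * b′ * g³ * Zn) (*-monoʳ-≤ g⁴ (subst (λ n → b′ * z ≤ β * Z n) (n≡ p p∈) (above _ (late p p∈)))) ⟩
      g⁴ * (β * Zn) + C * b′ * g³ * Zn ≡⟨ lem₃ g⁴ β Zn (C * b′ * g³) ⟩
      (g⁴ * β + C * b′ * g³) * Zn ∎
      where
      w = classMoment g p
      z = Z (g ∸ sum p ∸ 2)
      Zn = Z (g ∸ sum p)
      lem₁ : ∀ b w h → h * b * w ≡ b * (h * w)
      lem₁ = solve-∀
      lem₂ : ∀ b f z C c y → b * (f * z + C * (c * y)) ≡ f * (b * z) + C * b * c * y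
      lem₂ = solve-∀
      lem₃ : ∀ f b y x → f * (b * y) + x * y ≡ (f * b + x) * y
      lem₃ = solve-∀

  good-lower : α * g⁴ * length (goodSets g D) ≤ 100 * (β + α) * sumOn weight² (goodSets g D) + C * (β + α) * g³ * length (goodSets g D)
  good-lower = begin
    α * g⁴ * length (goodSets g D) ≡⟨ cong (α * g⁴ *_) (length-goodSets g D 3D≤g) ⟩
    α * g⁴ * A ≡⟨ sumOn-*ˡ (α * g⁴) (λ p → Z (g ∸ sum p)) Ps ⟨
    sumOn (λ p → α * g⁴ * Z (g ∸ sum p)) Ps ≤⟨ sumOn-mono Ps each ⟩
    sumOn (λ p → 100 * b * classMoment g p + C * b * g³ * Z (g ∸ sum p)) Ps
      ≡⟨ trans (sumOn-+ (λ p → 100 * b * classMoment g p) (λ p → C * b * g³ * Z (g ∸ sum p)) Ps)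
           (cong₂ _+_ (sumOn-*ˡ (100 * b) (classMoment g) Ps) (sumOn-*ˡ (C * b * g³) (λ p → Z (g ∸ sum p)) Ps)) ⟩
    100 * b * W + C * b * g³ * A ≡⟨ cong₂ (λ x y → 100 * b * x + C * b * g³ * y) (moment-goodSets g D) (length-goodSets g D 3D≤g) ⟨
    100 * b * sumOn weight² (goodSets g D) + C * b * g³ * length (goodSets g D) ∎
    where
    b = β + α
    each : ∀ p → p ∈ Ps → α * g⁴ * Z (g ∸ sum p) ≤ 100 * b * classMoment g p + C * b * g³ * Z (g ∸ sum p)
    each p p∈ = begin
      α * g⁴ * Zn ≡⟨ lem₁ α g⁴ Zn ⟩
      g⁴ * (α * Zn) ≤⟨ *-monoʳ-≤ g⁴ (subst (λ n → α * Z n ≤ b * z) (n≡ p p∈) (below _ (late p p∈))) ⟩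
      g⁴ * (b * z) ≡⟨ lem₂ g⁴ b z ⟩
      b * (g⁴ * z) ≤⟨ *-monoʳ-≤ b (classMoment-lower g D p∈ 3D+2≤g) ⟩
      b * (100 * w + C * (g³ * Zn)) ≡⟨ lem₃ b w C g³ Zn 100 ⟩
      100 * b * w + C * b * g³ * Zn ∎
      where
      w = classMoment g p
      z = Z (g ∸ sum p ∸ 2)
      Zn = Z (g ∸ sum p)
      lem₁ : ∀ a f y → a * f * y ≡ f * (a * y)
      lem₁ = solve-∀
      lem₂ : ∀ f b z → f * (b * z) ≡ b * (f * z)
      lem₂ = solve-∀
      lem₃ : ∀ b w C c y h → b * (h * w + C * (c * y)) ≡ h * b * w + C * b * c * y
      lem₃ = solve-∀

  module _ (e : ℕ) (e-tail : e * length (tailCodes g D) ≤ Z g) (eC≤g : e * C ≤ g) (e≤ : e ≤ (β + α) * (β + α + β)) where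

    private
      dec = decompose g D 3D≤g (≤-trans (≤-trans (s≤s z≤n) (m≤n+m (4 + 2 * i) (3 * D))) large)
      module Split = Decomposition dec
      n = length (gapSets g)
      a = α
      b = β + α
      a′ = β
      b′ = β + α + β
      Wg = sumOn weight² (goodSets g D)
      Ag = length (goodSets g D)
      Wt = sumOn weight² Split.rest
      t = length Split.rest
      num : totalMoment g ≡ Wg + Wt
      num = trans (sumOn-↭ weight² Split.perm) (sumOn-++ weight² (goodSets g D) Split.rest)
      count : n ≡ Ag + t
      count = trans (↭-length Split.perm) (length-++ (goodSets g D))
      et≤n : e * t ≤ n
      et≤n = ≤-trans (*-monoʳ-≤ e Split.rest≤) (≤-trans e-tail (Z≤count g))
      Ag≤n : Ag ≤ n
      Ag≤n = ≤-trans (m≤m+n Ag t) (≤-reflexive (sym count))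
      eCg³ : e * C * g³ ≤ g⁴
      eCg³ = *-monoˡ-≤ g³ eC≤g
      Wt≤ : Wt ≤ t * (4 * g⁴)
      Wt≤ = ≤-trans (sumOn-mono Split.rest (λ H H∈ → weight-bound g (kunzData g (Split.rest⊆ H H∈)))) (≤-reflexive (sumOn-const (4 * g⁴) Split.rest))
      det : a′ * b ≡ a * b′ + 1
      det = trans (trans (*-distribˡ-+ β β α) (cong (_+ β * α) (sym (cassini i)))) (lem α β)
        where
        lem : ∀ α β → α * α + α * β + 1 + β * α ≡ α * (β + α + β) + 1
        lem = solve-∀

      -- 401 = 100 · 4 + 1: the at most n / e remaining sets have squared weight at most 4 g⁴ each,
      -- and the class errors add 1 because e C g³ ≤ g⁴.
      upper₀ : 100 * b′ * e * totalMoment g ≤ (a′ * e + 401 * b′) * (g⁴ * n)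
      upper₀ = begin
        100 * b′ * e * totalMoment g ≡⟨ trans (cong (100 * b′ * e *_) num) (lem₁ b′ e Wg Wt 100) ⟩
        e * (100 * b′ * Wg) + 100 * b′ * e * Wt ≤⟨ *-monoʳ-≤ e good-upper ⊕ *-monoʳ-≤ (100 * b′ * e) Wt≤ ⟩
        e * ((g⁴ * a′ + C * b′ * g³) * Ag) + 100 * b′ * e * (t * (4 * g⁴))
          ≡⟨ lem₂ e g⁴ a′ C b′ g³ Ag t 100 4 ⟩
        (e * a′ * g⁴ + e * C * g³ * b′) * Ag + 100 * 4 * b′ * g⁴ * (e * t)
          ≤⟨ *-mono-≤ (+-monoʳ-≤ (e * a′ * g⁴) (*-monoˡ-≤ b′ eCg³)) Ag≤n ⊕ *-monoʳ-≤ (100 * 4 * b′ * g⁴) et≤n ⟩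
        (e * a′ * g⁴ + g⁴ * b′) * n + 100 * 4 * b′ * g⁴ * n ≡⟨ lem₃ e a′ g⁴ b′ n 400 ⟩
        (a′ * e + 401 * b′) * (g⁴ * n) ∎
        where
        lem₁ : ∀ b e x y h → h * b * e * (x + y) ≡ e * (h * b * x) + h * b * e * y
        lem₁ = solve-∀
        lem₂ : ∀ e f a C b c A t h q → e * ((f * a + C * b * c) * A) + h * b * e * (t * (q * f)) ≡ (e * a * f + e * C * c * b) * A + h * q * b * f * (e * t)
        lem₂ = solve-∀
        lem₃ : ∀ e a f b n h → (e * a * f + f * b) * n + h * b * f * n ≡ (a * e + suc h * b) * (f * n)
        lem₃ = solve-∀

      a≤b : a ≤ b
      a≤b = m≤n+m α β

      -- The factor 2 is one for the class errors and one for the at most n / e sets that are not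
      -- good.
      lower₀ : a * e * (g⁴ * n) ≤ 100 * b * e * totalMoment g + 2 * b * (g⁴ * n)
      lower₀ = begin
        a * e * (g⁴ * n) ≡⟨ trans (cong (λ z → a * e * (g⁴ * z)) count) (lem₁ a e g⁴ Ag t) ⟩
        e * (a * g⁴ * Ag) + a * g⁴ * (e * t) ≤⟨ *-monoʳ-≤ e good-lower ⊕ *-mono-≤ (*-monoˡ-≤ g⁴ a≤b) et≤n ⟩
        e * (100 * b * Wg + C * b * g³ * Ag) + b * g⁴ * n ≡⟨ lem₂ e b Wg C g³ Ag g⁴ n 100 ⟩
        100 * b * e * Wg + (e * C * g³ * b * Ag + b * g⁴ * n)
          ≤⟨ *-monoʳ-≤ (100 * b * e) (≤-trans (m≤m+n Wg Wt) (≤-reflexive (sym num))) ⊕ +-monoˡ-≤ (b * g⁴ * n) (*-mono-≤ (*-monoˡ-≤ b eCg³) Ag≤n) ⟩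
        100 * b * e * totalMoment g + (g⁴ * b * n + b * g⁴ * n) ≡⟨ cong (100 * b * e * totalMoment g +_) (lem₃ g⁴ b n) ⟩
        100 * b * e * totalMoment g + 2 * b * (g⁴ * n) ∎
        where
        lem₁ : ∀ a e f A t → a * e * (f * (A + t)) ≡ e * (a * f * A) + a * f * (e * t)
        lem₁ = solve-∀
        lem₂ : ∀ e b W C c A f n h → e * (h * b * W + C * b * c * A) + b * f * n ≡ h * b * e * W + (e * C * c * b * A + b * f * n)
        lem₂ = solve-∀
        lem₃ : ∀ f b n → f * b * n + b * f * n ≡ 2 * b * (f * n)
        lem₃ = solve-∀

    moment-upper : 100 * b * e * totalMoment g ≤ (a * e + 500 * b) * (g⁴ * n)
    moment-upper = transfer-upper a b a′ b′ e (totalMoment g) (g⁴ * n) {{>-nonZero (Z-pos (4 + 2 * i))}} det e≤ upper₀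

    moment-lower : a′ * e * (g⁴ * n) ≤ 100 * b′ * e * totalMoment g + 500 * b′ * (g⁴ * n)
    moment-lower = transfer-lower a b a′ b′ e (totalMoment g) (g⁴ * n) {{>-nonZero (Z-pos (3 + 2 * i))}} det e≤ lower₀

-- The limit

ratio : (x y : ℕ) → .{{NonZero y}} → ℚᵘ
ratio x y = mkℚᵘ (ℤ.+ x) (pred y)

ratio-≤ : ∀ x y x′ y′ .{{_ : NonZero y}} .{{_ : NonZero y′}} → x * y′ ≤ x′ * y → ratio x y ℚ.≤ ratio x′ y′
ratio-≤ x (suc y) x′ (suc y′) le = *≤* (subst₂ ℤ._≤_ (ℤP.pos-* x (suc y′)) (ℤP.pos-* x′ (suc y)) (ℤ.+≤+ le))

ratio-< : ∀ x y x′ y′ .{{_ : NonZero y}} .{{_ : NonZero y′}} → x * y′ < x′ * y → ratio x y ℚ.< ratio x′ y′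
ratio-< x (suc y) x′ (suc y′) lt = *<* (subst₂ ℤ._<_ (ℤP.pos-* x (suc y′)) (ℤP.pos-* x′ (suc y)) (ℤ.+<+ lt))

ratio-≃ : ∀ x y x′ y′ .{{_ : NonZero y}} .{{_ : NonZero y′}} → x * y′ ≡ x′ * y → ratio x y ℚ.≃ ratio x′ y′
ratio-≃ x (suc y) x′ (suc y′) eq = *≡* (trans (sym (ℤP.pos-* x (suc y′))) (trans (cong ℤ.+_ eq) (ℤP.pos-* x′ (suc y))))

ratio-* : ∀ x y x′ y′ .{{_ : NonZero y}} .{{_ : NonZero y′}} → ratio x y ℚ.* ratio x′ y′ ≡ ratio (x * x′) (y * y′) {{m*n≢0 y y′}}
ratio-* x (suc y) x′ (suc y′) = cong (λ z → mkℚᵘ z (pred (suc y * suc y′))) (sym (ℤP.pos-* x x′))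

ratio-+ : ∀ x y x′ y′ .{{_ : NonZero y}} .{{_ : NonZero y′}} → ratio x y ℚ.+ ratio x′ y′ ≡ ratio (x * y′ + x′ * y) (y * y′) {{m*n≢0 y y′}}
ratio-+ x (suc y) x′ (suc y′) = cong (λ z → mkℚᵘ z (pred (suc y * suc y′)))
  (trans (cong₂ ℤ._+_ (sym (ℤP.pos-* x (suc y′))) (sym (ℤP.pos-* x′ (suc y)))) (sym (ℤP.pos-+ (x * suc y′) (x′ * suc y))))

+-cancel-ℚ : ∀ p q → (p ℚ.+ q) ℚ.- q ℚ.≃ p
+-cancel-ℚ p q = ℚP.≃-trans (ℚP.+-assoc p q (ℚ.- q)) (ℚP.≃-trans (ℚP.+-congʳ p (ℚP.+-inverseʳ q)) (ℚP.+-identityʳ p))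

c3-200-antitone : ∀ {p q} → p ℚ.≤ q → c3-200 q ℚ.≤ c3-200 p
c3-200-antitone p≤q = ℚP.+-monoʳ-≤ (mkℚᵘ (ℤ.+ 3) 0) (ℚP.neg-mono-≤ (ℚP.*-monoʳ-≤-nonNeg (mkℚᵘ (ℤ.+ 200) 0) p≤q))

-- Here r stands for 3 b - 2 a, because 200 a / (100 b) = 2 a / b.
c3-200-ratio : ∀ a b r .{{_ : NonZero b}} → r + 2 * a ≡ 3 * b → c3-200 (ratio a (100 * b) {{m*n≢0 100 b}}) ℚ.≃ ratio r b
c3-200-ratio a b r eq = ℚP.≃-trans (ℚP.+-cong {x = mkℚᵘ (ℤ.+ 3) 0} three (ℚP.-‿cong twice)) (+-cancel-ℚ (ratio r b) (ratio (2 * a) b))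
  where
  instance
    nz : NonZero (100 * b)
    nz = m*n≢0 100 b
    nz′ : NonZero (1 * (100 * b))
    nz′ = m*n≢0 1 (100 * b)
    nz″ : NonZero (b * b)
    nz″ = m*n≢0 b b
  twice : ratio 200 1 ℚ.* ratio a (100 * b) ℚ.≃ ratio (2 * a) b
  twice = ℚP.≃-trans (ℚP.≃-reflexive (ratio-* 200 1 a (100 * b))) (ratio-≃ (200 * a) (1 * (100 * b)) (2 * a) b (lem a b 2 100))
    where
    lem : ∀ a b t h → t * h * a * b ≡ t * a * (1 * (h * b))
    lem = solve-∀
  three : ratio 3 1 ℚ.≃ ratio r b ℚ.+ ratio (2 * a) b
  three = ℚP.≃-trans (ratio-≃ 3 1 (r * b + 2 * a * b) (b * b)
      (trans (lem b) (trans (cong (_* b) (sym eq)) (lem₂ r (2 * a) b)))) (ℚP.≃-reflexive (sym (ratio-+ r b (2 * a) b)))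
    where
    lem : ∀ b → 3 * (b * b) ≡ 3 * b * b
    lem = solve-∀
    lem₂ : ∀ r a b → (r + a) * b ≡ (r * b + a * b) * 1
    lem₂ = solve-∀

below-L : ∀ a b r .{{_ : NonZero b}} → r + 2 * a ≡ 3 * b → 5 * (b * b) < r * r →
  ∀ {q} → q ℚ.≤ ratio a (100 * b) {{m*n≢0 100 b}} → q <L
below-L a b r eq sq {q} q≤ = ℚP.<-≤-trans r>0 r≤c , ℚP.<-≤-trans r²>5 (ℚP.*-mono-≤-nonNeg {{_}} {{_}} r≤c r≤c)
  where
  instance
    nz : NonZero (b * b)
    nz = m*n≢0 b b
  r≤c : ratio r b ℚ.≤ c3-200 q
  r≤c = ℚP.≤-respˡ-≃ (c3-200-ratio a b r eq) (c3-200-antitone q≤)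
  0<r : 0 < r
  0<r = n≢0⇒n>0 (λ { refl → contradiction sq λ () })
  r>0 : 0ℚᵘ ℚ.< ratio r b
  r>0 = ratio-< 0 1 r b (≤-trans 0<r (≤-reflexive (sym (*-identityʳ r))))
  r²>5 : mkℚᵘ (ℤ.+ 5) 0 ℚ.< ratio r b ℚ.* ratio r b
  r²>5 = subst (mkℚᵘ (ℤ.+ 5) 0 ℚ.<_) (sym (ratio-* r b r b)) (ratio-< 5 1 (r * r) (b * b) (≤-trans sq (≤-reflexive (sym (*-identityʳ (r * r))))))

above-L : ∀ a b r .{{_ : NonZero b}} → r + 2 * a ≡ 3 * b → r * r < 5 * (b * b) →
  ∀ {q} → ratio a (100 * b) {{m*n≢0 100 b}} ℚ.≤ q → L< q
above-L a b r eq sq {q} ≤q with ℚP.≤-total (c3-200 q) 0ℚᵘ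
... | inj₁ c≤0 = inj₁ c≤0
... | inj₂ 0≤c = inj₂ (ℚP.≤-<-trans (ℚP.*-mono-≤-nonNeg {{ℚ.nonNegative 0≤c}} {{ℚ.nonNegative 0≤c}} c≤r c≤r) r²<5)
  where
  instance
    nz : NonZero (b * b)
    nz = m*n≢0 b b
  c≤r : c3-200 q ℚ.≤ ratio r b
  c≤r = ℚP.≤-respʳ-≃ (c3-200-ratio a b r eq) (c3-200-antitone ≤q)
  r²<5 : ratio r b ℚ.* ratio r b ℚ.< mkℚᵘ (ℤ.+ 5) 0
  r²<5 = subst (ℚ._< mkℚᵘ (ℤ.+ 5) 0) (sym (ratio-* r b r b)) (ratio-< (r * r) (b * b) 5 1 (≤-trans (s≤s (≤-reflexive (*-identityʳ (r * r)))) sq))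

module _ (a b r a′ b′ r′ s M N : ℕ) .{{_ : NonZero b}} .{{_ : NonZero b′}} .{{_ : NonZero s}} .{{_ : NonZero N}}
  (r≡ : r + 2 * a ≡ 3 * b) (r²> : 5 * (b * b) < r * r) (r′≡ : r′ + 2 * a′ ≡ 3 * b′) (r′²< : r′ * r′ < 5 * (b′ * b′))
  (upper : M * (100 * b * s) ≤ (a * s + 1 * (100 * b)) * N) (lower : a′ * (N * s) ≤ (M * s + 1 * N) * (100 * b′)) where

  private
    instance
      nz₁ : NonZero (100 * b)
      nz₁ = m*n≢0 100 b
      nz₂ : NonZero (100 * b′)
      nz₂ = m*n≢0 100 b′
      nz₃ : NonZero (100 * b * s)
      nz₃ = m*n≢0 (100 * b) s
      nz₄ : NonZero (N * s)
      nz₄ = m*n≢0 N s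

  enclosed⇒near-L : ∀ ε → ratio 1 s ℚ.≤ ε → ((ratio M N ℚ.- ε) <L) × (L< (ratio M N ℚ.+ ε))
  enclosed⇒near-L ε δ≤ε =
      below-L a b r r≡ r²> (ℚP.≤-trans (ℚP.+-monoˡ-≤ (ℚ.- ε) (ℚP.≤-trans M≤ (ℚP.+-monoʳ-≤ (ratio a (100 * b)) δ≤ε)))
        (ℚP.≤-reflexive (+-cancel-ℚ (ratio a (100 * b)) ε)))
    , above-L a′ b′ r′ r′≡ r′²< (ℚP.≤-trans ≤M (ℚP.+-monoʳ-≤ (ratio M N) δ≤ε))
    where
    M≤ : ratio M N ℚ.≤ ratio a (100 * b) ℚ.+ ratio 1 s
    M≤ = subst (ratio M N ℚ.≤_) (sym (ratio-+ a (100 * b) 1 s)) (ratio-≤ M N (a * s + 1 * (100 * b)) (100 * b * s) upper)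
    ≤M : ratio a′ (100 * b′) ℚ.≤ ratio M N ℚ.+ ratio 1 s
    ≤M = subst (ratio a′ (100 * b′) ℚ.≤_) (sym (ratio-+ M N 1 s)) (ratio-≤ a′ (100 * b′) (M * s + 1 * N) (N * s) lower)

frac≡ratio : ∀ x y .{{_ : NonZero y}} → frac x y ≡ ratio x y
frac≡ratio x (suc y) = refl

n≤Z : ∀ n → n ≤ Z n
n≤Z zero                = z≤n
n≤Z (suc zero)          = ≤-refl
n≤Z (suc (suc zero))    = ≤-refl
n≤Z (suc (suc (suc n))) = ≤-trans (≤-reflexive (+-comm 1 (2 + n))) (n≤Z (suc (suc n)) ⊕ Z-pos (suc n))

divide-upper : ∀ a b s M x → 100 * b * (5 * s) * M ≤ (a * (5 * s) + 500 * b) * x → M * (100 * b * s) ≤ (a * s + 1 * (100 * b)) * x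
divide-upper a b s M x le = *-cancelˡ-≤ 5 (subst₂ _≤_ (lem₁ b s M 100 5) (lem₂ a b s x 5 100) le)
  where
  lem₁ : ∀ b s M h f → h * b * (f * s) * M ≡ f * (M * (h * b * s))
  lem₁ = solve-∀
  lem₂ : ∀ a b s x f h → (a * (f * s) + f * h * b) * x ≡ f * ((a * s + 1 * (h * b)) * x)
  lem₂ = solve-∀

divide-lower : ∀ a b s M x → a * (5 * s) * x ≤ 100 * b * (5 * s) * M + 500 * b * x → a * (x * s) ≤ (M * s + 1 * x) * (100 * b)
divide-lower a b s M x le = *-cancelˡ-≤ 5 (subst₂ _≤_ (lem₁ a s x 5) (lem₂ b s M x 5 100) le)
  where
  lem₁ : ∀ a s x f → a * (f * s) * x ≡ f * (a * (x * s))
  lem₁ = solve-∀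
  lem₂ : ∀ b s M x f h → h * b * (f * s) * M + f * h * b * x ≡ f * ((M * s + 1 * x) * (h * b))
  lem₂ = solve-∀

-- For a / b = α / (α + β) one has (3 b − 2 a)² − 5 b² = 4 (β² − α β − α²) = 4; for β / (α + 2 β) this is −4.
module _ (α β : ℕ) (det : α * α + α * β + 1 ≡ β * β) where

  low-square : 5 * ((β + α) * (β + α)) < (3 * β + α) * (3 * β + α)
  low-square = lin 3 (≤-reflexive (cong (4 *_) det)) (lem α β)
    where
    lem : ∀ α β → (3 * β + α) * (3 * β + α) + 4 * (α * α + α * β + 1) ≡ suc (5 * ((β + α) * (β + α))) + 4 * (β * β) + 3
    lem = solve-∀

  high-square : (4 * β + 3 * α) * (4 * β + 3 * α) < 5 * ((β + α + β) * (β + α + β))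
  high-square = lin 3 (≤-reflexive (cong (4 *_) det)) (lem α β)
    where
    lem : ∀ α β → 5 * ((β + α + β) * (β + α + β)) + 4 * (α * α + α * β + 1) ≡ suc ((4 * β + 3 * α) * (4 * β + 3 * α)) + 4 * (β * β) + 3
    lem = solve-∀

-- The number e = 5 s is both the precision and the index of the enclosure: by `n≤Z` its
-- denominators are at least e, so its length is at most 1 / e.
near-L : ∀ s .{{_ : NonZero s}} D g → 5 * s * length (tailCodes g D) ≤ Z g → 5 * s * classError D ≤ g → 3 * D + (4 + 2 * (5 * s)) ≤ g →
  ∀ ε → ratio 1 s ℚ.≤ ε → ((normalisedSecondMoment g ℚ.- ε) <L) × (L< (normalisedSecondMoment g ℚ.+ ε))
near-L s D g small eC≤g large ε δ≤ε = subst (λ q → ((q ℚ.- ε) <L) × (L< (q ℚ.+ ε))) (sym M≡)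
  (enclosed⇒near-L α (β + α) (3 * β + α) β (β + α + β) (4 * β + 3 * α) s (totalMoment g) N
    (lem₁ α β) (low-square α β det) (lem₂ α β) (high-square α β det)
    (divide-upper α (β + α) s (totalMoment g) N (subst (λ x → 100 * (β + α) * e * totalMoment g ≤ (α * e + 500 * (β + α)) * x) N≡ (moment-upper g D e large e small eC≤g e≤)))
    (divide-lower β (β + α + β) s (totalMoment g) N (subst (λ x → β * e * x ≤ 100 * (β + α + β) * e * totalMoment g + 500 * (β + α + β) * x) N≡ (moment-lower g D e large e small eC≤g e≤)))
    ε δ≤ε)
  where
  e = 5 * s
  α = Z (1 + 2 * e)
  β = Z (2 + 2 * e)
  n = length (gapSets g)
  N = n * g ^ 4
  det = cassini e
  1≤g : 1 ≤ g
  1≤g = ≤-trans (≤-trans (s≤s z≤n) (m≤n+m (4 + 2 * e) (3 * D))) large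
  instance
    nzb : NonZero (β + α)
    nzb = >-nonZero (Z-pos (3 + 2 * e))
    nzb′ : NonZero (β + α + β)
    nzb′ = >-nonZero (Z-pos (4 + 2 * e))
    nzN : NonZero N
    nzN = m*n≢0 n (g ^ 4) {{>-nonZero (≤-trans (Z-pos g) (Z≤count g))}} {{m^n≢0 g 4 {{>-nonZero 1≤g}}}}
  M≡ : normalisedSecondMoment g ≡ ratio (totalMoment g) N
  M≡ = frac≡ratio (totalMoment g) N
  N≡ : g * (g * g * g) * n ≡ N
  N≡ = lem g n
    where
    lem : ∀ g n → g * (g * g * g) * n ≡ n * (g * (g * (g * (g * 1))))
    lem = solve-∀
  e≤ : e ≤ (β + α) * (β + α + β)
  e≤ = ≤-trans (≤-trans (≤-trans (m≤m+n e (1 * e)) (m≤n+m (2 * e) 3)) (n≤Z (3 + 2 * e))) (m≤m*n (β + α) (β + α + β))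
  lem₁ : ∀ α β → 3 * β + α + 2 * α ≡ 3 * (β + α)
  lem₁ = solve-∀
  lem₂ : ∀ α β → 4 * β + 3 * α + 2 * β ≡ 3 * (β + α + β)
  lem₂ = solve-∀

theorem7p1 : (ε : ℚᵘ) → 0ℚᵘ ℚ.< ε →
  ∃ λ (G : ℕ) → (g : ℕ) → G ≤ g →
    ((normalisedSecondMoment g ℚ.- ε) <L) × (L< (normalisedSecondMoment g ℚ.+ ε))
theorem7p1 (mkℚᵘ (ℤ.+ zero) d) (*<* (ℤ.+<+ ()))
theorem7p1 (mkℚᵘ (ℤ.-[1+ p ]) d) (*<* ())
-- ε = (p + 1) / (d + 1) is at least 1 / s for s = d + 1, so precision 1 / s is enough; the
-- threshold adds up the three lower bounds required of g.
theorem7p1 ε@(mkℚᵘ (ℤ.+ suc p) d) _ = from (tailCodes-small (5 * suc d))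
  where
  s = suc d
  from : (∃ λ D → ∃ λ G → ∀ g → G ≤ g → 5 * s * length (tailCodes g D) ≤ Z g) →
    ∃ λ (G : ℕ) → (g : ℕ) → G ≤ g → ((normalisedSecondMoment g ℚ.- ε) <L) × (L< (normalisedSecondMoment g ℚ.+ ε))
  from (D , G , small) = G + (5 * s * classError D + (3 * D + (4 + 2 * (5 * s)))) , λ g G≤g → near-L s D g
    (small g (≤-trans (m≤m+n G _) G≤g))
    (≤-trans (m≤m+n (5 * s * classError D) _) (≤-trans (m≤n+m _ G) G≤g))
    (≤-trans (m≤n+m _ (5 * s * classError D)) (≤-trans (m≤n+m _ G) G≤g))
    ε (ratio-≤ 1 s (suc p) s (*-monoˡ-≤ s (s≤s (z≤n {p}))))
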